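{- For any integer $n>3$, any $d>r$ (where $r>0$ is the range of transmission and $d$ is the Geocast eccentricity), any integers $\alpha\ge 0$, $\beta>0$, any $V_{\max}>\pi r/(6\alpha)$, and any oblivious randomized Geocast protocol $\Pi$, there exists an $(\alpha,\beta)$-connected MANET of $n$ nodes (node speeds bounded by $V_{\max}$) for which $\Pi$ takes at least $$\frac{\alpha n}{2}+\frac{n^2}{48e\ln(n/2)}$$ time slots in order to solve the problem with probability at least $2^{ -n/2}$.
   Context: **Model.** A MANET is a set $V$ of $n$ nodes in $\mathbb{R}^2$, no two at the same point at the same time. Time is divided into slots $1,2,\dots$; positions (hence topology) change only at slot boundaries, and no node moves faster than $V_{\max}$ (measured as distance per time slot). All nodes have the same range of transmission $r>0$; two nodes are neighbors in a slot if their distance is at most $r$ during the whole slot. An active node $u$ receives a transmission from a neighbor $v$ in a slot if and only if $v$ is the only node transmitting in that slot among $u$ and its neighbors. There is no collision detection. Nodes may be activated at any slot boundary, and may fail (become inactive) and be reactivated; upon activation a node starts its algorithm from scratch, keeping no state. Slots counted from a node's activation are its (local) steps. **Geocast.** A source node $s$ holds a piece of information $I$ at time $t_1$. $I$ must be delivered to all nodes that at time $t_1$ are active and located within distance $d$ (the eccentricity) of the position of $s$ at that time. A node is covered if it has received $I$ (the source counts as covered from $t_1$), otherwise uncovered. A node is informed at time $t$ if it holds $I$ at time $t$. The problem is solved at slot $t_2\ge t_1$ if all target nodes are covered by slot $t_2$; the time taken is counted in slots from $t_1$. **$(\alpha,\beta)$-connectivity** (integers $\alpha\ge0$, $\beta\ge1$).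 For every slot $t\ge t_1$ at which the problem is not yet solved there is a slot $t'$ such that $[t,t+\alpha]\cap[t',t'+\beta)\neq\emptyset$, and there are nodes $p,p'$ such that at time $t'$ $p$ is informed and $p'$ is uncovered, and $p,p'$ are active and neighbors from step $t'$ until $p'$ becomes covered or until step $t'+\beta-1$ (inclusive), whichever occurs first. **Adversary.** Placement, movement and activation schedule (and the instance: source and $t_1$) are chosen by an adaptive adversary, which decides at the end of each slot with access to the protocol and all nodes' internal states but not to future random bits, subject to the speed bound and $(\alpha,\beta)$-connectivity. "There exists an $(\alpha,\beta)$-connected MANET" means that there is such an adversary strategy. Probability is over the protocol's random bits. **Protocols.** Protocols are conditional: a node does not transmit before it is covered. A randomized protocol is oblivious if it is given by a set $\{\pi_i : i\in V\}$ of sequences $\pi_i=\langle\pi_{i1},\pi_{i2},\dots\rangle$ of probabilities such that, in any execution, a covered node $i$ transmits independently with probability $\pi_{it}$ in the $t$-th step after its activation. For $\alpha=0$ the quantity $\pi r/(6\alpha)$ is read as $+\infty$ (there $\pi$ is the circle constant). -}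

module Defs where

open import Algebra.Bundles using (CommutativeRing)
open import Algebra.Structures using (IsCommutativeRing)
open import Data.Bool.Base using (Bool; true; false; T; if_then_else_)
open import Data.Bool.Properties using (T?)
open import Data.Empty using (⊥)
open import Data.Fin.Base using (Fin; zero; suc; toℕ)
open import Data.Fin.Properties using (_≟_; any?; all?)
open import Data.List.Base using (List; []; _∷_; length; drop)
open import Data.Nat.Base as ℕ using (ℕ; zero; suc; _!; _∸_)
import Data.Nat.Properties as ℕ
open import Data.Product.Base using (_×_; _,_; proj₁; proj₂; ∃; ∃-syntax)
open import Data.Sum.Base using (_⊎_)
open import Data.Vec.Base using (Vec; []; _∷_; lookup)
open import Function.Base using (_∘_)
open import Level using (0ℓ)
open import Relation.Binary.PropositionalEquality.Core using (_≡_; _≢_)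
open import Relation.Binary.Structures using (IsDecTotalOrder)
import Relation.Binary.Construct.NonStrictToStrict as Strict
open import Relation.Nullary.Decidable
  using (Dec; ¬?; ⌊_⌋; _×-dec_; _⊎-dec_; _→-dec_)
open import Relation.Nullary.Negation using (¬_)

-- The classical real numbers, axiomatised as a Dedekind-complete ordered
-- field (unique up to isomorphism).  Equality is a setoid equality so that,
-- under excluded middle, Cauchy sequences of rationals form a model.

record CompleteOrderedField : Set₁ where
  infix  8 -_ _⁻¹
  infixl 7 _*_
  infixl 6 _+_
  infix  4 _≈_ _≤_
  field
    Carrier           : Set
    _≈_ _≤_           : Carrier → Carrier → Set
    _+_ _*_           : Carrier → Carrier → Carrier
    -_ _⁻¹            : Carrier → Carrier
    0# 1#             : Carrier
    isCommutativeRing : IsCommutativeRing _≈_ _+_ _*_ -_ 0# 1#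
    isDecTotalOrder   : IsDecTotalOrder _≈_ _≤_
    0≉1               : ¬ 0# ≈ 1#
    -- 0# ⁻¹ is left unspecified
    *-inverseʳ        : ∀ x → ¬ x ≈ 0# → x * x ⁻¹ ≈ 1#
    +-monoˡ-≤         : ∀ z {x y} → x ≤ y → x + z ≤ y + z
    *-nonNeg          : ∀ {x y} → 0# ≤ x → 0# ≤ y → 0# ≤ x * y

  IsUpperBound : (Carrier → Set) → Carrier → Set
  IsUpperBound S u = ∀ x → S x → x ≤ u

  field
    complete : (S : Carrier → Set) → ∃ S → ∃ (IsUpperBound S) →
               ∃[ s ] IsUpperBound S s × (∀ u → IsUpperBound S u → s ≤ u)

  commutativeRing : CommutativeRing 0ℓ 0ℓ
  commutativeRing = record { isCommutativeRing = isCommutativeRing }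

module Reals (R : CompleteOrderedField) where

  open CompleteOrderedField R public renaming (Carrier to ℝ)
  open Strict _≈_ _≤_ public using (_<_)
  open CommutativeRing commutativeRing using (semiring; +-monoid; _-_) public
  open IsDecTotalOrder isDecTotalOrder public using (_≤?_)
  open import Algebra.Properties.Semiring.Exp semiring public using (_^_)
  open import Algebra.Properties.Semiring.Mult semiring
    using () renaming (_×_ to _·_)
  open import Algebra.Properties.Monoid.Sum +-monoid using (sum)

  infixl 7 _/_

  _/_ : ℝ → ℝ → ℝ
  x / y = x * y ⁻¹

  fromℕ : ℕ → ℝ
  fromℕ n = n · 1#

  -- v > x / m, where x / 0 is read as +∞.
  _>[_/_] : ℝ → ℝ → ℕ → Set
  v >[ x / zero    ] = ⊥
  v >[ x / m@(suc _) ] = x / fromℕ m < v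

  -- y = √x
  IsSqrt : ℝ → ℝ → Set
  IsSqrt x y = 0# ≤ y × y * y ≈ x

  -- ∣ s k - L ∣ < ε for all large k
  _⟶_ : (ℕ → ℝ) → ℝ → Set
  s ⟶ L = ∀ ε → 0# < ε →
    ∃[ N ] ∀ k → N ℕ.≤ k → L < s k + ε × s k < L + ε

  series : (ℕ → ℝ) → ℕ → ℝ
  series a k = sum {k} (a ∘ toℕ)

  -- y = exp x
  IsExp : ℝ → ℝ → Set
  IsExp x y = series (λ k → x ^ k / fromℕ (k !)) ⟶ y

  -- y = ln x
  IsLn : ℝ → ℝ → Set
  IsLn x y = IsExp y x

  -- y = sin x
  IsSin : ℝ → ℝ → Set
  IsSin x y =
    series (λ k → (- 1#) ^ k * x ^ (1 ℕ.+ 2 ℕ.* k) / fromℕ ((1 ℕ.+ 2 ℕ.* k) !)) ⟶ y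

  -- The circle constant is the least positive zero of sin.
  IsCircleConstant : ℝ → Set
  IsCircleConstant p =
    0# < p × IsSin p 0# × (∀ x → 0# < x → x < p → ¬ IsSin x 0#)

  Point : Set
  Point = ℝ × ℝ

  SamePoint : Point → Point → Set
  SamePoint (x , y) (x′ , y′) = x ≈ x′ × y ≈ y′

  sqDist : Point → Point → ℝ
  sqDist (x , y) (x′ , y′) = (x - x′) * (x - x′) + (y - y′) * (y - y′)

  -- Euclidean distance at most ρ, i.e. √(sqDist P Q) ≤ ρ
  Within : ℝ → Point → Point → Set
  Within ρ P Q = 0# ≤ ρ × sqDist P Q ≤ ρ * ρ

  within? : ∀ ρ P Q → Dec (Within ρ P Q)
  within? ρ P Q = (0# ≤? ρ) ×-dec (sqDist P Q ≤? ρ * ρ)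

  -- Expectation of f at a vector of independent bits, the i-th being true
  -- with probability p i.
  expect : ∀ {n} → (Fin n → ℝ) → (Vec Bool n → ℝ) → ℝ
  expect {zero}  p f = f []
  expect {suc n} p f = p zero * expect (p ∘ suc) (f ∘ (true ∷_))
                     + (1# - p zero) * expect (p ∘ suc) (f ∘ (false ∷_))

module Geocast (R : CompleteOrderedField) where

  open Reals R

  -- prob i k is the probability of the (k+1)-st local step: step 1 of the
  -- node has index 0.
  record ObliviousProtocol (n : ℕ) : Set where
    field
      prob   : Fin n → ℕ → ℝ
      prob≥0 : ∀ i k → 0# ≤ prob i k
      prob≤1 : ∀ i k → prob i k ≤ 1#

  -- The transmission pattern (who transmits) of every past slot, most
  -- recent first.  Slots are numbered from 0, so h : History n is a history
  -- at the beginning of slot `length h`.  As the adversary is deterministic,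
  -- h determines all past topologies and all internal states.
  History : ℕ → Set
  History n = List (Vec Bool n)

  -- pos h and active h are the configuration during slot `length h`, chosen
  -- at its start.  A node is activated at slot t if it is active in slot t
  -- but not in slot t - 1.
  -- No node can transmit before t₁, hence nothing is lost by fixing the
  -- instance (source, t₁) from the beginning.
  record Adversary (n : ℕ) (Vmax : ℝ) : Set where
    field
      pos      : History n → Fin n → Point
      active   : History n → Fin n → Bool
      source   : Fin n
      t₁       : ℕ
      distinct : ∀ h {i j} → i ≢ j → ¬ SamePoint (pos h i) (pos h j)
      speed    : ∀ h b i → Within Vmax (pos h i) (pos (b ∷ h) i)
      -- the source holds the information at t₁
      sourceActive : ∀ h → length h ≡ t₁ → T (active h source)

  module Execution {n : ℕ} {Vmax : ℝ} (r d : ℝ)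
                   (Π : ObliviousProtocol n) (𝒜 : Adversary n Vmax) where

    open ObliviousProtocol Π
    open Adversary 𝒜

    -- If i is active in the current slot, this is the number of steps it
    -- has completed since its activation.
    clock : History n → Fin n → ℕ
    clock []      i = 0
    clock (b ∷ h) i = if active h i then suc (clock h i) else 0

    Neighbors : History n → Fin n → Fin n → Set
    Neighbors h u v = u ≢ v × Within r (pos h u) (pos h v)

    -- u receives in the slot following h, with transmission pattern b
    Receives : History n → Vec Bool n → Fin n → Set
    Receives h b u = T (active h u) × ∃[ v ]
      Neighbors h u v × T (lookup b v) ×
      (∀ w → T (lookup b w) → w ≡ u ⊎ Neighbors h u w → w ≡ v)

    StartsAt : ℕ → Fin n → Set
    StartsAt t i = t ≡ t₁ × i ≡ source

    -- Covered h i and Informed h i refer to the beginning of slot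
    -- `length h`.  Coverage is permanent; holding the information is not,
    -- since a node that becomes inactive keeps no state.
    Covered : History n → Fin n → Set
    Covered []          i = StartsAt 0 i
    Covered h′@(b ∷ h)  i =
      StartsAt (length h′) i ⊎ Covered h i ⊎ Receives h b i

    Informed : History n → Fin n → Set
    Informed []         i = T (active [] i) × StartsAt 0 i
    Informed h′@(b ∷ h) i = T (active h′ i) ×
      (StartsAt (length h′) i ⊎ Informed h i ⊎ Receives h b i)

    -- h is a history at time t₁
    Target : History n → Fin n → Set
    Target h i = T (active h i) × Within d (pos h source) (pos h i)

    upTo-t₁ : History n → History n
    upTo-t₁ h = drop (length h ∸ t₁) h

    -- used for histories of length at least t₁ only
    Solved : History n → Set
    Solved h = ∀ i → Target (upTo-t₁ h) i → Covered h i

    neighbors? : ∀ h u v → Dec (Neighbors h u v)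
    neighbors? h u v = ¬? (u ≟ v) ×-dec within? r (pos h u) (pos h v)

    receives? : ∀ h b u → Dec (Receives h b u)
    receives? h b u = T? (active h u) ×-dec any? λ v →
      neighbors? h u v ×-dec (T? (lookup b v) ×-dec
      all? λ w → T? (lookup b w) →-dec
        (((w ≟ u) ⊎-dec neighbors? h u w) →-dec (w ≟ v)))

    startsAt? : ∀ t i → Dec (StartsAt t i)
    startsAt? t i = (t ℕ.≟ t₁) ×-dec (i ≟ source)

    covered? : ∀ h i → Dec (Covered h i)
    covered? []         i = startsAt? 0 i
    covered? h′@(b ∷ h) i =
      startsAt? (length h′) i ⊎-dec (covered? h i ⊎-dec receives? h b i)

    informed? : ∀ h i → Dec (Informed h i)
    informed? []         i = T? (active [] i) ×-dec startsAt? 0 i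
    informed? h′@(b ∷ h) i = T? (active h′ i) ×-dec
      (startsAt? (length h′) i ⊎-dec (informed? h i ⊎-dec receives? h b i))

    solved? : ∀ h → Dec (Solved h)
    solved? h = all? λ i →
      (T? (active (upTo-t₁ h) i) ×-dec
       within? d (pos (upTo-t₁ h) source) (pos (upTo-t₁ h) i))
      →-dec covered? h i

    transmitProb : History n → Fin n → ℝ
    transmitProb h i = if ⌊ informed? h i ⌋ then prob i (clock h i) else 0#

    -- Conditional probability, given h, that the problem is solved at the
    -- end of the next k slots.
    probSolvedAfter : ℕ → History n → ℝ
    probSolvedAfter zero    h = if ⌊ solved? h ⌋ then 1# else 0#
    probSolvedAfter (suc k) h =
      expect (transmitProb h) (λ b → probSolvedAfter k (b ∷ h))

    -- The first k slots counted from t₁ are t₁, …, t₁ + k - 1.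
    probSolvedWithin : ℕ → ℝ
    probSolvedWithin k = probSolvedAfter (t₁ ℕ.+ k) []

    prefix : (ℕ → Vec Bool n) → ℕ → History n
    prefix ω zero    = []
    prefix ω (suc t) = ω t ∷ prefix ω t

    -- The runs of Π: every finite prefix has positive probability.
    IsExecution : (ℕ → Vec Bool n) → Set
    IsExecution ω = ∀ t i →
      if lookup (ω t) i then 0# < transmitProb (prefix ω t) i
                        else transmitProb (prefix ω t) i < 1#

    IsConnected : ℕ → ℕ → Set
    IsConnected α β =
      ∀ ω → IsExecution ω → ∀ t → t₁ ℕ.≤ t → ¬ Solved (prefix ω t) →
      ∃[ t′ ]
        (∃[ x ] (t ℕ.≤ x × x ℕ.≤ t ℕ.+ α) × (t′ ℕ.≤ x × x ℕ.< t′ ℕ.+ β)) ×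
        (∃[ p ] ∃[ p′ ]
          Informed (prefix ω t′) p × ¬ Covered (prefix ω t′) p′ ×
          (∀ x → t′ ℕ.≤ x → x ℕ.< t′ ℕ.+ β → ¬ Covered (prefix ω x) p′ →
            T (active (prefix ω x) p) × T (active (prefix ω x) p′) ×
            Neighbors (prefix ω x) p p′))

{-# OPTIONS --safe #-}
module Submission where

-- The cluster, nodes 0, …, N - 1 with N = ⌊ n/2 ⌋, is informed simultaneously and
-- stays active.  The far nodes are then served one at a time: after α idle slots a
-- far node is kept in contact with one cluster node, its partner, until it is
-- covered, whereupon it is deactivated.  By an arbitrarily small movement the
-- adversary decides in each slot whether the far node hears the whole cluster or
-- its partner only.  Since the protocol is oblivious, the transmission
-- probabilities of the cluster are known in advance for each slot, and with sum s:
-- if s ≥ (7/5) ln (n/2), a lone transmission has probability at most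
-- s exp (1 - s) ≤ 7/n; otherwise the average node transmits with probability at
-- most (7/5) ln (n/2) / N.  A suitable partner therefore covers the far node within
-- the first τ ≈ n / (6 e ln (n/2)) slots of contact with probability at most 3/16.
-- As fewer than n/8 contacts can be longer than that, weighing each of them with
-- 1/16 bounds the probability of success by (3/16 + 1/16)^{n/2} 16^{n/8} = 2^{-n/2}.

open import Defs
open import Algebra.Bundles using (CommutativeRing)
import Algebra.Properties.Monoid.Sum as MonoidSum
import Algebra.Properties.Ring as RingProperties
import Algebra.Properties.Semiring.Mult as SemiringMult
import Algebra.Solver.Ring
open import Algebra.Solver.Ring.AlmostCommutativeRing
  using (AlmostCommutativeRing; fromCommutativeRing; _-Raw-AlmostCommutative⟶_)
open import Axiom.ExcludedMiddle using (ExcludedMiddle)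
open import Data.Bool.Base using (Bool; true; false; T; if_then_else_)
open import Data.Empty using (⊥-elim)
open import Data.Fin.Base using (Fin; zero; suc; toℕ; fromℕ<)
open import Data.Fin.Properties
  using (_≟_; any?; toℕ<n; toℕ-injective; toℕ-fromℕ<; 0≢1+n; suc-injective)
open import Data.Integer.Base as ℤ using (ℤ; +_; -[1+_]; _⊖_)
import Data.Integer.Properties as ℤ
open import Data.List.Base using ([]; _∷_; length; drop)
open import Data.Maybe.Base using (Maybe; just; nothing)
open import Data.Nat.Base as ℕ
  using (ℕ; zero; suc; z≤n; s≤s; _!; _∸_; ⌊_/2⌋; ⌈_/2⌉)
import Data.Nat.Properties as ℕ
open import Data.Product.Base using (_×_; _,_; proj₁; proj₂; ∃-syntax; Σ-syntax)
open import Data.Sum.Base using (_⊎_; inj₁; inj₂; [_,_]′)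
open import Data.Unit.Base using (⊤; tt)
open import Data.Vec.Base using (Vec; []; _∷_; lookup)
open import Function.Base using (_∘_)
open import Level using (0ℓ)
open import Relation.Binary.Bundles using (Poset)
import Relation.Binary.Construct.NonStrictToStrict as Strict
open import Relation.Binary.PropositionalEquality.Core as ≡ using (_≡_; _≢_)
import Relation.Binary.Reasoning.PartialOrder as PosetReasoning
import Relation.Binary.Reasoning.Setoid as SetoidReasoning
open import Relation.Binary.Structures using (IsDecTotalOrder)
open import Relation.Nullary.Decidable
  using (Dec; yes; no; ⌊_⌋; _×-dec_; _⊎-dec_; toWitness; fromWitness; isYes≗does)
open import Relation.Nullary.Negation using (¬_)

-- Neither way of exposing a far node is safe in every slot: a lone partner covers it whenever it
-- transmits, the whole cluster whenever exactly one of its nodes does. The first is harmless if the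
-- probabilities are small on average, the second if their sum is large. The mode changes from slot
-- to slot, but the partner is fixed for a whole contact; hence the partner is found by averaging
-- the hazards summed over τ slots, not slot by slot. The constant 48 is 6 · 8: with τ and L chosen
-- maximal, n is at most 6 e ln (n/2) (τ + 1) and at most 8 (L + 1). The number e enters through 6 e
-- ≥ 16, which yields 16 τ ln (n/2) ≤ n. No exponential function is constructed. Inequalities about
-- exp are proved for every partial sum, with factors multiplied out instead of divided by, and the
-- limit is taken only at 1 and at ln (n/2), where convergence is given.

-- A ring solver for the reals with integer coefficients

module IntegerCoefficients (R : CompleteOrderedField) where

  open Reals R
  open CommutativeRing commutativeRing
    using (setoid; ring; refl; sym; trans; +-cong; +-congˡ; +-congʳ; *-cong;
           -‿cong; -‿inverseʳ; +-comm; +-assoc; +-identityˡ; +-identityʳ)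
  open SemiringMult semiring using (×-homo-+; ×1-homo-*)
  open RingProperties ring
    using (-‿distribˡ-*; -‿distribʳ-*; -‿involutive; -0#≈0#; -‿+-comm)
  open SetoidReasoning setoid

  -- 0 and 1 are sent to 0# and 1#, rather than to fromℕ 0 and fromℕ 1, so
  -- that solver goals can mention them.
  ⟦_⟧ℕ : ℕ → ℝ
  ⟦ 0 ⟧ℕ               = 0#
  ⟦ 1 ⟧ℕ               = 1#
  ⟦ n@(suc (suc _)) ⟧ℕ = fromℕ n

  ⟦_⟧ℤ : ℤ → ℝ
  ⟦ + n ⟧ℤ      = ⟦ n ⟧ℕ
  ⟦ -[1+ n ] ⟧ℤ = - ⟦ suc n ⟧ℕ

  ⟦⟧ℕ≈fromℕ : ∀ n → ⟦ n ⟧ℕ ≈ fromℕ n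
  ⟦⟧ℕ≈fromℕ 0             = refl
  ⟦⟧ℕ≈fromℕ 1             = sym (+-identityʳ 1#)
  ⟦⟧ℕ≈fromℕ (suc (suc n)) = refl

  ⊖-homo : ∀ m n → ⟦ m ⊖ n ⟧ℤ ≈ fromℕ m - fromℕ n
  ⊖-homo m zero = begin
    ⟦ m ⟧ℕ       ≈⟨ ⟦⟧ℕ≈fromℕ m ⟩
    fromℕ m      ≈⟨ +-identityʳ _ ⟨
    fromℕ m + 0# ≈⟨ +-congˡ -0#≈0# ⟨
    fromℕ m - 0# ∎
  ⊖-homo zero (suc n) = begin
    - ⟦ suc n ⟧ℕ         ≈⟨ -‿cong (⟦⟧ℕ≈fromℕ (suc n)) ⟩
    - fromℕ (suc n)      ≈⟨ +-identityˡ _ ⟨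
    0# - fromℕ (suc n)   ∎
  ⊖-homo (suc m) (suc n) = begin
    ⟦ suc m ⊖ suc n ⟧ℤ                  ≡⟨ ≡.cong ⟦_⟧ℤ (ℤ.[1+m]⊖[1+n]≡m⊖n m n) ⟩
    ⟦ m ⊖ n ⟧ℤ                          ≈⟨ ⊖-homo m n ⟩
    fromℕ m - fromℕ n                   ≈⟨ +-congʳ (+-identityˡ _) ⟨
    (0# + fromℕ m) - fromℕ n            ≈⟨ +-congʳ (+-congʳ (-‿inverseʳ 1#)) ⟨
    ((1# - 1#) + fromℕ m) - fromℕ n     ≈⟨ +-congʳ (+-assoc _ _ _) ⟩
    (1# + (- 1# + fromℕ m)) - fromℕ n   ≈⟨ +-congʳ (+-congˡ (+-comm _ _)) ⟩
    (1# + (fromℕ m - 1#)) - fromℕ n     ≈⟨ +-congʳ (+-assoc _ _ _) ⟨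
    (fromℕ (suc m) - 1#) - fromℕ n      ≈⟨ +-assoc _ _ _ ⟩
    fromℕ (suc m) + (- 1# - fromℕ n)    ≈⟨ +-congˡ (-‿+-comm _ _) ⟩
    fromℕ (suc m) - fromℕ (suc n)       ∎

  ⟦⟧ℤ-+ : ∀ i j → ⟦ i ℤ.+ j ⟧ℤ ≈ ⟦ i ⟧ℤ + ⟦ j ⟧ℤ
  ⟦⟧ℤ-+ (+ m) (+ n) = begin
    ⟦ m ℕ.+ n ⟧ℕ      ≈⟨ ⟦⟧ℕ≈fromℕ (m ℕ.+ n) ⟩
    fromℕ (m ℕ.+ n)   ≈⟨ ×-homo-+ 1# m n ⟩
    fromℕ m + fromℕ n ≈⟨ +-cong (⟦⟧ℕ≈fromℕ m) (⟦⟧ℕ≈fromℕ n) ⟨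
    ⟦ m ⟧ℕ + ⟦ n ⟧ℕ   ∎
  ⟦⟧ℤ-+ (+ m) -[1+ n ] = begin
    ⟦ m ⊖ suc n ⟧ℤ          ≈⟨ ⊖-homo m (suc n) ⟩
    fromℕ m - fromℕ (suc n) ≈⟨ +-cong (⟦⟧ℕ≈fromℕ m) (-‿cong (⟦⟧ℕ≈fromℕ (suc n))) ⟨
    ⟦ m ⟧ℕ - ⟦ suc n ⟧ℕ     ∎
  ⟦⟧ℤ-+ -[1+ m ] (+ n) = begin
    ⟦ n ⊖ suc m ⟧ℤ          ≈⟨ ⊖-homo n (suc m) ⟩
    fromℕ n - fromℕ (suc m) ≈⟨ +-cong (⟦⟧ℕ≈fromℕ n) (-‿cong (⟦⟧ℕ≈fromℕ (suc m))) ⟨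
    ⟦ n ⟧ℕ - ⟦ suc m ⟧ℕ     ≈⟨ +-comm _ _ ⟩
    - ⟦ suc m ⟧ℕ + ⟦ n ⟧ℕ   ∎
  ⟦⟧ℤ-+ -[1+ m ] -[1+ n ] = begin
    - ⟦ suc (suc (m ℕ.+ n)) ⟧ℕ          ≡⟨ ≡.cong (λ k → - ⟦ k ⟧ℕ) (ℕ.+-suc (suc m) n) ⟨
    - ⟦ suc m ℕ.+ suc n ⟧ℕ              ≈⟨ -‿cong (⟦⟧ℕ≈fromℕ (suc m ℕ.+ suc n)) ⟩
    - fromℕ (suc m ℕ.+ suc n)           ≈⟨ -‿cong (×-homo-+ 1# (suc m) (suc n)) ⟩
    - (fromℕ (suc m) + fromℕ (suc n))   ≈⟨ -‿+-comm _ _ ⟨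
    - fromℕ (suc m) - fromℕ (suc n)
      ≈⟨ +-cong (-‿cong (⟦⟧ℕ≈fromℕ (suc m))) (-‿cong (⟦⟧ℕ≈fromℕ (suc n))) ⟨
    - ⟦ suc m ⟧ℕ - ⟦ suc n ⟧ℕ           ∎

  ⟦⟧ℤ-neg : ∀ i → ⟦ ℤ.- i ⟧ℤ ≈ - ⟦ i ⟧ℤ
  ⟦⟧ℤ-neg (+ zero)    = sym -0#≈0#
  ⟦⟧ℤ-neg (+ (suc n)) = refl
  ⟦⟧ℤ-neg -[1+ n ]    = sym (-‿involutive _)

  ⟦⟧ℤ-*-pos : ∀ m n → ⟦ (+ m) ℤ.* (+ n) ⟧ℤ ≈ ⟦ m ⟧ℕ * ⟦ n ⟧ℕ
  ⟦⟧ℤ-*-pos m n = begin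
    ⟦ (+ m) ℤ.* (+ n) ⟧ℤ ≡⟨ ≡.cong ⟦_⟧ℤ (ℤ.pos-* m n) ⟨
    ⟦ m ℕ.* n ⟧ℕ         ≈⟨ ⟦⟧ℕ≈fromℕ (m ℕ.* n) ⟩
    fromℕ (m ℕ.* n)      ≈⟨ ×1-homo-* m n ⟩
    fromℕ m * fromℕ n    ≈⟨ *-cong (⟦⟧ℕ≈fromℕ m) (⟦⟧ℕ≈fromℕ n) ⟨
    ⟦ m ⟧ℕ * ⟦ n ⟧ℕ      ∎

  ⟦⟧ℤ-*-posʳ : ∀ i n → ⟦ i ℤ.* (+ n) ⟧ℤ ≈ ⟦ i ⟧ℤ * ⟦ n ⟧ℕ
  ⟦⟧ℤ-*-posʳ (+ m) n = ⟦⟧ℤ-*-pos m n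
  ⟦⟧ℤ-*-posʳ -[1+ m ] n = begin
    ⟦ -[1+ m ] ℤ.* (+ n) ⟧ℤ           ≡⟨ ≡.cong ⟦_⟧ℤ (ℤ.neg-distribˡ-* (+ suc m) (+ n)) ⟨
    ⟦ ℤ.- ((+ suc m) ℤ.* (+ n)) ⟧ℤ    ≈⟨ ⟦⟧ℤ-neg ((+ suc m) ℤ.* (+ n)) ⟩
    - ⟦ (+ suc m) ℤ.* (+ n) ⟧ℤ        ≈⟨ -‿cong (⟦⟧ℤ-*-pos (suc m) n) ⟩
    - (⟦ suc m ⟧ℕ * ⟦ n ⟧ℕ)           ≈⟨ -‿distribˡ-* _ _ ⟩
    - ⟦ suc m ⟧ℕ * ⟦ n ⟧ℕ             ∎

  ⟦⟧ℤ-* : ∀ i j → ⟦ i ℤ.* j ⟧ℤ ≈ ⟦ i ⟧ℤ * ⟦ j ⟧ℤ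
  ⟦⟧ℤ-* i (+ n) = ⟦⟧ℤ-*-posʳ i n
  ⟦⟧ℤ-* i -[1+ n ] = begin
    ⟦ i ℤ.* -[1+ n ] ⟧ℤ             ≡⟨ ≡.cong ⟦_⟧ℤ (ℤ.neg-distribʳ-* i (+ suc n)) ⟨
    ⟦ ℤ.- (i ℤ.* (+ suc n)) ⟧ℤ      ≈⟨ ⟦⟧ℤ-neg (i ℤ.* (+ suc n)) ⟩
    - ⟦ i ℤ.* (+ suc n) ⟧ℤ          ≈⟨ -‿cong (⟦⟧ℤ-*-posʳ i (suc n)) ⟩
    - (⟦ i ⟧ℤ * ⟦ suc n ⟧ℕ)         ≈⟨ -‿distribʳ-* _ _ ⟩
    ⟦ i ⟧ℤ * - ⟦ suc n ⟧ℕ           ∎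

  almostCommutativeRing : AlmostCommutativeRing 0ℓ 0ℓ
  almostCommutativeRing = fromCommutativeRing commutativeRing

  homomorphism : ℤ.+-*-rawRing -Raw-AlmostCommutative⟶ almostCommutativeRing
  homomorphism = record
    { ⟦_⟧    = ⟦_⟧ℤ
    ; +-homo = ⟦⟧ℤ-+
    ; *-homo = ⟦⟧ℤ-*
    ; -‿homo = ⟦⟧ℤ-neg
    ; 0-homo = refl
    ; 1-homo = refl
    }

  coefficient≟ : ∀ i j → Maybe (⟦ i ⟧ℤ ≈ ⟦ j ⟧ℤ)
  coefficient≟ i j with i ℤ.≟ j
  ... | yes i≡j = just (≡.subst (λ k → ⟦ i ⟧ℤ ≈ ⟦ k ⟧ℤ) i≡j refl)
  ... | no _    = nothing

  open Algebra.Solver.Ring ℤ.+-*-rawRing almostCommutativeRing homomorphism coefficient≟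
    public using (solve; _:=_; _:+_; _:*_; _:-_; :-_; con; Polynomial)

  # : ∀ {n} → ℕ → Polynomial n
  # k = con (+ k)

-- Arithmetic in an ordered field

module OrderedField (R : CompleteOrderedField) where

  open Reals R public
  open IntegerCoefficients R public using (solve; _:=_; _:+_; _:*_; _:-_; :-_; #)
  open CommutativeRing commutativeRing public
    using (refl; sym; trans; reflexive; +-cong; +-congˡ; +-congʳ;
           *-cong; *-congˡ; *-congʳ; -‿cong; +-comm; *-comm; *-assoc;
           +-identityˡ; +-identityʳ; *-identityˡ; *-identityʳ; zeroˡ; zeroʳ)
  open IsDecTotalOrder isDecTotalOrder public
    using (antisym; total; isPartialOrder)
    renaming (refl to ≤-refl; trans to ≤-trans; reflexive to ≤-reflexive)
  open SemiringMult semiring public using (×-homo-+; ×1-homo-*)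

  poset : Poset 0ℓ 0ℓ 0ℓ
  poset = record { isPartialOrder = isPartialOrder }

  open MonoidSum +-monoid public using (sum; sum-cong-≋)

  module ≤-Reasoning = PosetReasoning poset

  <⇒≤ : ∀ {x y} → x < y → x ≤ y
  <⇒≤ = proj₁

  <⇒≱ : ∀ {x y} → x < y → ¬ y ≤ x
  <⇒≱ = Strict.<⇒≱ _≈_ _≤_ antisym

  ≰⇒> : ∀ {x y} → ¬ x ≤ y → y < x
  ≰⇒> = Strict.≰⇒> _≈_ _≤_ sym ≤-reflexive total

  ≰⇒≥ : ∀ {x y} → ¬ x ≤ y → y ≤ x
  ≰⇒≥ x≰y = <⇒≤ (≰⇒> x≰y)

  -- An inequality x ≤ y is proved by exhibiting y - x as a combination of
  -- nonnegative terms, which is checked by the ring solver.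
  certificate : ∀ {x y z} → 0# ≤ z → y - x ≈ z → x ≤ y
  certificate {x} {y} {z} 0≤z y-x≈z = begin
    x           ≈⟨ +-identityˡ x ⟨
    0# + x      ≤⟨ +-monoˡ-≤ x 0≤z ⟩
    z + x       ≈⟨ +-congʳ y-x≈z ⟨
    y - x + x   ≈⟨ solve 2 (λ x y → y :- x :+ x := y) refl x y ⟩
    y           ∎
    where open ≤-Reasoning

  x≤y⇒0≤y-x : ∀ {x y} → x ≤ y → 0# ≤ y - x
  x≤y⇒0≤y-x {x} {y} x≤y = begin
    0#       ≈⟨ solve 1 (λ x → # 0 := x :- x) refl x ⟩
    x - x    ≤⟨ +-monoˡ-≤ (- x) x≤y ⟩
    y - x    ∎
    where open ≤-Reasoning

  infixr 6 _⊕_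
  infixr 7 _⊗_

  _⊕_ : ∀ {x y} → 0# ≤ x → 0# ≤ y → 0# ≤ x + y
  _⊕_ {x} {y} 0≤x 0≤y = begin
    0#      ≤⟨ 0≤y ⟩
    y       ≈⟨ +-identityˡ y ⟨
    0# + y  ≤⟨ +-monoˡ-≤ y 0≤x ⟩
    x + y   ∎
    where open ≤-Reasoning

  _⊗_ : ∀ {x y} → 0# ≤ x → 0# ≤ y → 0# ≤ x * y
  _⊗_ = *-nonNeg

  +-mono-≤ : ∀ {x y u v} → x ≤ y → u ≤ v → x + u ≤ y + v
  +-mono-≤ {x} {y} {u} {v} x≤y u≤v = certificate
    (x≤y⇒0≤y-x x≤y ⊕ x≤y⇒0≤y-x u≤v)
    (solve 4 (λ x y u v → y :+ v :- (x :+ u) := y :- x :+ (v :- u)) refl x y u v)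

  *-monoˡ-≤ : ∀ {x y z} → 0# ≤ z → x ≤ y → z * x ≤ z * y
  *-monoˡ-≤ {x} {y} {z} 0≤z x≤y = certificate (0≤z ⊗ x≤y⇒0≤y-x x≤y)
    (solve 3 (λ x y z → z :* y :- z :* x := z :* (y :- x)) refl x y z)

  *-monoʳ-≤ : ∀ {x y z} → 0# ≤ z → x ≤ y → x * z ≤ y * z
  *-monoʳ-≤ {x} {y} {z} 0≤z x≤y = certificate (0≤z ⊗ x≤y⇒0≤y-x x≤y)
    (solve 3 (λ x y z → y :* z :- x :* z := z :* (y :- x)) refl x y z)

  *-mono-≤ : ∀ {x y u v} → 0# ≤ y → 0# ≤ u → x ≤ y → u ≤ v → x * u ≤ y * v
  *-mono-≤ 0≤y 0≤u x≤y u≤v = ≤-trans (*-monoʳ-≤ 0≤u x≤y) (*-monoˡ-≤ 0≤y u≤v)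

  0≤x² : ∀ x → 0# ≤ x * x
  0≤x² x with total 0# x
  ... | inj₁ 0≤x = 0≤x ⊗ 0≤x
  ... | inj₂ x≤0 = begin
    0#                    ≤⟨ x≤y⇒0≤y-x x≤0 ⊗ x≤y⇒0≤y-x x≤0 ⟩
    (0# - x) * (0# - x)   ≈⟨ solve 1 (λ x → (# 0 :- x) :* (# 0 :- x) := x :* x) refl x ⟩
    x * x                 ∎
    where open ≤-Reasoning

  0≤1 : 0# ≤ 1#
  0≤1 = ≤-trans (0≤x² 1#) (≤-reflexive (*-identityˡ 1#))

  0<1 : 0# < 1#
  0<1 = 0≤1 , 0≉1

  0≤fromℕ : ∀ n → 0# ≤ fromℕ n
  0≤fromℕ zero    = ≤-refl
  0≤fromℕ (suc n) = 0≤1 ⊕ 0≤fromℕ n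

  fromℕ-mono-≤ : ∀ {m n} → m ℕ.≤ n → fromℕ m ≤ fromℕ n
  fromℕ-mono-≤ {n = n} z≤n = 0≤fromℕ n
  fromℕ-mono-≤ (s≤s m≤n)   = +-mono-≤ ≤-refl (fromℕ-mono-≤ m≤n)

  -- Otherwise `y ≤ x`, and monotonicity reverses the hypothesis. Then `z * x ≈ z * y`, and
  -- multiplying by `z ⁻¹` gives `x ≈ y` after all.
  *-cancelˡ-≤ : ∀ {x y z} → 0# < z → z * x ≤ z * y → x ≤ y
  *-cancelˡ-≤ {x} {y} {z} 0<z zx≤zy with x ≤? y
  ... | yes x≤y = x≤y
  ... | no  x≰y = ⊥-elim (x≰y (≤-reflexive (begin-equality
    x              ≈⟨ cancel x ⟨
    z ⁻¹ * (z * x) ≈⟨ *-congˡ zx≈zy ⟩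
    z ⁻¹ * (z * y) ≈⟨ cancel y ⟩
    y              ∎)))
    where
    open ≤-Reasoning
    zx≈zy : z * x ≈ z * y
    zx≈zy = antisym zx≤zy (*-monoˡ-≤ (<⇒≤ 0<z) (≰⇒≥ x≰y))
    cancel : ∀ w → z ⁻¹ * (z * w) ≈ w
    cancel w = begin-equality
      z ⁻¹ * (z * w) ≈⟨ solve 3 (λ z i w → i :* (z :* w) := z :* i :* w) refl z (z ⁻¹) w ⟩
      z * z ⁻¹ * w   ≈⟨ *-congʳ (*-inverseʳ z (λ z≈0 → proj₂ 0<z (sym z≈0))) ⟩
      1# * w         ≈⟨ *-identityˡ w ⟩
      w              ∎

  0<-* : ∀ {x y} → 0# < x → 0# < y → 0# < x * y
  0<-* {x} {y} 0<x 0<y = ≰⇒> λ xy≤0 → <⇒≱ 0<y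
    (*-cancelˡ-≤ 0<x (≤-trans xy≤0 (≤-reflexive (sym (zeroʳ x)))))

  <-≤-trans : ∀ {x y z} → x < y → y ≤ z → x < z
  <-≤-trans x<y y≤z = ≰⇒> λ z≤x → <⇒≱ x<y (≤-trans y≤z z≤x)

  ≤-<-trans : ∀ {x y z} → x ≤ y → y < z → x < z
  ≤-<-trans x≤y y<z = ≰⇒> λ z≤x → <⇒≱ y<z (≤-trans z≤x x≤y)

  0<fromℕ : ∀ n → 0 ℕ.< n → 0# < fromℕ n
  0<fromℕ (suc n) _ = <-≤-trans 0<1 (≤-trans (≤-reflexive (sym (+-identityʳ 1#)))
    (fromℕ-mono-≤ {1} {suc n} (s≤s z≤n)))

  fromℕ-cancel-≤ : ∀ {m n} → fromℕ m ≤ fromℕ n → m ℕ.≤ n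
  fromℕ-cancel-≤ {m} {n} fm≤fn with m ℕ.≤? n
  ... | yes m≤n = m≤n
  ... | no  m≰n = ⊥-elim (<⇒≱ 0<1 (certificate
    (x≤y⇒0≤y-x (≤-trans (fromℕ-mono-≤ (ℕ.≰⇒> m≰n)) fm≤fn))
    (solve 1 (λ x → # 0 :- # 1 := x :- (# 1 :+ x)) refl (fromℕ n))))

  fromℕ-+ : ∀ m n → fromℕ (m ℕ.+ n) ≈ fromℕ m + fromℕ n
  fromℕ-+ = ×-homo-+ 1#

  fromℕ-* : ∀ m n → fromℕ (m ℕ.* n) ≈ fromℕ m * fromℕ n
  fromℕ-* = ×1-homo-*

  fromℕ-^ : ∀ m n → fromℕ (m ℕ.^ n) ≈ fromℕ m ^ n
  fromℕ-^ m zero    = +-identityʳ 1#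
  fromℕ-^ m (suc n) = trans (fromℕ-* m (m ℕ.^ n)) (*-congˡ (fromℕ-^ m n))

  >0⇒≉0 : ∀ {x} → 0# < x → ¬ x ≈ 0#
  >0⇒≉0 0<x x≈0 = proj₂ 0<x (sym x≈0)

  *-inverse : ∀ {x} → 0# < x → x * x ⁻¹ ≈ 1#
  *-inverse 0<x = *-inverseʳ _ (>0⇒≉0 0<x)

  x/y*y≈x : ∀ {x y} → 0# < y → x / y * y ≈ x
  x/y*y≈x {x} {y} 0<y = begin-equality
    x * y ⁻¹ * y   ≈⟨ solve 3 (λ x y i → x :* i :* y := x :* (y :* i)) refl x y (y ⁻¹) ⟩
    x * (y * y ⁻¹) ≈⟨ *-congˡ (*-inverse 0<y) ⟩
    x * 1#         ≈⟨ *-identityʳ x ⟩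
    x              ∎
    where open ≤-Reasoning

  0<⁻¹ : ∀ {x} → 0# < x → 0# < x ⁻¹
  0<⁻¹ {x} 0<x = ≰⇒> λ x⁻¹≤0 → <⇒≱ 0<1 (begin
    1#       ≈⟨ *-inverse 0<x ⟨
    x * x ⁻¹ ≤⟨ *-monoˡ-≤ (<⇒≤ 0<x) x⁻¹≤0 ⟩
    x * 0#   ≈⟨ zeroʳ x ⟩
    0#       ∎)
    where open ≤-Reasoning

  /-≤ : ∀ {x y z} → 0# < y → x ≤ z * y → x / y ≤ z
  /-≤ {x} {y} {z} 0<y x≤zy = *-cancelˡ-≤ 0<y (begin
    y * (x / y)   ≈⟨ *-comm _ _ ⟩
    x / y * y     ≈⟨ x/y*y≈x 0<y ⟩
    x             ≤⟨ x≤zy ⟩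
    z * y         ≈⟨ *-comm _ _ ⟩
    y * z         ∎)
    where open ≤-Reasoning

  0≤^ : ∀ {x} n → 0# ≤ x → 0# ≤ x ^ n
  0≤^ zero    0≤x = 0≤1
  0≤^ (suc n) 0≤x = 0≤x ⊗ 0≤^ n 0≤x

  ^-mono-≤ : ∀ {x y} n → 0# ≤ x → x ≤ y → x ^ n ≤ y ^ n
  ^-mono-≤ zero    0≤x x≤y = ≤-refl
  ^-mono-≤ (suc n) 0≤x x≤y =
    *-mono-≤ (≤-trans 0≤x x≤y) (0≤^ n 0≤x) x≤y (^-mono-≤ n 0≤x x≤y)

  sum-mono-≤ : ∀ {n} {f g : Fin n → ℝ} → (∀ i → f i ≤ g i) → sum f ≤ sum g
  sum-mono-≤ {zero}  f≤g = ≤-refl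
  sum-mono-≤ {suc n} f≤g = +-mono-≤ (f≤g zero) (sum-mono-≤ (λ i → f≤g (suc i)))

  0≤sum : ∀ {n} {f : Fin n → ℝ} → (∀ i → 0# ≤ f i) → 0# ≤ sum f
  0≤sum {zero}  0≤f = ≤-refl
  0≤sum {suc n} 0≤f = 0≤f zero ⊕ 0≤sum (λ i → 0≤f (suc i))

-- Partial sums of the exponential series

module ExponentialSeries (R : CompleteOrderedField) where

  open OrderedField R
  open ≤-Reasoning

  expTerm : ℝ → ℕ → ℝ
  expTerm x k = x ^ k / fromℕ (k !)

  expSum : ℕ → ℝ → ℝ
  expSum K x = series (expTerm x) K

  0<fact : ∀ k → 0# < fromℕ (k !)
  0<fact k = 0<fromℕ (k !) (ℕ.>-nonZero⁻¹ (k !) {{k ℕ.!≢0}})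

  0≤fact⁻¹ : ∀ k → 0# ≤ fromℕ (k !) ⁻¹
  0≤fact⁻¹ k = <⇒≤ (0<⁻¹ (0<fact k))

  fact⁻¹-suc : ∀ k → fromℕ (suc k) * fromℕ (suc k !) ⁻¹ ≈ fromℕ (k !) ⁻¹
  fact⁻¹-suc k = begin-equality
    s * i             ≈⟨ *-identityʳ _ ⟨
    s * i * 1#        ≈⟨ *-congˡ (*-inverse (0<fact k)) ⟨
    s * i * (f * j)
      ≈⟨ solve 4 (λ s i f j → s :* i :* (f :* j) := s :* f :* i :* j) refl s i f j ⟩
    s * f * i * j     ≈⟨ *-congʳ (*-congʳ (fromℕ-* (suc k) (k !))) ⟨
    fromℕ (suc k !) * i * j ≈⟨ *-congʳ (*-inverse (0<fact (suc k))) ⟩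
    1# * j            ≈⟨ *-identityˡ j ⟩
    j                 ∎
    where
    s = fromℕ (suc k)
    i = fromℕ (suc k !) ⁻¹
    f = fromℕ (k !)
    j = f ⁻¹

  expTerm-suc : ∀ x k → fromℕ (suc k) * x ^ k * fromℕ (suc k !) ⁻¹ ≈ expTerm x k
  expTerm-suc x k = begin-equality
    s * x ^ k * i     ≈⟨ solve 3 (λ s p i → s :* p :* i := p :* (s :* i)) refl s (x ^ k) i ⟩
    x ^ k * (s * i)   ≈⟨ *-congˡ (fact⁻¹-suc k) ⟩
    expTerm x k       ∎
    where
    s = fromℕ (suc k)
    i = fromℕ (suc k !) ⁻¹

  -- Together with `^-lower` this is the mean value estimate for a power: its increment over `q`
  -- lies between `q` times the derivative at the left end and `q` times the derivative at the right
  -- end.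
  ^-upper : ∀ {x q} k → 0# ≤ x → 0# ≤ q →
            (x + q) ^ suc k ≤ x ^ suc k + fromℕ (suc k) * q * (x + q) ^ k
  ^-upper {x} {q} zero 0≤x 0≤q = ≤-reflexive
    (solve 2 (λ x q → (x :+ q) :* # 1 := x :* # 1 :+ (# 1 :+ # 0) :* q :* # 1) refl x q)
  ^-upper {x} {q} (suc k) 0≤x 0≤q = certificate
    ((0≤x ⊕ 0≤q) ⊗ x≤y⇒0≤y-x (^-upper k 0≤x 0≤q) ⊕
     0≤q ⊗ x≤y⇒0≤y-x (^-mono-≤ (suc k) 0≤x x≤x+q))
    (solve 5 (λ x q n u v →
      x :* (x :* v) :+ (# 1 :+ n) :* q :* ((x :+ q) :* u) :- (x :+ q) :* ((x :+ q) :* u)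
      := (x :+ q) :* (x :* v :+ n :* q :* u :- (x :+ q) :* u)
         :+ q :* ((x :+ q) :* u :- x :* v))
      refl x q (fromℕ (suc k)) ((x + q) ^ k) (x ^ k))
    where
    x≤x+q : x ≤ x + q
    x≤x+q = certificate 0≤q (solve 2 (λ x q → x :+ q :- x := q) refl x q)

  ^-lower : ∀ {x q} k → 0# ≤ x → 0# ≤ q →
            x ^ suc k + fromℕ (suc k) * q * x ^ k ≤ (x + q) ^ suc k
  ^-lower {x} {q} zero 0≤x 0≤q = ≤-reflexive
    (solve 2 (λ x q → x :* # 1 :+ (# 1 :+ # 0) :* q :* # 1 := (x :+ q) :* # 1) refl x q)
  ^-lower {x} {q} (suc k) 0≤x 0≤q = certificate
    ((0≤x ⊕ 0≤q) ⊗ x≤y⇒0≤y-x (^-lower k 0≤x 0≤q) ⊕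
     0≤q ⊗ 0≤fromℕ (suc k) ⊗ 0≤q ⊗ 0≤^ k 0≤x)
    (solve 5 (λ x q n u v →
      (x :+ q) :* ((x :+ q) :* u) :- (x :* (x :* v) :+ (# 1 :+ n) :* q :* (x :* v))
      := (x :+ q) :* ((x :+ q) :* u :- (x :* v :+ n :* q :* v))
         :+ q :* (n :* (q :* v)))
      refl x q (fromℕ (suc k)) ((x + q) ^ k) (x ^ k))

  -- Divided by the factorial, the derivative of a power becomes the preceding term of the series.
  -- This is the termwise form of exp being its own derivative.
  expTerm-upper : ∀ {x q} k → 0# ≤ x → 0# ≤ q →
                  expTerm (x + q) (suc k) ≤ expTerm x (suc k) + q * expTerm (x + q) k
  expTerm-upper {x} {q} k 0≤x 0≤q = begin
    (x + q) ^ suc k * i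
      ≤⟨ *-monoʳ-≤ (0≤fact⁻¹ (suc k)) (^-upper k 0≤x 0≤q) ⟩
    (x ^ suc k + s * q * u) * i
      ≈⟨ solve 5 (λ v s q u i → (v :+ s :* q :* u) :* i := v :* i :+ q :* (s :* u :* i))
           refl (x ^ suc k) s q u i ⟩
    expTerm x (suc k) + q * (s * u * i)     ≈⟨ +-congˡ (*-congˡ (expTerm-suc (x + q) k)) ⟩
    expTerm x (suc k) + q * expTerm (x + q) k ∎
    where
    s = fromℕ (suc k)
    i = fromℕ (suc k !) ⁻¹
    u = (x + q) ^ k

  expTerm-lower : ∀ {x q} k → 0# ≤ x → 0# ≤ q →
                  expTerm x (suc k) + q * expTerm x k ≤ expTerm (x + q) (suc k)
  expTerm-lower {x} {q} k 0≤x 0≤q = begin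
    expTerm x (suc k) + q * expTerm x k ≈⟨ +-congˡ (*-congˡ (expTerm-suc x k)) ⟨
    expTerm x (suc k) + q * (s * u * i)
      ≈⟨ solve 5 (λ v s q u i → (v :+ s :* q :* u) :* i := v :* i :+ q :* (s :* u :* i))
           refl (x ^ suc k) s q u i ⟨
    (x ^ suc k + s * q * u) * i         ≤⟨ *-monoʳ-≤ (0≤fact⁻¹ (suc k)) (^-lower k 0≤x 0≤q) ⟩
    (x + q) ^ suc k * i                 ∎
    where
    s = fromℕ (suc k)
    i = fromℕ (suc k !) ⁻¹
    u = x ^ k

  0≤expTerm : ∀ {x} k → 0# ≤ x → 0# ≤ expTerm x k
  0≤expTerm k 0≤x = 0≤^ k 0≤x ⊗ 0≤fact⁻¹ k

  expTerm-zero : ∀ x → expTerm x 0 ≈ 1#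
  expTerm-zero x = begin-equality
    1# * (1# + 0#) ⁻¹           ≈⟨ *-congʳ (+-identityʳ 1#) ⟨
    (1# + 0#) * (1# + 0#) ⁻¹    ≈⟨ *-inverse (0<fact 0) ⟩
    1#                          ∎

  0≤expSum : ∀ {x} K → 0# ≤ x → 0# ≤ expSum K x
  0≤expSum K 0≤x = 0≤sum {K} (λ i → 0≤expTerm (toℕ i) 0≤x)

  expSum-mono : ∀ {x y} K → 0# ≤ x → x ≤ y → expSum K x ≤ expSum K y
  expSum-mono K 0≤x x≤y = sum-mono-≤ {K} (λ i →
    *-monoʳ-≤ (0≤fact⁻¹ (toℕ i)) (^-mono-≤ (toℕ i) 0≤x x≤y))

  series-mono : ∀ {a : ℕ → ℝ} → (∀ k → 0# ≤ a k) → ∀ {K M} → K ℕ.≤ M →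
                series a K ≤ series a M
  series-mono 0≤a {M = M} z≤n = 0≤sum {M} (λ i → 0≤a (toℕ i))
  series-mono 0≤a (s≤s K≤M)   = +-mono-≤ ≤-refl (series-mono (0≤a ∘ suc) K≤M)

  expSum-≤suc : ∀ {x} K → 0# ≤ x → expSum K x ≤ expSum (suc K) x
  expSum-≤suc K 0≤x = series-mono (λ k → 0≤expTerm k 0≤x) (ℕ.n≤1+n K)

  sum-+-* : ∀ {n} (f g : Fin n → ℝ) q → sum (λ i → f i + q * g i) ≈ sum f + q * sum g
  sum-+-* {zero}  f g q = solve 1 (λ q → # 0 := # 0 :+ q :* # 0) refl q
  sum-+-* {suc n} f g q = trans (+-congˡ (sum-+-* (f ∘ suc) (g ∘ suc) q))
    (solve 5 (λ a b q u v → a :+ q :* b :+ (u :+ q :* v) := a :+ u :+ q :* (b :+ v))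
      refl (f zero) (g zero) q (sum (f ∘ suc)) (sum (g ∘ suc)))

  -- These two encode exp (x + q) (1 - q) ≤ exp x and exp x (1 + q) ≤ exp (x + q).
  expSum-upper : ∀ {x q} K → 0# ≤ x → 0# ≤ q → (1# - q) * expSum K (x + q) ≤ expSum K x
  expSum-upper zero 0≤x 0≤q = ≤-reflexive (zeroʳ _)
  expSum-upper {x} {q} (suc K) 0≤x 0≤q = certificate
    (x≤y⇒0≤y-x S≤ ⊕ 0≤q ⊗ x≤y⇒0≤y-x (expSum-≤suc K (0≤x ⊕ 0≤q)))
    (solve 4 (λ s q S T → s :- (# 1 :- q) :* S := s :+ q :* T :- S :+ q :* (S :- T))
      refl (expSum (suc K) x) q (expSum (suc K) (x + q)) (expSum K (x + q)))
    where
    f = λ (i : Fin K) → expTerm x (suc (toℕ i))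
    g = λ (i : Fin K) → expTerm (x + q) (toℕ i)
    -- The zeroth terms agree, and every later term is charged to its predecessor at `x + q`, so the
    -- sum on the right has one term less. `expSum-≤suc` compensates for this.
    S≤ : expSum (suc K) (x + q) ≤ expSum (suc K) x + q * expSum K (x + q)
    S≤ = begin
      expSum (suc K) (x + q)
        ≤⟨ +-mono-≤ ≤-refl (sum-mono-≤ {K} (λ i → expTerm-upper (toℕ i) 0≤x 0≤q)) ⟩
      expTerm x 0 + sum (λ i → f i + q * g i)
        ≈⟨ +-congˡ (sum-+-* f g q) ⟩
      expTerm x 0 + (sum f + q * sum g)
        ≈⟨ solve 3 (λ a b c → a :+ (b :+ c) := a :+ b :+ c)
             refl (expTerm x 0) (sum f) (q * sum g) ⟩
      expSum (suc K) x + q * expSum K (x + q) ∎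

  expSum-lower : ∀ {x q} K → 0# ≤ x → 0# ≤ q → (1# + q) * expSum K x ≤ expSum (suc K) (x + q)
  expSum-lower {x} {q} K 0≤x 0≤q = begin
    (1# + q) * expSum K x
      ≈⟨ solve 2 (λ q S → (# 1 :+ q) :* S := S :+ q :* S) refl q (expSum K x) ⟩
    expSum K x + q * expSum K x         ≤⟨ +-mono-≤ (expSum-≤suc K 0≤x) ≤-refl ⟩
    expSum (suc K) x + q * expSum K x
      ≈⟨ solve 3 (λ a b c → a :+ (b :+ c) := a :+ b :+ c)
           refl (expTerm x 0) (sum f) (q * sum g) ⟨
    expTerm x 0 + (sum f + q * sum g)   ≈⟨ +-congˡ (sum-+-* f g q) ⟨
    expTerm x 0 + sum (λ i → f i + q * g i)
      ≤⟨ +-mono-≤ ≤-refl (sum-mono-≤ {K} (λ i → expTerm-lower (toℕ i) 0≤x 0≤q)) ⟩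
    expSum (suc K) (x + q)              ∎
    where
    f = λ (i : Fin K) → expTerm x (suc (toℕ i))
    g = λ (i : Fin K) → expTerm x (toℕ i)

  expSum-zero : ∀ K → expSum K 0# ≤ 1#
  expSum-zero zero    = 0≤1
  expSum-zero (suc K) = begin
    expTerm 0# 0 + sum (λ (i : Fin K) → expTerm 0# (suc (toℕ i)))
      ≤⟨ +-mono-≤ (≤-reflexive (expTerm-zero 0#)) (rest K (λ i → toℕ i)) ⟩
    1# + 0#                                                      ≈⟨ +-identityʳ 1# ⟩
    1#                                                           ∎
    where
    rest : ∀ k (e : Fin k → ℕ) → sum (λ i → expTerm 0# (suc (e i))) ≤ 0#
    rest zero    e = ≤-refl
    rest (suc k) e = begin
      0# * 0# ^ e zero * fromℕ (suc (e zero) !) ⁻¹ + sum (λ i → expTerm 0# (suc (e (suc i))))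
        ≤⟨ +-mono-≤ (≤-reflexive (solve 2 (λ a b → # 0 :* a :* b := # 0)
             refl (0# ^ e zero) (fromℕ (suc (e zero) !) ⁻¹))) (rest k (e ∘ suc)) ⟩
      0# + 0#  ≈⟨ +-identityʳ 0# ⟩
      0#       ∎

  1≤expSum : ∀ {x} K → 0# ≤ x → 1# ≤ expSum (suc K) x
  1≤expSum {x} K 0≤x = begin
    1#              ≈⟨ expTerm-zero x ⟨
    expTerm x 0     ≈⟨ +-identityʳ _ ⟨
    expTerm x 0 + 0# ≤⟨ series-mono (λ k → 0≤expTerm k 0≤x) {1} {suc K} (s≤s z≤n) ⟩
    expSum (suc K) x ∎

  -- The factor `X` allows bounds of the form `X * exp l ≤ Y` without division. If `X` vanishes, the
  -- bound at index 0 suffices; otherwise `ε` is the supposed gap divided by `X`.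
  limit-≤ : ∀ {s : ℕ → ℝ} {L X Y} → s ⟶ L → 0# ≤ X → (∀ K → X * s K ≤ Y) → X * L ≤ Y
  limit-≤ {s} {L} {X} {Y} s⟶L 0≤X bound with X * L ≤? Y
  ... | yes XL≤Y = XL≤Y
  ... | no  XL≰Y = ⊥-elim (<⇒≱ L<s+ε (*-cancelˡ-≤ 0<X (begin
    X * (s K + ε)
      ≈⟨ solve 3 (λ X s ε → X :* (s :+ ε) := X :* s :+ ε :* X) refl X (s K) ε ⟩
    X * s K + ε * X        ≤⟨ +-mono-≤ (bound K) (≤-reflexive (x/y*y≈x 0<X)) ⟩
    Y + (X * L - Y)        ≈⟨ solve 2 (λ Y Z → Y :+ (Z :- Y) := Z) refl Y (X * L) ⟩
    X * L                  ∎)))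
    where
    0<gap : 0# < X * L - Y
    0<gap = ≰⇒> λ gap≤0 → XL≰Y (certificate (x≤y⇒0≤y-x gap≤0)
      (solve 2 (λ Y Z → Y :- Z := # 0 :- (Z :- Y)) refl Y (X * L)))
    0<X : 0# < X
    0<X = ≰⇒> λ X≤0 → XL≰Y (begin
      X * L       ≈⟨ *-congʳ (antisym X≤0 0≤X) ⟩
      0# * L      ≈⟨ solve 2 (λ L s → # 0 :* L := # 0 :* s) refl L (s 0) ⟩
      0# * s 0    ≈⟨ *-congʳ (antisym X≤0 0≤X) ⟨
      X * s 0     ≤⟨ bound 0 ⟩
      Y           ∎)
    ε = (X * L - Y) / X
    K = proj₁ (s⟶L ε (0<-* 0<gap (0<⁻¹ 0<X)))
    L<s+ε = proj₁ (proj₂ (s⟶L ε (0<-* 0<gap (0<⁻¹ 0<X))) K ℕ.≤-refl)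

  limit-≥ : ∀ {s : ℕ → ℝ} {L X} K → s ⟶ L → (∀ M → K ℕ.≤ M → X ≤ s M) → X ≤ L
  limit-≥ {s} {L} {X} K s⟶L bound with X ≤? L
  ... | yes X≤L = X≤L
  ... | no  X≰L = ⊥-elim (<⇒≱ s<L+ε (begin
    L + (X - L)  ≈⟨ solve 2 (λ X L → L :+ (X :- L) := X) refl X L ⟩
    X            ≤⟨ bound M (ℕ.m≤n⊔m _ K) ⟩
    s M          ∎))
    where
    0<gap : 0# < X - L
    0<gap = ≰⇒> λ gap≤0 → X≰L (certificate (x≤y⇒0≤y-x gap≤0)
      (solve 2 (λ X L → L :- X := # 0 :- (X :- L)) refl X L))
    M = proj₁ (s⟶L (X - L) 0<gap) ℕ.⊔ K
    s<L+ε = proj₂ (proj₂ (s⟶L (X - L) 0<gap) M (ℕ.m≤m⊔n _ K))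

-- Patterns with no transmitter and with exactly one

none single : ∀ {n} → Vec Bool n → Bool
none []            = true
none (true  ∷ b)   = false
none (false ∷ b)   = none b
single []          = false
single (true  ∷ b) = none b
single (false ∷ b) = single b

none⇒false : ∀ {n} (b : Vec Bool n) → T (none b) → ∀ i → ¬ T (lookup b i)
none⇒false (false ∷ b) t (suc i) = none⇒false b t i

false⇒none : ∀ {n} (b : Vec Bool n) → (∀ i → ¬ T (lookup b i)) → T (none b)
false⇒none []          f = tt
false⇒none (true  ∷ b) f = f zero tt
false⇒none (false ∷ b) f = false⇒none b (f ∘ suc)

single⇒unique : ∀ {n} (b : Vec Bool n) → T (single b) →
                ∃[ v ] T (lookup b v) × (∀ w → T (lookup b w) → w ≡ v)
single⇒unique (true ∷ b) t = zero , tt , λ where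
  zero    _ → ≡.refl
  (suc w) u → ⊥-elim (none⇒false b t w u)
single⇒unique (false ∷ b) t with single⇒unique b t
... | v , bv , unique = suc v , bv , λ where (suc w) u → ≡.cong suc (unique w u)

unique⇒single : ∀ {n} (b : Vec Bool n) v → T (lookup b v) →
                (∀ w → T (lookup b w) → w ≡ v) → T (single b)
unique⇒single (true ∷ b) zero bv unique = false⇒none b λ i bi →
  0≢1+n (≡.sym (unique (suc i) bi))
unique⇒single (true ∷ b) (suc v) bv unique with () ← unique zero tt
unique⇒single (false ∷ b) (suc v) bv unique =
  unique⇒single b v bv λ w bw → suc-injective (unique (suc w) bw)

-- Independent transmissions: expectations, silence, lone transmissions

module Expectation (R : CompleteOrderedField) where

  open OrderedField R
  open ExponentialSeries R
  open ≤-Reasoning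

  indicator : Bool → ℝ
  indicator true  = 1#
  indicator false = 0#

  0≤indicator : ∀ b → 0# ≤ indicator b
  0≤indicator true  = 0≤1
  0≤indicator false = ≤-refl

  indicator≤1 : ∀ b → indicator b ≤ 1#
  indicator≤1 true  = ≤-refl
  indicator≤1 false = 0≤1

  IsProbability : ∀ {n} → (Fin n → ℝ) → Set
  IsProbability p = ∀ i → 0# ≤ p i × p i ≤ 1#

  -- Positions outside `P` are true with probability 0, so patterns that leave `P` carry no weight.
  -- With the informed nodes as `P`, only patterns in which all transmitters are informed have to be
  -- examined.
  expect-mono-on : ∀ {n} {p : Fin n → ℝ} {f g} (P : Fin n → Set) → IsProbability p →
                   (∀ i → P i ⊎ p i ≈ 0#) →
                   (∀ b → (∀ i → T (lookup b i) → P i) → f b ≤ g b) →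
                   expect p f ≤ expect p g
  expect-mono-on {zero} P 0≤p≤1 supp f≤g = f≤g [] λ ()
  expect-mono-on {suc n} {p} {f} {g} P 0≤p≤1 supp f≤g = +-mono-≤ transmits silent
    where
    silent : (1# - p zero) * expect (p ∘ suc) (f ∘ (false ∷_)) ≤
             (1# - p zero) * expect (p ∘ suc) (g ∘ (false ∷_))
    silent = *-monoˡ-≤ (x≤y⇒0≤y-x (proj₂ (0≤p≤1 zero)))
      (expect-mono-on (P ∘ suc) (0≤p≤1 ∘ suc) (supp ∘ suc) λ b b⊆P →
        f≤g (false ∷ b) λ where (suc i) → b⊆P i)
    transmits : p zero * expect (p ∘ suc) (f ∘ (true ∷_)) ≤
                p zero * expect (p ∘ suc) (g ∘ (true ∷_))
    transmits with supp zero
    ... | inj₁ P₀ = *-monoˡ-≤ (proj₁ (0≤p≤1 zero))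
      (expect-mono-on (P ∘ suc) (0≤p≤1 ∘ suc) (supp ∘ suc) λ b b⊆P →
        f≤g (true ∷ b) λ where
          zero    _ → P₀
          (suc i)   → b⊆P i)
    ... | inj₂ p₀≈0 = ≤-reflexive (begin-equality
      p zero * _ ≈⟨ *-congʳ p₀≈0 ⟩
      0# * _     ≈⟨ zeroˡ _ ⟩
      0#         ≈⟨ zeroˡ _ ⟨
      0# * _     ≈⟨ *-congʳ p₀≈0 ⟨
      p zero * _ ∎)

  expect-mono : ∀ {n} {p : Fin n → ℝ} {f g} → IsProbability p → (∀ b → f b ≤ g b) →
                expect p f ≤ expect p g
  expect-mono 0≤p≤1 f≤g =
    expect-mono-on (λ _ → ⊤) 0≤p≤1 (λ _ → inj₁ tt) (λ b _ → f≤g b)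

  expect-affine : ∀ {n} (p : Fin n → ℝ) f A B →
                  expect p (λ b → f b * A + B) ≈ expect p f * A + B
  expect-affine {zero}  p f A B = refl
  expect-affine {suc n} p f A B = begin-equality
    p₀ * expect p′ (λ b → f (true ∷ b) * A + B) + (1# - p₀) * expect p′ (λ b → f (false ∷ b) * A + B)
      ≈⟨ +-cong (*-congˡ (expect-affine p′ _ A B)) (*-congˡ (expect-affine p′ _ A B)) ⟩
    p₀ * (t * A + B) + (1# - p₀) * (s * A + B)
      ≈⟨ solve 5 (λ p t s A B → p :* (t :* A :+ B) :+ (# 1 :- p) :* (s :* A :+ B)
           := (p :* t :+ (# 1 :- p) :* s) :* A :+ B) refl p₀ t s A B ⟩
    (p₀ * t + (1# - p₀) * s) * A + B ∎
    where
    p₀ = p zero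
    p′ = p ∘ suc
    t = expect p′ (f ∘ (true ∷_))
    s = expect p′ (f ∘ (false ∷_))

  expect-const : ∀ {n} (p : Fin n → ℝ) c → expect p (λ _ → c) ≈ c
  expect-const {zero}  p c = refl
  expect-const {suc n} p c = trans
    (+-cong (*-congˡ (expect-const (p ∘ suc) c)) (*-congˡ (expect-const (p ∘ suc) c)))
    (solve 2 (λ p c → p :* c :+ (# 1 :- p) :* c := c) refl (p zero) c)

  expect-cong : ∀ {n} {p q : Fin n → ℝ} f → (∀ i → p i ≈ q i) → expect p f ≈ expect q f
  expect-cong {zero}  f p≈q = refl
  expect-cong {suc n} f p≈q = +-cong
    (*-cong (p≈q zero) (expect-cong _ (p≈q ∘ suc)))
    (*-cong (+-congˡ (-‿cong (p≈q zero))) (expect-cong _ (p≈q ∘ suc)))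

  0≤expect : ∀ {n} {p : Fin n → ℝ} {f} → IsProbability p → (∀ b → 0# ≤ f b) → 0# ≤ expect p f
  0≤expect {p = p} {f} 0≤p≤1 0≤f = begin
    0#                   ≈⟨ expect-const p 0# ⟨
    expect p (λ _ → 0#)  ≤⟨ expect-mono 0≤p≤1 0≤f ⟩
    expect p f           ∎

  expect≤ : ∀ {n} {p : Fin n → ℝ} {f c} → IsProbability p → (∀ b → f b ≤ c) → expect p f ≤ c
  expect≤ {p = p} {f} {c} 0≤p≤1 f≤c = begin
    expect p f           ≤⟨ expect-mono 0≤p≤1 f≤c ⟩
    expect p (λ _ → c)   ≈⟨ expect-const p c ⟩
    c                    ∎

  expect-lookup : ∀ {n} (p : Fin n → ℝ) i → expect p (λ b → indicator (lookup b i)) ≈ p i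
  expect-lookup p zero = trans
    (+-cong (*-congˡ (expect-const (p ∘ suc) 1#)) (*-congˡ (expect-const (p ∘ suc) 0#)))
    (solve 1 (λ p → p :* # 1 :+ (# 1 :- p) :* # 0 := p) refl (p zero))
  expect-lookup p (suc i) = trans
    (+-cong (*-congˡ (expect-lookup (p ∘ suc) i)) (*-congˡ (expect-lookup (p ∘ suc) i)))
    (solve 2 (λ p c → p :* c :+ (# 1 :- p) :* c := c) refl (p zero) (p (suc i)))

  probNone probSingle : ∀ {n} → (Fin n → ℝ) → ℝ
  probNone   p = expect p (indicator ∘ none)
  probSingle p = expect p (indicator ∘ single)

  0≤probNone : ∀ {n} {p : Fin n → ℝ} → IsProbability p → 0# ≤ probNone p
  0≤probNone 0≤p≤1 = 0≤expect 0≤p≤1 (λ b → 0≤indicator (none b))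

  0≤probSingle : ∀ {n} {p : Fin n → ℝ} → IsProbability p → 0# ≤ probSingle p
  0≤probSingle 0≤p≤1 = 0≤expect 0≤p≤1 (λ b → 0≤indicator (single b))

  -- For `x = 0` this is the bound `exp (- sum p)`, multiplied out. In the induction `x` collects
  -- the probabilities of the nodes already removed, and each factor `1 - p₀` is absorbed by
  -- `expSum-upper`.
  probNone-bound : ∀ {n} {p : Fin n → ℝ} {x} K → IsProbability p → 0# ≤ x →
                   probNone p * expSum K (x + sum p) ≤ expSum K x
  probNone-bound {zero} {p} {x} K _ 0≤x = begin
    1# * expSum K (x + 0#) ≈⟨ *-identityˡ _ ⟩
    expSum K (x + 0#)      ≤⟨ expSum-mono K (0≤x ⊕ ≤-refl) (≤-reflexive (+-identityʳ x)) ⟩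
    expSum K x             ∎
  probNone-bound {suc n} {p} {x} K 0≤p≤1 0≤x = begin
    (p₀ * expect p′ (λ _ → 0#) + (1# - p₀) * G) * S
      ≈⟨ *-congʳ (+-congʳ (*-congˡ (expect-const p′ 0#))) ⟩
    (p₀ * 0# + (1# - p₀) * G) * S
      ≈⟨ solve 3 (λ p G S → (p :* # 0 :+ (# 1 :- p) :* G) :* S := (# 1 :- p) :* (G :* S))
           refl p₀ G S ⟩
    (1# - p₀) * (G * S)
      ≤⟨ *-monoˡ-≤ 0≤1-p₀ (*-monoˡ-≤ (0≤probNone 0≤p′≤1) S≤) ⟩
    (1# - p₀) * (G * expSum K (x + p₀ + sum p′))
      ≤⟨ *-monoˡ-≤ 0≤1-p₀ (probNone-bound K 0≤p′≤1 (0≤x ⊕ 0≤p₀)) ⟩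
    (1# - p₀) * expSum K (x + p₀)
      ≤⟨ expSum-upper K 0≤x 0≤p₀ ⟩
    expSum K x ∎
    where
    p₀ = p zero
    p′ = p ∘ suc
    0≤p₀ = proj₁ (0≤p≤1 zero)
    0≤p′≤1 = 0≤p≤1 ∘ suc
    0≤1-p₀ = x≤y⇒0≤y-x (proj₂ (0≤p≤1 zero))
    G = probNone p′
    S = expSum K (x + (p₀ + sum p′))
    S≤ : S ≤ expSum K (x + p₀ + sum p′)
    S≤ = expSum-mono K (0≤x ⊕ 0≤p₀ ⊕ 0≤sum (proj₁ ∘ 0≤p′≤1)) (≤-reflexive
      (solve 3 (λ x p s → x :+ (p :+ s) := x :+ p :+ s) refl x p₀ (sum p′)))

  probSingle≤sum : ∀ {n} {p : Fin n → ℝ} → IsProbability p → probSingle p ≤ sum p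
  probSingle≤sum {zero} _ = ≤-refl
  probSingle≤sum {suc n} {p} 0≤p≤1 = certificate
    (0≤p₀ ⊗ x≤y⇒0≤y-x G≤1 ⊕ x≤y⇒0≤y-x (probSingle≤sum 0≤p′≤1) ⊕ 0≤p₀ ⊗ 0≤probSingle 0≤p′≤1)
    (solve 4 (λ p G F s → p :+ s :- (p :* G :+ (# 1 :- p) :* F)
       := p :* (# 1 :- G) :+ (s :- F :+ p :* F)) refl (p zero) (probNone p′) (probSingle p′) (sum p′))
    where
    p′ = p ∘ suc
    0≤p₀ = proj₁ (0≤p≤1 zero)
    0≤p′≤1 = 0≤p≤1 ∘ suc
    G≤1 : probNone p′ ≤ 1#
    G≤1 = expect≤ 0≤p′≤1 (λ b → indicator≤1 (none b))

  -- For x = 0 and z = sum p - 1 this is probSingle p ≤ s exp (1 - s), where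
  -- s = sum p.
  probSingle-bound : ∀ {n} {p : Fin n → ℝ} {x z} K → IsProbability p → 0# ≤ x → 0# ≤ z →
                     z + 1# ≤ x + sum p →
                     probSingle p * expSum (suc K) z ≤ sum p * expSum (suc K) x
  probSingle-bound {zero} K _ _ _ _ = ≤-reflexive (trans (zeroˡ _) (sym (zeroˡ _)))
  probSingle-bound {suc n} {p} {x} {z} K 0≤p≤1 0≤x 0≤z z+1≤ = begin
    (p₀ * G + (1# - p₀) * F) * S z
      ≈⟨ solve 4 (λ p G F S → (p :* G :+ (# 1 :- p) :* F) :* S := p :* (G :* S) :+ (# 1 :- p) :* S :* F)
           refl p₀ G F (S z) ⟩
    p₀ * (G * S z) + (1# - p₀) * S z * F
      ≤⟨ +-mono-≤ (*-monoˡ-≤ 0≤p₀ first) second ⟩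
    p₀ * S x + sum p′ * S x
      ≈⟨ solve 3 (λ p s S → p :* S :+ s :* S := (p :+ s) :* S) refl p₀ (sum p′) (S x) ⟩
    (p₀ + sum p′) * S x ∎
    where
    p₀ = p zero
    p′ = p ∘ suc
    0≤p₀ = proj₁ (0≤p≤1 zero)
    0≤p′≤1 = 0≤p≤1 ∘ suc
    G = probNone p′
    F = probSingle p′
    S = expSum (suc K)
    0≤F = 0≤probSingle 0≤p′≤1
    0≤sum-p′ = 0≤sum (proj₁ ∘ 0≤p′≤1)
    -- Node `zero` transmits and the others are silent. From `p₀ ≤ 1` follows `z ≤ x + sum p′`, so
    -- the bound on silence applies.
    first : G * S z ≤ S x
    first = ≤-trans
      (*-monoˡ-≤ (0≤probNone 0≤p′≤1) (expSum-mono (suc K) 0≤z (certificate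
        (x≤y⇒0≤y-x z+1≤ ⊕ x≤y⇒0≤y-x (proj₂ (0≤p≤1 zero)))
        (solve 4 (λ x p s z → x :+ s :- z := x :+ (p :+ s) :- (z :+ # 1) :+ (# 1 :- p))
          refl x p₀ (sum p′) z))))
      (probNone-bound (suc K) 0≤p′≤1 0≤x)
    -- Node `zero` is silent: the factor `1 - p₀` pays for lowering `z` by `p₀` in the induction
    -- hypothesis. If `p₀` exceeds `z`, it pays for lowering `z` to 0, and the crude bound
    -- `probSingle≤sum` is enough.
    second : (1# - p₀) * S z * F ≤ sum p′ * S x
    second with total p₀ z
    ... | inj₁ p₀≤z = begin
      (1# - p₀) * S z * F ≤⟨ *-monoʳ-≤ 0≤F (≤-trans
                               (*-monoˡ-≤ (x≤y⇒0≤y-x (proj₂ (0≤p≤1 zero)))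
                                 (expSum-mono (suc K) 0≤z (≤-reflexive
                                   (solve 2 (λ z p → z := z :- p :+ p) refl z p₀))))
                               (expSum-upper (suc K) (x≤y⇒0≤y-x p₀≤z) 0≤p₀)) ⟩
      S (z - p₀) * F      ≈⟨ *-comm _ _ ⟩
      F * S (z - p₀)      ≤⟨ probSingle-bound K 0≤p′≤1 0≤x (x≤y⇒0≤y-x p₀≤z)
                               (certificate (x≤y⇒0≤y-x z+1≤)
                                 (solve 4 (λ x p s z → x :+ s :- (z :- p :+ # 1)
                                    := x :+ (p :+ s) :- (z :+ # 1)) refl x p₀ (sum p′) z)) ⟩
      sum p′ * S x        ∎
    ... | inj₂ z≤p₀ = begin
      (1# - p₀) * S z * F        ≤⟨ *-monoʳ-≤ 0≤F (*-monoʳ-≤ (0≤expSum (suc K) 0≤z)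
                                      (certificate (x≤y⇒0≤y-x z≤p₀)
                                        (solve 2 (λ z p → # 1 :- z :- (# 1 :- p) := p :- z)
                                             refl z p₀))) ⟩
      (1# - z) * S z * F         ≤⟨ *-monoʳ-≤ 0≤F (*-monoˡ-≤
                                      (x≤y⇒0≤y-x (≤-trans z≤p₀ (proj₂ (0≤p≤1 zero))))
                                      (expSum-mono (suc K) 0≤z (≤-reflexive (sym (+-identityˡ z))))) ⟩
      (1# - z) * S (0# + z) * F  ≤⟨ *-monoʳ-≤ 0≤F (expSum-upper (suc K) ≤-refl 0≤z) ⟩
      S 0# * F
        ≤⟨ *-mono-≤ 0≤1 0≤F (expSum-zero (suc K)) (probSingle≤sum 0≤p′≤1) ⟩
      1# * sum p′                ≤⟨ *-monoʳ-≤ 0≤sum-p′ (1≤expSum K 0≤x) ⟩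
      S x * sum p′               ≈⟨ *-comm _ _ ⟩
      sum p′ * S x               ∎

-- Numerical bounds on e and ln, and the dichotomy between the two modes

module LogarithmBounds (R : CompleteOrderedField) where

  open OrderedField R
  open ExponentialSeries R
  open Expectation R
  open ≤-Reasoning

  -- The first four terms 1 + 1 + 1/2 + 1/6 already sum to 8/3. All of them are written as multiples
  -- of 1/3!, so that the ring solver can add them.
  8≤3e : ∀ {e} → IsExp 1# e → fromℕ 8 ≤ fromℕ 3 * e
  8≤3e {e} exp1 = begin
    fromℕ 8                ≈⟨ 8≈3S ⟩
    fromℕ 3 * expSum 4 1#  ≤⟨ *-monoˡ-≤ (0≤fromℕ 3) (limit-≥ 4 exp1 λ M 4≤M →
                                series-mono (λ k → 0≤expTerm k 0≤1) 4≤M) ⟩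
    fromℕ 3 * e            ∎
    where
    i : ℕ → ℝ
    i k = fromℕ (k !) ⁻¹
    one^ : ∀ k → 1# ^ k ≈ 1#
    one^ zero    = refl
    one^ (suc k) = trans (*-identityˡ _) (one^ k)
    term : ∀ k {x} → x ≈ i k → x ≈ expTerm 1# k
    term k x≈ = trans x≈ (trans (sym (*-identityˡ _)) (*-congʳ (sym (one^ k))))
    i₂ : fromℕ 3 * i 3 ≈ i 2
    i₂ = fact⁻¹-suc 2
    i₁ : fromℕ 2 * (fromℕ 3 * i 3) ≈ i 1
    i₁ = trans (*-congˡ i₂) (fact⁻¹-suc 1)
    i₀ : fromℕ 1 * (fromℕ 2 * (fromℕ 3 * i 3)) ≈ i 0
    i₀ = trans (*-congˡ i₁) (fact⁻¹-suc 0)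
    8≈3S : fromℕ 8 ≈ fromℕ 3 * expSum 4 1#
    8≈3S = begin-equality
      fromℕ 8
        ≈⟨ *-identityʳ _ ⟨
      fromℕ 8 * 1#
        ≈⟨ *-congˡ (trans (term 0 i₀) (expTerm-zero 1#)) ⟨
      fromℕ 8 * (fromℕ 1 * (fromℕ 2 * (fromℕ 3 * i 3)))
        ≈⟨ solve 1 (λ d → # 8 :* ((# 1 :+ # 0) :* (# 2 :* (# 3 :* d)))
             := # 3 :* ((# 1 :+ # 0) :* (# 2 :* (# 3 :* d)) :+ (# 2 :* (# 3 :* d)
                  :+ (# 3 :* d :+ (d :+ # 0))))) refl (i 3) ⟩
      fromℕ 3 * (fromℕ 1 * (fromℕ 2 * (fromℕ 3 * i 3)) + (fromℕ 2 * (fromℕ 3 * i 3)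
                  + (fromℕ 3 * i 3 + (i 3 + 0#))))
        ≈⟨ *-congˡ (+-cong (term 0 i₀) (+-cong (term 1 i₁) (+-cong (term 2 i₂) (+-congʳ (term 3 refl))))) ⟩
      fromℕ 3 * expSum 4 1# ∎

  quarter : ℝ
  quarter = fromℕ 4 ⁻¹

  0<4 : 0# < fromℕ 4
  0<4 = 0<fromℕ 4 (s≤s z≤n)

  0≤quarter : 0# ≤ quarter
  0≤quarter = <⇒≤ (0<⁻¹ 0<4)

  -- exp (1/4) ≤ 4/3
  expSum-quarters : ∀ K j → fromℕ 3 ^ j * expSum K (fromℕ j * quarter) ≤ fromℕ 4 ^ j
  expSum-quarters K zero = begin
    1# * expSum K (0# * quarter) ≈⟨ *-identityˡ _ ⟩
    expSum K (0# * quarter)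
      ≤⟨ expSum-mono K (≤-refl ⊗ 0≤quarter) (≤-reflexive (zeroˡ quarter)) ⟩
    expSum K 0#                  ≤⟨ expSum-zero K ⟩
    1#                           ∎
  expSum-quarters K (suc j) = begin
    fromℕ 3 * fromℕ 3 ^ j * expSum K (fromℕ (suc j) * quarter)
      ≤⟨ *-monoˡ-≤ (0≤fromℕ 3 ⊗ 0≤^ j (0≤fromℕ 3)) (expSum-mono K
           (0≤fromℕ (suc j) ⊗ 0≤quarter) (≤-reflexive
           (solve 2 (λ j q → (# 1 :+ j) :* q := j :* q :+ q) refl (fromℕ j) quarter))) ⟩
    fromℕ 3 * fromℕ 3 ^ j * S′
      ≈⟨ solve 2 (λ p s → # 3 :* p :* s := p :* ((# 4 :- # 1) :* s)) refl (fromℕ 3 ^ j) S′ ⟩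
    fromℕ 3 ^ j * ((fromℕ 4 - 1#) * S′)
      ≈⟨ *-congˡ (*-congʳ (+-congˡ (-‿cong (*-inverse 0<4)))) ⟨
    fromℕ 3 ^ j * ((fromℕ 4 - fromℕ 4 * quarter) * S′)
      ≈⟨ solve 3 (λ p s q → p :* ((# 4 :- # 4 :* q) :* s) := p :* (# 4 :* ((# 1 :- q) :* s)))
           refl (fromℕ 3 ^ j) S′ quarter ⟩
    fromℕ 3 ^ j * (fromℕ 4 * ((1# - quarter) * S′))
      ≤⟨ *-monoˡ-≤ (0≤^ j (0≤fromℕ 3)) (*-monoˡ-≤ (0≤fromℕ 4)
           (expSum-upper K (0≤fromℕ j ⊗ 0≤quarter) 0≤quarter)) ⟩
    fromℕ 3 ^ j * (fromℕ 4 * S)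
      ≈⟨ solve 2 (λ p s → p :* (# 4 :* s) := # 4 :* (p :* s)) refl (fromℕ 3 ^ j) S ⟩
    fromℕ 4 * (fromℕ 3 ^ j * S)
      ≤⟨ *-monoˡ-≤ (0≤fromℕ 4) (expSum-quarters K j) ⟩
    fromℕ 4 * fromℕ 4 ^ j ∎
    where
    S  = expSum K (fromℕ j * quarter)
    S′ = expSum K (fromℕ j * quarter + quarter)

  -- If `l` were below j/4, then `x` = exp l would be at most (4/3)^j.
  ln-lower : ∀ {x l} j → IsLn x l → 0# ≤ l → fromℕ 4 ^ j < fromℕ 3 ^ j * x → fromℕ j ≤ fromℕ 4 * l
  ln-lower {x} {l} j ln 0≤l 4^j<3^jx with fromℕ j ≤? fromℕ 4 * l
  ... | yes j≤4l = j≤4l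
  ... | no  j≰4l = ⊥-elim (<⇒≱ 4^j<3^jx (limit-≤ ln (0≤^ j (0≤fromℕ 3)) λ K → ≤-trans
    (*-monoˡ-≤ (0≤^ j (0≤fromℕ 3)) (expSum-mono K 0≤l l≤j/4)) (expSum-quarters K j)))
    where
    l≤j/4 : l ≤ fromℕ j * quarter
    l≤j/4 = *-cancelˡ-≤ 0<4 (begin
      fromℕ 4 * l                   ≤⟨ ≰⇒≥ j≰4l ⟩
      fromℕ j                       ≈⟨ x/y*y≈x 0<4 ⟨
      fromℕ j * quarter * fromℕ 4   ≈⟨ *-comm _ _ ⟩
      fromℕ 4 * (fromℕ j * quarter) ∎)

  0≤ln⇒0<ln : ∀ {x l} → 1# < x → IsLn x l → 0# ≤ l → 0# < l
  0≤ln⇒0<ln {x} {l} 1<x ln 0≤l = ≰⇒> λ l≤0 → <⇒≱ 1<x (begin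
    x        ≈⟨ *-identityˡ x ⟨
    1# * x   ≤⟨ limit-≤ ln 0≤1 (λ K → ≤-trans (≤-reflexive (*-identityˡ _))
                  (≤-trans (expSum-mono K 0≤l l≤0) (expSum-zero K))) ⟩
    1#       ∎)

  -- The bound s exp (1 - s) is brought down to the one exponential that is known, exp l = `x`: with
  -- `y = s - l - 1`, exp (s - 1) = exp l · exp y is at least `x` (1 + y) = `x` (s - l).
  probSingle-ln : ∀ {n} {p : Fin n → ℝ} {x l} → IsLn x l → 0# ≤ l → IsProbability p →
                  l + 1# ≤ sum p → probSingle p * (sum p - l) * x ≤ sum p
  probSingle-ln {p = p} {x} {l} ln 0≤l 0≤p≤1 l+1≤s = limit-≤ ln
    (0≤F ⊗ ≤-trans (0≤1 ⊕ 0≤y) (≤-reflexive 1+y)) λ K → begin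
    F * (s - l) * expSum K l             ≈⟨ *-congʳ (*-congˡ 1+y) ⟨
    F * (1# + y) * expSum K l            ≈⟨ *-assoc _ _ _ ⟩
    F * ((1# + y) * expSum K l)          ≤⟨ *-monoˡ-≤ 0≤F (expSum-lower K 0≤l 0≤y) ⟩
    F * expSum (suc K) (l + y)
      ≤⟨ probSingle-bound K 0≤p≤1 ≤-refl (0≤l ⊕ 0≤y) (≤-reflexive
                                              (solve 2 (λ l s → l :+ (s :- (l :+ # 1)) :+ # 1 := # 0 :+ s)
                                                   refl l s)) ⟩
    s * expSum (suc K) 0#
      ≤⟨ *-monoˡ-≤ (0≤sum (proj₁ ∘ 0≤p≤1)) (expSum-zero (suc K)) ⟩
    s * 1#                               ≈⟨ *-identityʳ s ⟩
    s                                    ∎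
    where
    F = probSingle p
    s = sum p
    y = s - (l + 1#)
    0≤F = 0≤probSingle 0≤p≤1
    0≤y : 0# ≤ y
    0≤y = x≤y⇒0≤y-x l+1≤s
    1+y : 1# + y ≈ s - l
    1+y = solve 2 (λ l s → # 1 :+ (s :- (l :+ # 1)) := s :- l) refl l s

  n/2*2≈n : ∀ n → fromℕ n / fromℕ 2 * fromℕ 2 ≈ fromℕ n
  n/2*2≈n n = x/y*y≈x (0<fromℕ 2 (s≤s z≤n))

  ln-half-lower : ∀ n {l} j m → IsLn (fromℕ n / fromℕ 2) l → 0# ≤ l → m ℕ.≤ n →
                  2 ℕ.* 4 ℕ.^ j ℕ.< m ℕ.* 3 ℕ.^ j → fromℕ j ≤ fromℕ 4 * l
  ln-half-lower n {l} j m ln 0≤l m≤n lt = ln-lower j ln 0≤l (≰⇒> λ 3^jx≤4^j →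
    ℕ.<⇒≱ lt (fromℕ-cancel-≤ (begin
    fromℕ (m ℕ.* 3 ℕ.^ j)         ≈⟨ trans (fromℕ-* m (3 ℕ.^ j)) (*-congˡ (fromℕ-^ 3 j)) ⟩
    fromℕ m * fromℕ 3 ^ j         ≤⟨ *-monoʳ-≤ (0≤^ j (0≤fromℕ 3)) (fromℕ-mono-≤ m≤n) ⟩
    fromℕ n * fromℕ 3 ^ j         ≈⟨ *-congʳ (n/2*2≈n n) ⟨
    x * fromℕ 2 * fromℕ 3 ^ j
      ≈⟨ solve 3 (λ x t p → x :* t :* p := t :* (p :* x)) refl x (fromℕ 2) (fromℕ 3 ^ j) ⟩
    fromℕ 2 * (fromℕ 3 ^ j * x)   ≤⟨ *-monoˡ-≤ (0≤fromℕ 2) 3^jx≤4^j ⟩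
    fromℕ 2 * fromℕ 4 ^ j         ≈⟨ trans (fromℕ-* 2 (4 ℕ.^ j)) (*-congˡ (fromℕ-^ 4 j)) ⟨
    fromℕ (2 ℕ.* 4 ℕ.^ j)         ∎)))
    where
    x = fromℕ n / fromℕ 2

  -- n ≥ 16 ln (n/2) forces n and hence ln (n/2) to be large: each lower bound
  -- j/4 on ln (n/2) yields n ≥ 4j.
  ln-large : ∀ {n l} → IsLn (fromℕ n / fromℕ 2) l → 0# ≤ l → 4 ℕ.≤ n →
             fromℕ 16 * l ≤ fromℕ n → fromℕ 10 ≤ fromℕ 4 * l × 40 ℕ.≤ n
  ln-large {n} {l} ln 0≤l 4≤n 16l≤n = b₅ , grow 10 b₅
    where
    grow : ∀ j → fromℕ j ≤ fromℕ 4 * l → 4 ℕ.* j ℕ.≤ n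
    grow j j≤4l = fromℕ-cancel-≤ (begin
      fromℕ (4 ℕ.* j)          ≈⟨ fromℕ-* 4 j ⟩
      fromℕ 4 * fromℕ j        ≤⟨ *-monoˡ-≤ (0≤fromℕ 4) j≤4l ⟩
      fromℕ 4 * (fromℕ 4 * l)  ≈⟨ solve 1 (λ l → # 4 :* (# 4 :* l) := # 16 :* l) refl l ⟩
      fromℕ 16 * l             ≤⟨ 16l≤n ⟩
      fromℕ n                  ∎)
    lower = λ j m → ln-half-lower n j m ln 0≤l
    -- Each `j` is the largest with (4/3)^j < m/2 for the lower bound `m` on `n` reached so far; the
    -- bounds on `n` run through 4, 8, 16, 28, 36, 40, where the iteration becomes stationary.
    b₁ = lower 2 4 4≤n (toWitness {a? = 32 ℕ.<? 36} tt)
    b₂ = lower 4 8 (grow 2 b₁) (toWitness {a? = 512 ℕ.<? 648} tt)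
    b₃ = lower 7 16 (grow 4 b₂) (toWitness {a? = 32768 ℕ.<? 34992} tt)
    b₄ = lower 9 28 (grow 7 b₃) (toWitness {a? = 524288 ℕ.<? 551124} tt)
    b₅ = lower 10 36 (grow 9 b₄) (toWitness {a? = 2097152 ℕ.<? 2125764} tt)

  16l≤n : ∀ {l x} t → 0# ≤ l → fromℕ 16 * fromℕ (suc t) * l ≤ x → fromℕ 16 * l ≤ x
  16l≤n {l} t 0≤l = ≤-trans (certificate (0≤fromℕ 16 ⊗ 0≤fromℕ t ⊗ 0≤l)
    (solve 2 (λ t l → # 16 :* (# 1 :+ t) :* l :- # 16 :* l := # 16 :* (t :* l))
         refl (fromℕ t) l))

  -- The threshold for `sum p` is f l with f = 7/5. If `sum p` is at most f l, then 16 τ `sum p` ≤ f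
  -- n, which is at most 3 N if f stays below 3/2 by a margin for odd `n`. If it is larger,
  -- `probSingle-ln` requires f l ≥ l + 1; as l ≥ 5/2 is known, f = 7/5 is just large enough. Then s
  -- - l ≥ 2s/7, so `probSingle p` ≤ 7/n and 16 τ `probSingle p` ≤ 7/l ≤ 14/5.
  crowded-or-light : ∀ n N τ {l M} {p : Fin M → ℝ} → IsLn (fromℕ n / fromℕ 2) l → 0# ≤ l → 4 ℕ.≤ n →
              n ℕ.≤ 1 ℕ.+ 2 ℕ.* N → fromℕ 16 * fromℕ τ * l ≤ fromℕ n → IsProbability p →
              fromℕ 16 * fromℕ τ * probSingle p ≤ fromℕ 3 ⊎
              fromℕ 16 * fromℕ τ * sum p ≤ fromℕ 3 * fromℕ N
  crowded-or-light n N zero {p = p} _ _ _ _ _ _ = inj₁ (begin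
    fromℕ 16 * 0# * probSingle p
      ≈⟨ solve 1 (λ F → # 16 :* # 0 :* F := # 0) refl (probSingle p) ⟩
    0#                           ≤⟨ 0≤fromℕ 3 ⟩
    fromℕ 3                      ∎)
  crowded-or-light n N τ@(suc τ-1) {l} {p = p} ln 0≤l 4≤n n≤1+2N κl≤n 0≤p≤1
    with fromℕ 5 * sum p ≤? fromℕ 7 * l
  ... | yes 5s≤7l = inj₂ (*-cancelˡ-≤ (0<fromℕ 5 (s≤s z≤n)) (begin
    fromℕ 5 * (κ * s)       ≈⟨ solve 2 (λ κ s → # 5 :* (κ :* s) := κ :* (# 5 :* s)) refl κ s ⟩
    κ * (fromℕ 5 * s)       ≤⟨ *-monoˡ-≤ 0≤κ 5s≤7l ⟩
    κ * (fromℕ 7 * l)       ≈⟨ solve 2 (λ κ l → κ :* (# 7 :* l) := # 7 :* (κ :* l)) refl κ l ⟩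
    fromℕ 7 * (κ * l)       ≤⟨ *-monoˡ-≤ (0≤fromℕ 7) κl≤n ⟩
    fromℕ 7 * fromℕ n       ≈⟨ fromℕ-* 7 n ⟨
    fromℕ (7 ℕ.* n)         ≤⟨ fromℕ-mono-≤ 7n≤15N ⟩
    fromℕ (15 ℕ.* N)        ≈⟨ fromℕ-* 15 N ⟩
    fromℕ 15 * fromℕ N      ≈⟨ solve 1 (λ N → # 15 :* N := # 5 :* (# 3 :* N)) refl (fromℕ N) ⟩
    fromℕ 5 * (fromℕ 3 * fromℕ N) ∎))
    where
    κ = fromℕ 16 * fromℕ τ
    s = sum p
    0≤κ = 0≤fromℕ 16 ⊗ 0≤fromℕ τ
    7≤N : 7 ℕ.≤ N
    7≤N = ℕ.*-cancelˡ-≤ 2 (ℕ.≤-trans (toWitness {a? = 14 ℕ.≤? 39} tt)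
      (ℕ.≤-pred (ℕ.≤-trans (proj₂ (ln-large ln 0≤l 4≤n (16l≤n τ-1 0≤l κl≤n))) n≤1+2N)))
    7n≤15N : 7 ℕ.* n ℕ.≤ 15 ℕ.* N
    7n≤15N = fromℕ-cancel-≤ (begin
      fromℕ (7 ℕ.* n)                     ≈⟨ fromℕ-* 7 n ⟩
      fromℕ 7 * fromℕ n                   ≤⟨ *-monoˡ-≤ (0≤fromℕ 7) (fromℕ-mono-≤ n≤1+2N) ⟩
      fromℕ 7 * (1# + fromℕ (2 ℕ.* N))    ≈⟨ *-congˡ (+-congˡ (fromℕ-* 2 N)) ⟩
      fromℕ 7 * (1# + fromℕ 2 * fromℕ N)  ≤⟨ certificate (x≤y⇒0≤y-x (fromℕ-mono-≤ 7≤N))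
        (solve 1 (λ N → # 15 :* N :- # 7 :* (# 1 :+ # 2 :* N) := N :- # 7) refl (fromℕ N)) ⟩
      fromℕ 15 * fromℕ N                  ≈⟨ fromℕ-* 15 N ⟨
      fromℕ (15 ℕ.* N)                    ∎)
  ... | no 5s≰7l = inj₁ (*-cancelˡ-≤ 0<l (begin
    l * (κ * F)       ≈⟨ solve 3 (λ l κ F → l :* (κ :* F) := κ :* l :* F) refl l κ F ⟩
    κ * l * F         ≤⟨ *-monoʳ-≤ 0≤F κl≤n ⟩
    fromℕ n * F       ≤⟨ nF≤7 ⟩
    fromℕ 7           ≤⟨ *-cancelˡ-≤ 0<4 (certificate
                           (0≤fromℕ 3 ⊗ x≤y⇒0≤y-x 10≤4l ⊕ 0≤fromℕ 2)
                           (solve 1 (λ l → # 4 :* (l :* # 3) :- # 4 :* # 7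
                              := # 3 :* (# 4 :* l :- # 10) :+ # 2) refl l)) ⟩
    l * fromℕ 3       ∎))
    where
    κ = fromℕ 16 * fromℕ τ
    s = sum p
    F = probSingle p
    x = fromℕ n / fromℕ 2
    0≤F = 0≤probSingle 0≤p≤1
    7l≤5s = ≰⇒≥ 5s≰7l
    10≤4l : fromℕ 10 ≤ fromℕ 4 * l
    10≤4l = proj₁ (ln-large ln 0≤l 4≤n (16l≤n τ-1 0≤l κl≤n))
    0<l : 0# < l
    0<l = ≰⇒> λ l≤0 → <⇒≱ (0<fromℕ 10 (s≤s z≤n)) (≤-trans 10≤4l (≤-trans
      (*-monoˡ-≤ (0≤fromℕ 4) l≤0) (≤-reflexive (zeroʳ _))))
    l+1≤s : l + 1# ≤ s
    l+1≤s = *-cancelˡ-≤ (0<fromℕ 10 (s≤s z≤n)) (certificate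
      (0≤fromℕ 2 ⊗ x≤y⇒0≤y-x 7l≤5s ⊕ x≤y⇒0≤y-x 10≤4l)
      (solve 2 (λ l s → # 10 :* s :- # 10 :* (l :+ # 1)
         := # 2 :* (# 5 :* s :- # 7 :* l) :+ (# 4 :* l :- # 10)) refl l s))
    0<s : 0# < s
    0<s = <-≤-trans 0<1 (≤-trans (certificate 0≤l
      (solve 1 (λ l → l :+ # 1 :- # 1 := l) refl l)) l+1≤s)
    nF≤7 : fromℕ n * F ≤ fromℕ 7
    nF≤7 = *-cancelˡ-≤ (0<-* (0<fromℕ 2 (s≤s z≤n)) 0<s) (begin
      fromℕ 2 * s * (fromℕ n * F)
        ≤⟨ *-monoʳ-≤ (0≤fromℕ n ⊗ 0≤F) (certificate (x≤y⇒0≤y-x 7l≤5s)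
             (solve 2 (λ l s → # 7 :* (s :- l) :- # 2 :* s := # 5 :* s :- # 7 :* l) refl l s)) ⟩
      fromℕ 7 * (s - l) * (fromℕ n * F)
        ≈⟨ *-congˡ (*-congʳ (n/2*2≈n n)) ⟨
      fromℕ 7 * (s - l) * (x * fromℕ 2 * F)
        ≈⟨ solve 3 (λ d x F → # 7 :* d :* (x :* # 2 :* F) := # 14 :* (F :* d :* x))
             refl (s - l) x F ⟩
      fromℕ 14 * (F * (s - l) * x)
        ≤⟨ *-monoˡ-≤ (0≤fromℕ 14) (probSingle-ln ln 0≤l 0≤p≤1 l+1≤s) ⟩
      fromℕ 14 * s
        ≈⟨ solve 1 (λ s → # 14 :* s := # 2 :* s :* # 7) refl s ⟩
      fromℕ 2 * s * fromℕ 7 ∎)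

-- The far nodes N, …, n - 1 are informed one after the other, in this order.
-- In idle c g and contact c p the far nodes below c have been informed; g + 1
-- idle slots remain in the former, and in the latter the cluster node p is kept
-- in contact with the far node c.
data Phase (n : ℕ) : Set where
  start   : Phase n
  idle    : ℕ → ℕ → Phase n
  contact : ℕ → Fin n → Phase n

-- Distances on a line, potential and hazards

module Network (R : CompleteOrderedField) where

  open OrderedField R
  open Geocast R
  open Expectation R
  open LogarithmBounds R
  open ≤-Reasoning hiding (start)

  -- All nodes are placed on the first axis. There ρ² - (x - y)² factors into the two differences
  -- that are assumed nonnegative.
  within-line : ∀ {ρ x y} → 0# ≤ ρ → x - y ≤ ρ → y - x ≤ ρ → Within ρ (x , 0#) (y , 0#)
  within-line {ρ} {x} {y} 0≤ρ x-y≤ρ y-x≤ρ = 0≤ρ , certificate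
    (x≤y⇒0≤y-x x-y≤ρ ⊗ x≤y⇒0≤y-x y-x≤ρ)
    (solve 3 (λ ρ x y → ρ :* ρ :- ((x :- y) :* (x :- y) :+ (# 0 :- # 0) :* (# 0 :- # 0))
       := (ρ :- (x :- y)) :* (ρ :- (y :- x))) refl ρ x y)

  within-line⁻ : ∀ {ρ x y} → Within ρ (x , 0#) (y , 0#) → x - y ≤ ρ
  within-line⁻ {ρ} {x} {y} (0≤ρ , D²≤ρ²) with x - y ≤? ρ
  ... | yes x-y≤ρ = x-y≤ρ
  ... | no  x-y≰ρ = *-cancelˡ-≤ (≤-<-trans 0≤ρ (≰⇒> x-y≰ρ)) (begin
    (x - y) * (x - y) ≈⟨ solve 2 (λ x y → (x :- y) :* (x :- y)
                           := (x :- y) :* (x :- y) :+ (# 0 :- # 0) :* (# 0 :- # 0)) refl x y ⟩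
    sqDist (x , 0#) (y , 0#) ≤⟨ D²≤ρ² ⟩
    ρ * ρ             ≤⟨ *-monoʳ-≤ 0≤ρ (≰⇒≥ x-y≰ρ) ⟩
    (x - y) * ρ       ∎)

  -- A contact that ends within τ slots is short.  At most L - 1 of the contacts
  -- can be long, for lack of time; weight L bounds (1/16)^{- #long}, and
  -- weight 0 = 0 says that not even short contacts can all be completed.
  weight : ℕ → ℝ
  weight zero    = 0#
  weight (suc L) = fromℕ 16 ^ L

  sixteenth : ℝ
  sixteenth = fromℕ 16 ⁻¹

  0<16 : 0# < fromℕ 16
  0<16 = 0<fromℕ 16 (s≤s z≤n)

  0≤sixteenth : 0# ≤ sixteenth
  0≤sixteenth = <⇒≤ (0<⁻¹ 0<16)

  0≤weight : ∀ L → 0# ≤ weight L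
  0≤weight zero    = ≤-refl
  0≤weight (suc L) = 0≤^ L (0≤fromℕ 16)

  weight-pred : ∀ L → weight (ℕ.pred L) ≤ sixteenth * weight L
  weight-pred zero       = ≤-reflexive (sym (zeroʳ _))
  weight-pred (suc zero) = 0≤sixteenth ⊗ 0≤1
  weight-pred (suc (suc L)) = ≤-reflexive (begin-equality
    w                     ≈⟨ *-identityˡ w ⟨
    1# * w                ≈⟨ *-congʳ (*-inverse 0<16) ⟨
    fromℕ 16 * s * w
      ≈⟨ solve 3 (λ f s w → f :* s :* w := s :* (f :* w)) refl (fromℕ 16) s w ⟩
    s * (fromℕ 16 * w)    ∎)
    where
    s = sixteenth
    w = fromℕ 16 ^ L

  -- Bounds the probability of success when `m` far nodes are still to be served and the time left
  -- admits fewer than `L` long contacts. Each far node contributes 1/4 = 3/16 + 1/16, for a short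
  -- and for a long contact; the second summand is genuine only because `weight` drops by a factor
  -- 16 after a long contact.
  potential : ℕ → ℕ → ℝ
  potential m L = quarter ^ m * weight L

  0≤potential : ∀ m L → 0# ≤ potential m L
  0≤potential m L = 0≤^ m 0≤quarter ⊗ 0≤weight L

  -- From the slot in which the cluster is informed on, its nodes transmit
  -- with probabilities that depend on the slot only.
  module Rates {n : ℕ} (N : ℕ) (crowded : ℕ → Bool) (Π : ObliviousProtocol n) where

    open ObliviousProtocol Π using (prob; prob≥0; prob≤1)

    clusterProb : ℕ → Fin n → ℝ
    clusterProb t i = if ⌊ toℕ i ℕ.<? N ⌋ then prob i t else 0#

    -- The probability that slot `t` covers the far node in contact when `p` is its partner; see
    -- `expect-success`.
    hazard : ℕ → Fin n → ℝ
    hazard t p = if crowded t then probSingle (clusterProb t) else clusterProb t p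

    -- A union bound for being covered in one of `w` slots, the first of which is `t`.
    hazardSum : ℕ → ℕ → Fin n → ℝ
    hazardSum zero    t p = 0#
    hazardSum (suc w) t p = hazard t p + hazardSum w (suc t) p

    clusterProb-isProbability : ∀ t → IsProbability (clusterProb t)
    clusterProb-isProbability t i with toℕ i ℕ.<? N
    ... | yes _ = prob≥0 i t , prob≤1 i t
    ... | no  _ = ≤-refl , 0≤1

    0≤hazard : ∀ t p → 0# ≤ hazard t p
    0≤hazard t p with crowded t
    ... | true  = 0≤probSingle (clusterProb-isProbability t)
    ... | false = proj₁ (clusterProb-isProbability t p)

    0≤hazardSum : ∀ w t p → 0# ≤ hazardSum w t p
    0≤hazardSum zero    t p = ≤-refl
    0≤hazardSum (suc w) t p = 0≤hazard t p ⊕ 0≤hazardSum w (suc t) p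

  -- The time limit reserves `α` idle slots for each of `m` far nodes and `suc τ` slots for each of
  -- `L` long contacts. In less time, fewer than `L` contacts can outlast `τ` slots if all far nodes
  -- are to be served.
  SlowAdversary : ∀ {n} (Vmax r d : ℝ) → ObliviousProtocol n → (α β N τ : ℕ) → Set
  SlowAdversary {n} Vmax r d Π α β N τ = Σ[ 𝒜 ∈ Adversary n Vmax ]
    (let open Execution r d Π 𝒜 in
     IsConnected α β ×
     (∀ k m L → N ℕ.+ m ≡ n → k ℕ.< α ℕ.* m ℕ.+ suc τ ℕ.* L →
       probSolvedWithin k ≤ potential m L))

  -- The adversary: phases, positions and activity

  module Strategy {n : ℕ} {Vmax : ℝ} (r d δ : ℝ) (0<δ : 0# < δ)
    (2nδ≤Vmax : fromℕ (2 ℕ.* n) * δ ≤ Vmax) (2nδ<r : fromℕ (2 ℕ.* n) * δ < r)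
    (r+2nδ≤d : r + fromℕ (2 ℕ.* n) * δ ≤ d)
    (N a : ℕ) (N<n : N ℕ.< n) (src mate : Fin n) (src<N : toℕ src ℕ.< N)
    (mate<N : toℕ mate ℕ.< N) (src≢mate : src ≢ mate)
    (crowded : ℕ → Bool) (partner : ℕ → Fin n) (partner<N : ∀ t → toℕ (partner t) ℕ.< N)
    (Π : ObliviousProtocol n)
    where

    -- In a crowded slot the whole cluster is in range of the far node in
    -- contact, otherwise only its partner is.
    success : ℕ → Fin n → Vec Bool n → Bool
    success t p b = if crowded t then single b else lookup b p

    next : ℕ → Phase n → Vec Bool n → Phase n
    next t start          b = if lookup b src then idle N a else start
    next t (idle c (suc g)) b = idle c g
    -- The contact starts in the slot after `t`, so its partner is the one chosen for a window that
    -- begins at `suc t`.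
    next t (idle c zero)  b = contact c (partner (suc t))
    next t (contact c p)  b = if success t p b then idle (suc c) a else contact c p

    phase : History n → Phase n
    phase []      = start
    phase (b ∷ h) = next (length h) (phase h) b

    progress : Phase n → ℕ
    progress start         = N
    progress (idle c _)    = c
    progress (contact c _) = c

    -- The partner alone moves to offset `n`; all other cluster nodes are below. A far node at
    -- offset 0 thus hears the whole cluster, at offset `n` the partner only, and beyond `n` no
    -- cluster node.
    clusterOffset : Phase n → Fin n → ℕ
    clusterOffset (contact _ p) i = if ⌊ i ≟ p ⌋ then n else toℕ i
    clusterOffset _             i = toℕ i

    farOffset : Phase n → ℕ → Fin n → ℕ
    farOffset (contact c _) t i =
      if ⌊ toℕ i ℕ.≟ c ⌋ then (if crowded t then 0 else n) else suc (n ℕ.+ toℕ i)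
    farOffset _             t i = suc (n ℕ.+ toℕ i)

    -- A far node at offset u is in range of a cluster node at offset v if and
    -- only if u ≤ v.
    coordinate : Phase n → ℕ → Fin n → ℝ
    coordinate φ t i = if ⌊ toℕ i ℕ.<? N ⌋
      then fromℕ (clusterOffset φ i) * δ
      else r + fromℕ (farOffset φ t i) * δ

    position : Phase n → ℕ → Fin n → Point
    position φ t i = coordinate φ t i , 0#

    -- All far nodes are within range of each other, so a far node that kept the information could
    -- cover the later ones itself. Asleep, it loses the information, and only the cluster can
    -- transmit.
    Awake : Phase n → Fin n → Set
    Awake φ i = toℕ i ℕ.< N ⊎ progress φ ℕ.≤ toℕ i

    awake? : ∀ φ i → Dec (Awake φ i)
    awake? φ i = (toℕ i ℕ.<? N) ⊎-dec (progress φ ℕ.≤? toℕ i)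

    0≤offset : ∀ k → 0# ≤ fromℕ k * δ
    0≤offset k = 0≤fromℕ k ⊗ <⇒≤ 0<δ

    offset-mono : ∀ {j k} → j ℕ.≤ k → fromℕ j * δ ≤ fromℕ k * δ
    offset-mono j≤k = *-monoʳ-≤ (<⇒≤ 0<δ) (fromℕ-mono-≤ j≤k)

    offset-cancel : ∀ {j k} → fromℕ j * δ ≤ fromℕ k * δ → j ℕ.≤ k
    offset-cancel jδ≤kδ = fromℕ-cancel-≤ (*-cancelˡ-≤ 0<δ
      (≤-trans (≤-reflexive (*-comm _ _)) (≤-trans jδ≤kδ (≤-reflexive (*-comm _ _)))))

    0<r : 0# < r
    0<r = ≤-<-trans (0≤offset (2 ℕ.* n)) 2nδ<r

    0≤r = <⇒≤ 0<r

    0≤d : 0# ≤ d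
    0≤d = ≤-trans (0≤r ⊕ 0≤offset (2 ℕ.* n)) r+2nδ≤d

    n≤2n : n ℕ.≤ 2 ℕ.* n
    n≤2n = ℕ.m≤m+n n _

    clusterOffset≤n : ∀ φ i → clusterOffset φ i ℕ.≤ n
    clusterOffset≤n start      i = ℕ.<⇒≤ (toℕ<n i)
    clusterOffset≤n (idle _ _) i = ℕ.<⇒≤ (toℕ<n i)
    clusterOffset≤n (contact _ p) i with i ≟ p
    ... | yes _ = ℕ.≤-refl
    ... | no  _ = ℕ.<⇒≤ (toℕ<n i)

    farOffset≤2n : ∀ φ t i → farOffset φ t i ℕ.≤ 2 ℕ.* n
    farOffset≤2n φ t i = go φ
      where
      n+i<2n : suc (n ℕ.+ toℕ i) ℕ.≤ 2 ℕ.* n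
      n+i<2n rewrite ℕ.+-identityʳ n = ℕ.+-monoʳ-< n (toℕ<n i)
      go : ∀ φ → farOffset φ t i ℕ.≤ 2 ℕ.* n
      go start      = n+i<2n
      go (idle _ _) = n+i<2n
      go (contact c _) with toℕ i ℕ.≟ c | crowded t
      ... | yes _ | true  = z≤n
      ... | yes _ | false = n≤2n
      ... | no  _ | _     = n+i<2n

    clusterOffset-injective : ∀ φ {i j} → clusterOffset φ i ≡ clusterOffset φ j → i ≡ j
    clusterOffset-injective start      eq = toℕ-injective eq
    clusterOffset-injective (idle _ _) eq = toℕ-injective eq
    clusterOffset-injective (contact _ p) {i} {j} eq with i ≟ p | j ≟ p
    ... | yes i≡p | yes j≡p = ≡.trans i≡p (≡.sym j≡p)
    ... | yes _   | no  _   = ⊥-elim (ℕ.<⇒≢ (toℕ<n j) (≡.sym eq))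
    ... | no  _   | yes _   = ⊥-elim (ℕ.<⇒≢ (toℕ<n i) eq)
    ... | no  _   | no  _   = toℕ-injective eq

    farOffset-injective : ∀ φ t {i j} → farOffset φ t i ≡ farOffset φ t j → i ≡ j
    farOffset-injective start      t eq = toℕ-injective (ℕ.+-cancelˡ-≡ n _ _ (ℕ.suc-injective eq))
    farOffset-injective (idle _ _) t eq = toℕ-injective (ℕ.+-cancelˡ-≡ n _ _ (ℕ.suc-injective eq))
    farOffset-injective (contact c _) t {i} {j} eq with toℕ i ℕ.≟ c | toℕ j ℕ.≟ c
    ... | yes i≡c | yes j≡c = toℕ-injective (≡.trans i≡c (≡.sym j≡c))
    ... | no  _   | no  _   = toℕ-injective (ℕ.+-cancelˡ-≡ n _ _ (ℕ.suc-injective eq))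
    ... | yes _   | no  _   with crowded t
    ...   | true  with () ← eq
    ...   | false = ⊥-elim (ℕ.<⇒≢ (s≤s (ℕ.m≤m+n n _)) eq)
    farOffset-injective (contact c _) t {i} {j} eq | no _ | yes _ with crowded t
    ...   | true  with () ← eq
    ...   | false = ⊥-elim (ℕ.<⇒≢ (s≤s (ℕ.m≤m+n n _)) (≡.sym eq))

    coordinate-cluster : ∀ φ t {i} → toℕ i ℕ.< N → coordinate φ t i ≡ fromℕ (clusterOffset φ i) * δ
    coordinate-cluster φ t {i} i<N with toℕ i ℕ.<? N
    ... | yes _  = ≡.refl
    ... | no i≮N = ⊥-elim (i≮N i<N)

    coordinate-far : ∀ φ t {i} → N ℕ.≤ toℕ i → coordinate φ t i ≡ r + fromℕ (farOffset φ t i) * δ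
    coordinate-far φ t {i} N≤i with toℕ i ℕ.<? N
    ... | yes i<N = ⊥-elim (ℕ.<⇒≱ i<N N≤i)
    ... | no _    = ≡.refl

    cluster<r : ∀ φ i → fromℕ (clusterOffset φ i) * δ < r
    cluster<r φ i = ≤-<-trans (offset-mono (ℕ.≤-trans (clusterOffset≤n φ i) n≤2n)) 2nδ<r

    cluster≢far : ∀ φ i k → ¬ fromℕ (clusterOffset φ i) * δ ≈ r + fromℕ k * δ
    cluster≢far φ i k eq = <⇒≱ (cluster<r φ i) (begin
      r                              ≤⟨ certificate (0≤offset k) (solve 2 (λ r k → r :+ k :- r := k)
           refl r (fromℕ k * δ)) ⟩
      r + fromℕ k * δ                ≈⟨ eq ⟨
      fromℕ (clusterOffset φ i) * δ  ∎)

    coordinate-injective : ∀ φ t {i j} → coordinate φ t i ≈ coordinate φ t j → i ≡ j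
    coordinate-injective φ t {i} {j} eq with toℕ i ℕ.<? N | toℕ j ℕ.<? N
    ... | yes _ | yes _ = clusterOffset-injective φ (ℕ.≤-antisym
      (offset-cancel {clusterOffset φ i} {clusterOffset φ j} (≤-reflexive eq))
      (offset-cancel {clusterOffset φ j} {clusterOffset φ i} (≤-reflexive (sym eq))))
    ... | yes _ | no  _ = ⊥-elim (cluster≢far φ i (farOffset φ t j) eq)
    ... | no  _ | yes _ = ⊥-elim (cluster≢far φ j (farOffset φ t i) (sym eq))
    ... | no  _ | no  _ = farOffset-injective φ t (ℕ.≤-antisym
      (offset-cancel {farOffset φ t i} {farOffset φ t j} (+-cancel eq))
      (offset-cancel {farOffset φ t j} {farOffset φ t i} (+-cancel (sym eq))))
      where
      +-cancel : ∀ {x y} → r + x ≈ r + y → x ≤ y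
      +-cancel {x} {y} eq = certificate (x≤y⇒0≤y-x (≤-reflexive eq))
        (solve 3 (λ r x y → y :- x := r :+ y :- (r :+ x)) refl r x y)

    offset-difference : ∀ {j} k → j ℕ.≤ 2 ℕ.* n → fromℕ j * δ - fromℕ k * δ ≤ fromℕ (2 ℕ.* n) * δ
    offset-difference {j} k j≤2n = certificate (x≤y⇒0≤y-x (offset-mono j≤2n) ⊕ 0≤offset k)
      (solve 3 (λ j k m → m :- (j :- k) := m :- j :+ k)
           refl (fromℕ j * δ) (fromℕ k * δ) (fromℕ (2 ℕ.* n) * δ))

    coordinate-moves : ∀ φ t φ′ t′ i → coordinate φ t i - coordinate φ′ t′ i ≤ fromℕ (2 ℕ.* n) * δ
    coordinate-moves φ t φ′ t′ i with toℕ i ℕ.<? N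
    ... | yes _ = offset-difference (clusterOffset φ′ i) (ℕ.≤-trans (clusterOffset≤n φ i) n≤2n)
    ... | no  _ = ≤-trans (≤-reflexive (solve 3 (λ r x y → r :+ x :- (r :+ y) := x :- y)
         refl r _ _))
      (offset-difference (farOffset φ′ t′ i) (farOffset≤2n φ t i))

    cluster-within : ∀ φ t {i j} → toℕ i ℕ.< N → toℕ j ℕ.< N → Within r (position φ t i) (position φ t j)
    cluster-within φ t {i} {j} i<N j<N
      rewrite coordinate-cluster φ t i<N | coordinate-cluster φ t j<N = within-line 0≤r
      (≤-trans (offset-difference (clusterOffset φ j) (ℕ.≤-trans (clusterOffset≤n φ i) n≤2n)) (<⇒≤ 2nδ<r))
      (≤-trans (offset-difference (clusterOffset φ i) (ℕ.≤-trans (clusterOffset≤n φ j) n≤2n)) (<⇒≤ 2nδ<r))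

    far-within : ∀ φ t {u v} → N ℕ.≤ toℕ u → toℕ v ℕ.< N → farOffset φ t u ℕ.≤ clusterOffset φ v →
                 Within r (position φ t u) (position φ t v) ×
                 Within r (position φ t v) (position φ t u)
    far-within φ t {u} {v} N≤u v<N u≤v
      rewrite coordinate-far φ t N≤u | coordinate-cluster φ t v<N =
      within-line 0≤r near far , within-line 0≤r far near
      where
      x = fromℕ (farOffset φ t u) * δ
      y = fromℕ (clusterOffset φ v) * δ
      near : r + x - y ≤ r
      near = certificate (x≤y⇒0≤y-x (offset-mono u≤v))
        (solve 3 (λ r x y → r :- (r :+ x :- y) := y :- x) refl r x y)
      far : y - (r + x) ≤ r
      far = certificate (x≤y⇒0≤y-x (<⇒≤ (cluster<r φ v)) ⊕ 0≤r ⊕ 0≤offset (farOffset φ t u))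
        (solve 3 (λ r x y → r :- (y :- (r :+ x)) := r :- y :+ (r :+ x)) refl r x y)

    far-within⁻ : ∀ φ t {u v} → N ℕ.≤ toℕ u → toℕ v ℕ.< N →
                  Within r (position φ t u) (position φ t v) → farOffset φ t u ℕ.≤ clusterOffset φ v
    far-within⁻ φ t {u} {v} N≤u v<N w
      rewrite coordinate-far φ t N≤u | coordinate-cluster φ t v<N =
      offset-cancel {farOffset φ t u} {clusterOffset φ v} (certificate (x≤y⇒0≤y-x (within-line⁻ w))
        (solve 3 (λ r x y → y :- x := r :- (r :+ x :- y)) refl r _ _))

    within-d : ∀ i → Within d (position start 0 src) (position start 0 i)
    within-d i with toℕ src ℕ.<? N | toℕ i ℕ.<? N
    ... | no src≮N | _ = ⊥-elim (src≮N src<N)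
    ... | yes _ | yes _ = within-line 0≤d
      (≤-trans (offset-difference (toℕ i) (ℕ.≤-trans (ℕ.<⇒≤ (toℕ<n src)) n≤2n)) 2nδ≤d)
      (≤-trans (offset-difference (toℕ src) (ℕ.≤-trans (ℕ.<⇒≤ (toℕ<n i)) n≤2n)) 2nδ≤d)
      where
      2nδ≤d : fromℕ (2 ℕ.* n) * δ ≤ d
      2nδ≤d = ≤-trans (certificate 0≤r (solve 2 (λ r m → r :+ m :- m := r) refl r _)) r+2nδ≤d
    ... | yes _ | no  _ = within-line 0≤d
      (certificate (x≤y⇒0≤y-x (<⇒≤ (cluster<r start src)) ⊕ 0≤d ⊕ 0≤offset (farOffset start 0 i))
        (solve 4 (λ r x y d → d :- (x :- (r :+ y)) := r :- x :+ (d :+ y)) refl r _ _ d))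
      (≤-trans (certificate (x≤y⇒0≤y-x (offset-mono (farOffset≤2n start 0 i)) ⊕ 0≤offset (toℕ src))
        (solve 4 (λ r x y m → r :+ m :- (r :+ y :- x) := m :- y :+ x)
             refl r (fromℕ (toℕ src) * δ) _ _)) r+2nδ≤d)

    adversary : Adversary n Vmax
    adversary = record
      { pos          = λ h → position (phase h) (length h)
      ; active       = λ h i → ⌊ awake? (phase h) i ⌋
      ; source       = src
      -- With this choice the cluster's clocks agree with the slot numbers, and the targets are
      -- determined by the initial configuration, in which every node is awake.
      ; t₁           = 0
      ; distinct     = λ h i≢j (eq , _) → i≢j (coordinate-injective (phase h) (length h) eq)
      ; speed        = λ h b i → within-line
          (≤-trans (0≤offset (2 ℕ.* n)) 2nδ≤Vmax)
          (≤-trans (coordinate-moves (phase h) (length h) (phase (b ∷ h)) (length (b ∷ h)) i) 2nδ≤Vmax)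
          (≤-trans (coordinate-moves (phase (b ∷ h)) (length (b ∷ h)) (phase h) (length h) i) 2nδ≤Vmax)
      ; sourceActive = λ h _ → fromWitness {a? = awake? (phase h) src} (inj₁ src<N)
      }

    -- Coverage in each phase

    open Adversary adversary using (active)
    open Execution {n} {Vmax} r d Π adversary

    active⇒awake : ∀ h i → T (active h i) → Awake (phase h) i
    active⇒awake h i = toWitness {a? = awake? (phase h) i}

    awake⇒active : ∀ h i → Awake (phase h) i → T (active h i)
    awake⇒active h i = fromWitness {a? = awake? (phase h) i}

    cluster-active : ∀ h {i} → toℕ i ℕ.< N → T (active h i)
    cluster-active h {i} i<N = awake⇒active h i (inj₁ i<N)

    cluster-neighbors : ∀ h {i j} → i ≢ j → toℕ i ℕ.< N → toℕ j ℕ.< N → Neighbors h i j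
    cluster-neighbors h i≢j i<N j<N = i≢j , cluster-within (phase h) (length h) i<N j<N

    informed⇒covered : ∀ h i → Informed h i → Covered h i
    informed⇒covered []      i (_ , s)               = s
    informed⇒covered (b ∷ h) i (_ , inj₁ s)          = inj₁ s
    informed⇒covered (b ∷ h) i (_ , inj₂ (inj₁ inf)) = inj₂ (inj₁ (informed⇒covered h i inf))
    informed⇒covered (b ∷ h) i (_ , inj₂ (inj₂ rec)) = inj₂ (inj₂ rec)

    covered-new : ∀ h b i → Covered (b ∷ h) i → Covered h i ⊎ Receives h b i
    covered-new h b i (inj₁ (() , _))
    covered-new h b i (inj₂ c) = c

    informed-cluster : ∀ h b {i} → toℕ i ℕ.< N → Informed h i → Informed (b ∷ h) i
    informed-cluster h b i<N inf = cluster-active (b ∷ h) i<N , inj₂ (inj₁ inf)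

    -- Only informed nodes transmit in a pattern of positive probability.
    Possible : History n → Vec Bool n → Set
    Possible h b = ∀ i → T (lookup b i) → Informed h i

    Legal : History n → Set
    Legal []      = ⊤
    Legal (b ∷ h) = Possible h b × Legal h

    -- The far nodes are served in the order of their indices, so the covered nodes always form an
    -- initial segment.
    record Working (c : ℕ) (h : History n) : Set where
      field
        N≤c      : N ℕ.≤ c
        covered< : ∀ i → Covered h i → toℕ i ℕ.< c
        <covered : ∀ i → toℕ i ℕ.< c → Covered h i
        informed : ∀ i → toℕ i ℕ.< N → Informed h i

    Invariant : Phase n → History n → Set
    Invariant start         h = (∀ i → Covered h i → i ≡ src) × Informed h src
    Invariant (idle c g)    h = g ℕ.≤ a × Working c h
    Invariant (contact c p) h = toℕ p ℕ.< N × Working c h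

    InCluster : Vec Bool n → Set
    InCluster b = ∀ i → T (lookup b i) → toℕ i ℕ.< N

    far-deaf : ∀ h b u → InCluster b → N ℕ.≤ toℕ u → n ℕ.< farOffset (phase h) (length h) u →
               ¬ Receives h b u
    far-deaf h b u b⊆N N≤u n<u (_ , v , (_ , w) , bv , _) = ℕ.<⇒≱ n<u (ℕ.≤-trans
      (far-within⁻ (phase h) (length h) N≤u (b⊆N v bv) w) (clusterOffset≤n (phase h) v))

    informed⇒active : ∀ h i → Informed h i → T (active h i)
    informed⇒active []      i = proj₁
    informed⇒active (b ∷ h) i = proj₁

    -- An informed node is covered and hence below `c`. A far node below `c` is asleep and holds
    -- nothing.
    informed⇒cluster : ∀ {c} h → progress (phase h) ≡ c → Working c h →
                       ∀ i → Informed h i → toℕ i ℕ.< N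
    informed⇒cluster h ≡.refl W i inf with active⇒awake h i (informed⇒active h i inf)
    ... | inj₁ i<N = i<N
    ... | inj₂ c≤i = ⊥-elim (ℕ.<⇒≱ (Working.covered< W i (informed⇒covered h i inf)) c≤i)

    possible⇒cluster : ∀ {c} h b → progress (phase h) ≡ c → Working c h → Possible h b → InCluster b
    possible⇒cluster h b eq W poss i bi = informed⇒cluster h eq W i (poss i bi)

    farOffset-target : ∀ c p t {u} → toℕ u ≡ c → farOffset (contact c p) t u ≡ (if crowded t then 0 else n)
    farOffset-target c p t {u} u≡c with toℕ u ℕ.≟ c
    ... | yes _  = ≡.refl
    ... | no u≢c = ⊥-elim (u≢c u≡c)

    clusterOffset-partner : ∀ c p → clusterOffset (contact c p) p ≡ n
    clusterOffset-partner c p with p ≟ p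
    ... | yes _  = ≡.refl
    ... | no p≢p = ⊥-elim (p≢p ≡.refl)

    clusterOffset-partner⁻ : ∀ c p {v} → n ℕ.≤ clusterOffset (contact c p) v → v ≡ p
    clusterOffset-partner⁻ c p {v} n≤v with v ≟ p
    ... | yes v≡p = v≡p
    ... | no _    = ⊥-elim (ℕ.<⇒≱ (toℕ<n v) n≤v)

    target-neighbor : ∀ h {c p u} → phase h ≡ contact c p → toℕ u ≡ c → N ℕ.≤ toℕ u → toℕ p ℕ.< N →
                      Neighbors h u p × Neighbors h p u
    target-neighbor h {c} {p} {u} eq u≡c N≤u p<N
      with far-within (contact c p) (length h) N≤u p<N near
      where
      near : farOffset (contact c p) (length h) u ℕ.≤ clusterOffset (contact c p) p
      near rewrite farOffset-target c p (length h) u≡c | clusterOffset-partner c p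
        with crowded (length h)
      ... | true  = z≤n
      ... | false = ℕ.≤-refl
    ... | up , pu rewrite eq = (u≢p , up) , (u≢p ∘ ≡.sym) , pu
      where
      u≢p : u ≢ p
      u≢p ≡.refl = ℕ.<⇒≱ p<N N≤u

    -- `phase` is computed from the transmission patterns without reference to coverage. This lemma
    -- and its converse `target-receives⁻` show that it advances exactly when the far node in
    -- contact is covered.
    target-receives : ∀ h b {c p u} → phase h ≡ contact c p → toℕ u ≡ c → N ℕ.≤ toℕ u → toℕ p ℕ.< N →
                      InCluster b → T (success (length h) p b) → Receives h b u
    target-receives h b {c} {p} {u} eq u≡c N≤u p<N b⊆N ok
      with crowded (length h) in mode
    ... | false = awake⇒active h u awake , p , proj₁ (target-neighbor h eq u≡c N≤u p<N) , ok , unique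
      where
      awake : Awake (phase h) u
      awake rewrite eq = inj₂ (ℕ.≤-reflexive (≡.sym u≡c))
      unique : ∀ w → T (lookup b w) → w ≡ u ⊎ Neighbors h u w → w ≡ p
      unique w bw (inj₁ ≡.refl) = ⊥-elim (ℕ.<⇒≱ (b⊆N w bw) N≤u)
      unique w bw (inj₂ (_ , near)) rewrite eq = clusterOffset-partner⁻ c p
        (≡.subst (ℕ._≤ _) (≡.trans (farOffset-target c p (length h) u≡c) (≡.cong (if_then 0 else n) mode))
          (far-within⁻ (contact c p) (length h) N≤u (b⊆N w bw) near))
    ... | true with single⇒unique b ok
    ...   | v , bv , only = awake⇒active h u awake , v , neighbor , bv , λ w bw _ → only w bw
      where
      awake : Awake (phase h) u
      awake rewrite eq = inj₂ (ℕ.≤-reflexive (≡.sym u≡c))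
      neighbor : Neighbors h u v
      neighbor rewrite eq = (λ where ≡.refl → ℕ.<⇒≱ (b⊆N v bv) N≤u) ,
        proj₁ (far-within (contact c p) (length h) N≤u (b⊆N v bv)
          (ℕ.≤-trans (ℕ.≤-reflexive (≡.trans (farOffset-target c p (length h) u≡c)
            (≡.cong (if_then 0 else n) mode))) z≤n))

    target-receives⁻ : ∀ h b {c p u} → phase h ≡ contact c p → toℕ u ≡ c → N ℕ.≤ toℕ u →
                       InCluster b → Receives h b u → T (success (length h) p b)
    target-receives⁻ h b {c} {p} {u} eq u≡c N≤u b⊆N (_ , v , (_ , near) , bv , unique)
      with crowded (length h) in mode
    ... | false rewrite eq = ≡.subst (T ∘ lookup b) (clusterOffset-partner⁻ c p
        (≡.subst (ℕ._≤ _) (≡.trans (farOffset-target c p (length h) u≡c) (≡.cong (if_then 0 else n) mode))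
          (far-within⁻ (contact c p) (length h) N≤u (b⊆N v bv) near))) bv
    ... | true = unique⇒single b v bv λ w bw → unique w bw (inj₂ (neighbor w bw))
      where
      neighbor : ∀ w → T (lookup b w) → Neighbors h u w
      neighbor w bw rewrite eq = (λ where ≡.refl → ℕ.<⇒≱ (b⊆N w bw) N≤u) ,
        proj₁ (far-within (contact c p) (length h) N≤u (b⊆N w bw)
          (ℕ.≤-trans (ℕ.≤-reflexive (≡.trans (farOffset-target c p (length h) u≡c)
            (≡.cong (if_then 0 else n) mode))) z≤n))

    farOffset-waiting : ∀ c p t {u} → toℕ u ≢ c → n ℕ.< farOffset (contact c p) t u
    farOffset-waiting c p t {u} u≢c with toℕ u ℕ.≟ c
    ... | yes u≡c = ⊥-elim (u≢c u≡c)
    ... | no _    = s≤s (ℕ.m≤m+n n _)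

    preserve : ∀ φ h b → phase h ≡ φ → Invariant φ h → Possible h b →
               Invariant (next (length h) φ b) (b ∷ h)
    preserve start h b eq (only , inf) poss with lookup b src in bsrc
    ... | false = (λ i cov → [ only i , (λ where (_ , v , _ , bv , _) → ⊥-elim (silent v bv)) ]′
                    (covered-new h b i cov)) , informed-cluster h b src<N inf
      where
      silent : ∀ v → ¬ T (lookup b v)
      silent v bv with ≡.refl ← only v (informed⇒covered h v (poss v bv)) = ≡.subst T bsrc bv
    ... | true = ℕ.≤-refl , record
      { N≤c      = ℕ.≤-refl
      ; covered< = λ i cov → [ (λ c → ≡.subst (λ j → toℕ j ℕ.< N) (≡.sym (only i c)) src<N) , close i ]′
                     (covered-new h b i cov)
      ; <covered = λ i i<N → informed⇒covered (b ∷ h) i (reached i i<N)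
      ; informed = reached
      }
      where
      only-src : ∀ v → T (lookup b v) → v ≡ src
      only-src v bv = only v (informed⇒covered h v (poss v bv))
      close : ∀ i → Receives h b i → toℕ i ℕ.< N
      close i rec with ℕ.<-≤-connex (toℕ i) N
      ... | inj₁ i<N = i<N
      ... | inj₂ N≤i = ⊥-elim (far-deaf h b i
        (λ v bv → ≡.subst (λ j → toℕ j ℕ.< N) (≡.sym (only-src v bv)) src<N) N≤i n<off rec)
        where
        n<off : n ℕ.< farOffset (phase h) (length h) i
        n<off rewrite eq = s≤s (ℕ.m≤m+n n _)
      -- The source, as the only covered node, transmits without competition, and the cluster is a
      -- clique. One slot therefore informs all of it.
      reached : ∀ i → toℕ i ℕ.< N → Informed (b ∷ h) i
      reached i i<N with i ≟ src
      ... | yes ≡.refl = informed-cluster h b i<N inf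
      ... | no  i≢src  = cluster-active (b ∷ h) i<N , inj₂ (inj₂ (cluster-active h i<N , src ,
        cluster-neighbors h i≢src i<N src<N , ≡.subst T (≡.sym bsrc) tt , λ w bw _ → only-src w bw))
    preserve (idle c g) h b eq (g≤a , W) poss = waiting g g≤a
      where
      open Working W
      b⊆N = possible⇒cluster h b (≡.cong progress eq) W poss
      W′ : Working c (b ∷ h)
      W′ = record
        { N≤c      = N≤c
        ; covered< = λ i cov → [ covered< i , close i ]′ (covered-new h b i cov)
        ; <covered = λ i i<c → inj₂ (inj₁ (<covered i i<c))
        ; informed = λ i i<N → informed-cluster h b i<N (informed i i<N)
        }
        where
        close : ∀ i → Receives h b i → toℕ i ℕ.< c
        close i rec with ℕ.<-≤-connex (toℕ i) N
        ... | inj₁ i<N = ℕ.<-≤-trans i<N N≤c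
        ... | inj₂ N≤i = ⊥-elim (far-deaf h b i b⊆N N≤i n<off rec)
          where
          n<off : n ℕ.< farOffset (phase h) (length h) i
          n<off rewrite eq = s≤s (ℕ.m≤m+n n _)
      waiting : ∀ g → g ℕ.≤ a → Invariant (next (length h) (idle c g) b) (b ∷ h)
      waiting zero    _   = partner<N _ , W′
      waiting (suc g) g<a = ℕ.<⇒≤ g<a , W′
    preserve (contact c p) h b eq (p<N , W) poss with success (length h) p b in ok
    ... | true = ℕ.≤-refl , record
      { N≤c      = ℕ.m≤n⇒m≤1+n N≤c
      ; covered< = λ i cov → [ ℕ.m<n⇒m<1+n ∘ covered< i , close i ]′ (covered-new h b i cov)
      ; <covered = λ i i<1+c → [ (λ i<c → inj₂ (inj₁ (<covered i i<c))) ,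
                     (λ i≡c → inj₂ (inj₂ (target-receives h b eq i≡c
                       (ℕ.≤-trans N≤c (ℕ.≤-reflexive (≡.sym i≡c))) p<N b⊆N (≡.subst T (≡.sym ok) tt)))) ]′
                     (ℕ.m<1+n⇒m<n∨m≡n i<1+c)
      ; informed = λ i i<N → informed-cluster h b i<N (informed i i<N)
      }
      where
      open Working W
      b⊆N = possible⇒cluster h b (≡.cong progress eq) W poss
      close : ∀ i → Receives h b i → toℕ i ℕ.< suc c
      close i rec with ℕ.<-≤-connex (toℕ i) N | toℕ i ℕ.≟ c
      ... | inj₁ i<N | _       = ℕ.m<n⇒m<1+n (ℕ.<-≤-trans i<N N≤c)
      ... | inj₂ _   | yes i≡c = s≤s (ℕ.≤-reflexive i≡c)
      ... | inj₂ N≤i | no i≢c  = ⊥-elim (far-deaf h b i b⊆N N≤i n<off rec)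
        where
        n<off : n ℕ.< farOffset (phase h) (length h) i
        n<off rewrite eq = farOffset-waiting c p (length h) i≢c
    ... | false = p<N , record
      { N≤c      = N≤c
      ; covered< = λ i cov → [ covered< i , close i ]′ (covered-new h b i cov)
      ; <covered = λ i i<c → inj₂ (inj₁ (<covered i i<c))
      ; informed = λ i i<N → informed-cluster h b i<N (informed i i<N)
      }
      where
      open Working W
      b⊆N = possible⇒cluster h b (≡.cong progress eq) W poss
      close : ∀ i → Receives h b i → toℕ i ℕ.< c
      close i rec with ℕ.<-≤-connex (toℕ i) N | toℕ i ℕ.≟ c
      ... | inj₁ i<N | _       = ℕ.<-≤-trans i<N N≤c
      ... | inj₂ N≤i | yes i≡c = ⊥-elim (≡.subst T ok (target-receives⁻ h b eq i≡c N≤i b⊆N rec))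
      ... | inj₂ N≤i | no i≢c  = ⊥-elim (far-deaf h b i b⊆N N≤i n<off rec)
        where
        n<off : n ℕ.< farOffset (phase h) (length h) i
        n<off rewrite eq = farOffset-waiting c p (length h) i≢c

    invariant : ∀ h → Legal h → Invariant (phase h) h
    invariant []      _            = (λ i → proj₂) , cluster-active [] src<N , ≡.refl , ≡.refl
    invariant (b ∷ h) (poss , leg) = preserve (phase h) h b ≡.refl (invariant h leg) poss

    invariant-at : ∀ {h φ} → Legal h → phase h ≡ φ → Invariant φ h
    invariant-at {h} leg eq = ≡.subst (λ φ → Invariant φ h) eq (invariant h leg)

    drop-length : ∀ (h : History n) → drop (length h) h ≡ []
    drop-length []      = ≡.refl
    drop-length (b ∷ h) = drop-length h

    -- As `t₁` is 0, the target set is read off the empty history. At that time all nodes are awake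
    -- and within `d` of the source, so every node is a target.
    solved⇒covered : ∀ h → Solved h → ∀ i → Covered h i
    solved⇒covered h solved i = solved i target
      where
      target : Target (upTo-t₁ h) i
      target rewrite drop-length h =
        awake⇒active [] i ([ inj₁ , inj₂ ]′ (ℕ.<-≤-connex (toℕ i) N)) , within-d i

    unsolved-start : ∀ {h} → Legal h → phase h ≡ start → ¬ Solved h
    unsolved-start {h} leg eq solved =
      src≢mate (≡.sym (proj₁ (invariant-at leg eq) mate (solved⇒covered h solved mate)))

    unsolved : ∀ {c h} → Working c h → c ℕ.< n → ¬ Solved h
    unsolved {c} {h} W c<n solved = ℕ.<-irrefl (toℕ-fromℕ< c<n)
      (Working.covered< W (fromℕ< c<n) (solved⇒covered h solved (fromℕ< c<n)))

    unsolved⁻ : ∀ {c h} → Working c h → ¬ Solved h → c ℕ.< n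
    unsolved⁻ {c} {h} W ¬solved = ℕ.≰⇒> λ n≤c → ¬solved λ i _ →
      Working.<covered W i (ℕ.<-≤-trans (toℕ<n i) n≤c)

    -- Connectivity along executions

    module _ (ω : ℕ → Vec Bool n) (exec : IsExecution ω) where

      possible : ∀ t → Possible (prefix ω t) (ω t)
      possible t i ωti with exec t i
      ... | pr with lookup (ω t) i
      ...   | true with informed? (prefix ω t) i
      ...     | yes inf = inf
      ...     | no  _   = ⊥-elim (<⇒≱ pr ≤-refl)

      legal : ∀ t → Legal (prefix ω t)
      legal zero    = tt
      legal (suc t) = possible t , legal t

      ContactPair : ℕ → ℕ → Set
      ContactPair t β = ∃[ p ] ∃[ p′ ]
        Informed (prefix ω t) p × ¬ Covered (prefix ω t) p′ ×
        (∀ x → t ℕ.≤ x → x ℕ.< t ℕ.+ β → ¬ Covered (prefix ω x) p′ →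
          T (active (prefix ω x) p) × T (active (prefix ω x) p′) ×
          Neighbors (prefix ω x) p p′)

      -- The contact ends only by a success, and a success covers `u`.
      phase-stays : ∀ {c p u} t y → phase (prefix ω t) ≡ contact c p → toℕ u ≡ c →
                    ¬ Covered (prefix ω (y ℕ.+ t)) u → phase (prefix ω (y ℕ.+ t)) ≡ contact c p
      phase-stays t zero    eq u≡c ¬cov = eq
      phase-stays {c} {p} {u} t (suc y) eq u≡c ¬cov = step (phase-stays t y eq u≡c (¬cov ∘ inj₂ ∘ inj₁))
        where
        h = prefix ω (y ℕ.+ t)
        b = ω (y ℕ.+ t)
        step : phase h ≡ contact c p → next (length h) (phase h) b ≡ contact c p
        step eq′ with invariant-at (legal (y ℕ.+ t)) eq′ | success (length h) p b in ok
        ... | _       | false = ≡.trans (≡.cong (λ φ → next (length h) φ b) eq′)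
                                  (≡.cong (if_then idle (suc c) a else contact c p) ok)
        ... | p<N , W | true  = ⊥-elim (¬cov (inj₂ (inj₂ (target-receives h b eq′ u≡c
          (ℕ.≤-trans (Working.N≤c W) (ℕ.≤-reflexive (≡.sym u≡c))) p<N
          (possible⇒cluster h b (≡.cong progress eq′) W (possible (y ℕ.+ t))) (≡.subst T (≡.sym ok) tt)))))

      contact-pair : ∀ {c p} t β → phase (prefix ω t) ≡ contact c p → c ℕ.< n → ContactPair t β
      contact-pair {c} {p} t β eq c<n with invariant-at (legal t) eq
      ... | p<N , W = p , u , informed p p<N , ¬covered , λ x t≤x _ ¬cov → kept x t≤x ¬cov
        where
        open Working W
        u = fromℕ< c<n
        u≡c = toℕ-fromℕ< c<n
        N≤u = ℕ.≤-trans N≤c (ℕ.≤-reflexive (≡.sym u≡c))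
        ¬covered : ¬ Covered (prefix ω t) u
        ¬covered cov = ℕ.<-irrefl u≡c (covered< u cov)
        kept : ∀ x → t ℕ.≤ x → ¬ Covered (prefix ω x) u →
               T (active (prefix ω x) p) × T (active (prefix ω x) u) × Neighbors (prefix ω x) p u
        kept x t≤x ¬cov = cluster-active (prefix ω x) p<N , awake⇒active (prefix ω x) u awake ,
          proj₂ (target-neighbor (prefix ω x) eqₓ u≡c N≤u p<N)
          where
          eqₓ : phase (prefix ω x) ≡ contact c p
          eqₓ = ≡.subst (λ z → phase (prefix ω z) ≡ contact c p) (ℕ.m∸n+n≡m t≤x)
            (phase-stays t (x ∸ t) eq u≡c (≡.subst (λ z → ¬ Covered (prefix ω z) u)
              (≡.sym (ℕ.m∸n+n≡m t≤x)) ¬cov))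
          awake : Awake (phase (prefix ω x)) u
          awake rewrite eqₓ = inj₂ (ℕ.≤-reflexive (≡.sym u≡c))

      idle-ends : ∀ {c} g t → phase (prefix ω t) ≡ idle c g →
                  ∃[ p ] phase (prefix ω (suc g ℕ.+ t)) ≡ contact c p
      idle-ends zero t eq rewrite eq = _ , ≡.refl
      idle-ends {c} (suc g) t eq with idle-ends {c} g (suc t) eq′
        where
        eq′ : phase (prefix ω (suc t)) ≡ idle c g
        eq′ rewrite eq = ≡.refl
      ... | p , eqₚ = p , ≡.subst (λ z → phase (prefix ω z) ≡ contact c p) (ℕ.+-suc (suc g) t) eqₚ

    -- Before the source is heard, `src` and `mate` are the required pair. In an idle phase no far
    -- node is in range of the cluster, but the next contact begins after `suc g ≤ suc a` slots,
    -- just within the permitted delay. A contact lasts until its far node is covered, which serves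
    -- every `β`.
    connected : ∀ β → 0 ℕ.< β → IsConnected (suc a) β
    connected β 0<β ω exec t _ ¬solved = go (phase (prefix ω t)) ≡.refl
      where
      inside : ∀ t → t ℕ.< t ℕ.+ β
      inside t = ℕ.m<m+n t 0<β
      leg = legal ω exec t
      Connection : Set
      Connection = ∃[ t′ ]
        (∃[ x ] (t ℕ.≤ x × x ℕ.≤ t ℕ.+ suc a) × (t′ ℕ.≤ x × x ℕ.< t′ ℕ.+ β)) ×
        ContactPair ω exec t′ β
      go : ∀ φ → phase (prefix ω t) ≡ φ → Connection
      go start eq with invariant-at leg eq
      ... | only , inf = t , (t , (ℕ.≤-refl , ℕ.m≤m+n t _) , ℕ.≤-refl , inside t) ,
        src , mate , inf , (λ cov → src≢mate (≡.sym (only mate cov))) , λ x _ _ _ →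
          cluster-active (prefix ω x) src<N , cluster-active (prefix ω x) mate<N ,
          cluster-neighbors (prefix ω x) src≢mate src<N mate<N
      go (idle c g) eq with invariant-at leg eq | idle-ends ω exec g t eq
      ... | g≤a , W | p , eqₚ = suc g ℕ.+ t , (suc g ℕ.+ t , (ℕ.m≤n+m t (suc g) ,
        ℕ.≤-trans (ℕ.≤-reflexive (ℕ.+-comm (suc g) t)) (ℕ.+-monoʳ-≤ t (s≤s g≤a))) ,
        ℕ.≤-refl , inside (suc g ℕ.+ t)) , contact-pair ω exec (suc g ℕ.+ t) β eqₚ (unsolved⁻ W ¬solved)
      go (contact c p) eq = t , (t , (ℕ.≤-refl , ℕ.m≤m+n t _) , ℕ.≤-refl , inside t) ,
        contact-pair ω exec t β eq (unsolved⁻ (proj₂ (invariant-at leg eq)) ¬solved)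

    -- The probability of being solved in time

    open ObliviousProtocol Π using (prob; prob≥0; prob≤1)
    open Rates N crowded Π

    transmitProb-isProbability : ∀ h → IsProbability (transmitProb h)
    transmitProb-isProbability h i with informed? h i
    ... | yes _ = prob≥0 i (clock h i) , prob≤1 i (clock h i)
    ... | no  _ = ≤-refl , 0≤1

    transmitProb-support : ∀ h i → Informed h i ⊎ transmitProb h i ≈ 0#
    transmitProb-support h i with informed? h i
    ... | yes inf = inj₁ inf
    ... | no  _   = inj₂ refl

    clock-cluster : ∀ h {i} → toℕ i ℕ.< N → clock h i ≡ length h
    clock-cluster []      i<N = ≡.refl
    clock-cluster (b ∷ h) {i} i<N with active h i | cluster-active h i<N
    ... | true | _ = ≡.cong suc (clock-cluster h i<N)

    -- Here obliviousness takes effect: cluster nodes are never deactivated, so their local step is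
    -- the slot number, and exactly they are informed. The probabilities do not depend on the rest
    -- of the history.
    transmitProb-cluster : ∀ {c} h → progress (phase h) ≡ c → Working c h →
                           ∀ i → transmitProb h i ≈ clusterProb (length h) i
    transmitProb-cluster h eq W i with informed? h i | toℕ i ℕ.<? N
    ... | yes inf | yes i<N = reflexive (≡.cong (prob i) (clock-cluster h i<N))
    ... | yes inf | no  i≮N = ⊥-elim (i≮N (informed⇒cluster h eq W i inf))
    ... | no ¬inf | yes i<N = ⊥-elim (¬inf (Working.informed W i i<N))
    ... | no _    | no  _   = refl

    expect-success : ∀ {c p} h → progress (phase h) ≡ c → Working c h →
                     expect (transmitProb h) (indicator ∘ success (length h) p) ≈ hazard (length h) p
    expect-success {c} {p} h eq W = trans (expect-cong _ (transmitProb-cluster h eq W)) cases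
      where
      cases : expect (clusterProb (length h)) (indicator ∘ success (length h) p) ≈ hazard (length h) p
      cases with crowded (length h)
      ... | true  = refl
      ... | false = expect-lookup (clusterProb (length h)) p

    probSolvedAfter≤1 : ∀ k h → probSolvedAfter k h ≤ 1#
    probSolvedAfter≤1 zero h with solved? h
    ... | yes _ = ≤-refl
    ... | no  _ = 0≤1
    probSolvedAfter≤1 (suc k) h =
      expect≤ (transmitProb-isProbability h) (λ b → probSolvedAfter≤1 k (b ∷ h))

    probSolvedAfter-zero : ∀ {h X} → ¬ Solved h → 0# ≤ X → probSolvedAfter 0 h ≤ X
    probSolvedAfter-zero {h} ¬solved 0≤X with solved? h
    ... | yes solved = ⊥-elim (¬solved solved)
    ... | no  _      = 0≤X

    probSolvedAfter-suc : ∀ k {h X} → (∀ b → Possible h b → probSolvedAfter k (b ∷ h) ≤ X) →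
                          probSolvedAfter (suc k) h ≤ X
    probSolvedAfter-suc k {h} {X} bound = begin
      expect (transmitProb h) (λ b → probSolvedAfter k (b ∷ h))
        ≤⟨ expect-mono-on (Informed h) (transmitProb-isProbability h) (transmitProb-support h) bound ⟩
      expect (transmitProb h) (λ _ → X)
        ≈⟨ expect-const (transmitProb h) X ⟩
      X ∎

    module Potential (τ : ℕ)
      (partner-bound : ∀ t → fromℕ 16 * hazardSum τ t (partner t) ≤ fromℕ 3) where

      contact-slack : ∀ t m L →
        (hazardSum τ t (partner t) + sixteenth) * potential m L ≤ potential (suc m) L
      contact-slack t m L = begin
        (H + sixteenth) * potential m L
          ≤⟨ *-monoʳ-≤ (0≤potential m L) H+1/16≤1/4 ⟩
        quarter * potential m L
          ≈⟨ *-assoc _ _ _ ⟨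
        potential (suc m) L ∎
        where
        H = hazardSum τ t (partner t)
        H+1/16≤1/4 : H + sixteenth ≤ quarter
        H+1/16≤1/4 = *-cancelˡ-≤ 0<16 (begin
          fromℕ 16 * (H + sixteenth)
            ≈⟨ solve 3 (λ f H s → f :* (H :+ s) := f :* H :+ f :* s)
                 refl (fromℕ 16) H sixteenth ⟩
          fromℕ 16 * H + fromℕ 16 * sixteenth
            ≤⟨ +-mono-≤ (partner-bound t) (≤-reflexive (*-inverse 0<16)) ⟩
          fromℕ 3 + 1#                          ≈⟨ solve 0 (# 3 :+ # 1 := # 4 :* # 1) refl ⟩
          fromℕ 4 * 1#                          ≈⟨ *-congˡ (*-inverse 0<4) ⟨
          fromℕ 4 * (fromℕ 4 * quarter)
            ≈⟨ solve 1 (λ q → # 4 :* (# 4 :* q) := # 16 :* q) refl quarter ⟩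
          fromℕ 16 * quarter                    ∎)

      arrive-bound : ∀ k h {c} m L → Legal h → phase h ≡ idle c a → c ℕ.+ m ≡ n →
                     k ℕ.< suc a ℕ.* m ℕ.+ suc τ ℕ.* L → probSolvedAfter k h ≤ potential m L
      idle-bound : ∀ k h {c} g m L → Legal h → phase h ≡ idle c g → c ℕ.+ suc m ≡ n →
                   k ℕ.< suc g ℕ.+ suc a ℕ.* m ℕ.+ suc τ ℕ.* L →
                   probSolvedAfter k h ≤ potential (suc m) L
      -- The contact has lasted `τ - w` slots, and a success in one of the next `w` slots is still
      -- short; `τ` stands on the left of the time condition to avoid this subtraction. The hazards
      -- bound the probability of a short end, and `sixteenth` accounts for a long one.
      contact-bound : ∀ k h {c p} w m L → Legal h → phase h ≡ contact c p → c ℕ.+ suc m ≡ n →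
                      w ℕ.≤ τ → k ℕ.+ τ ℕ.< suc a ℕ.* m ℕ.+ suc τ ℕ.* L ℕ.+ w →
                      probSolvedAfter k h ≤ (hazardSum w (length h) p + sixteenth) * potential m L

      arrive-bound k h zero zero leg eq c+m≡n k<
        rewrite ℕ.*-zeroʳ a | ℕ.*-zeroʳ τ with () ← k<
      arrive-bound k h zero (suc L) leg eq c+m≡n k< = begin
        probSolvedAfter k h       ≤⟨ probSolvedAfter≤1 k h ⟩
        1#                        ≤⟨ 1≤16^ L ⟩
        fromℕ 16 ^ L              ≈⟨ *-identityˡ _ ⟨
        1# * fromℕ 16 ^ L         ∎
        where
        1≤16^ : ∀ L → 1# ≤ fromℕ 16 ^ L
        1≤16^ zero    = ≤-refl
        1≤16^ (suc L) = begin
          1#                      ≈⟨ *-identityˡ 1# ⟨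
          1# * 1#
            ≤⟨ *-mono-≤ (0≤fromℕ 16) 0≤1 (≤-trans (≤-reflexive (sym (+-identityʳ 1#))) (fromℕ-mono-≤ {1} {16} (s≤s z≤n))) (1≤16^ L) ⟩
          fromℕ 16 * fromℕ 16 ^ L ∎
      arrive-bound k h (suc m) L leg eq c+m≡n k< = idle-bound k h a m L leg eq c+m≡n
        (≡.subst (λ z → k ℕ.< z ℕ.+ suc τ ℕ.* L) (ℕ.*-suc (suc a) m) k<)

      working< : ∀ {c m} → c ℕ.+ suc m ≡ n → c ℕ.< n
      working< {c} {m} c+m≡n = ℕ.≤-trans (ℕ.m<m+n c (s≤s z≤n)) (ℕ.≤-reflexive c+m≡n)

      idle-bound zero h g m L leg eq c+m≡n k< = probSolvedAfter-zero
        (unsolved (proj₂ (invariant-at leg eq)) (working< c+m≡n)) (0≤potential (suc m) L)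
      idle-bound (suc k) h (suc g) m L leg eq c+m≡n k< = probSolvedAfter-suc k λ b poss →
        idle-bound k (b ∷ h) g m L (poss , leg) (≡.cong (λ φ → next (length h) φ b) eq) c+m≡n (ℕ.≤-pred k<)
      idle-bound (suc k) h zero m L leg eq c+m≡n k< = probSolvedAfter-suc k λ b poss → ≤-trans
        (contact-bound k (b ∷ h) τ m L (poss , leg) (≡.cong (λ φ → next (length h) φ b) eq) c+m≡n
          ℕ.≤-refl (ℕ.+-monoˡ-< τ (ℕ.≤-pred k<)))
        (contact-slack (suc (length h)) m L)

      contact-bound zero h w m L leg eq c+m≡n w≤τ k< = probSolvedAfter-zero
        (unsolved (proj₂ (invariant-at leg eq)) (working< c+m≡n))
        ((0≤hazardSum w (length h) _ ⊕ 0≤sixteenth) ⊗ 0≤potential m L)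
      contact-bound (suc k) h {c} {p} w m L leg eq c+m≡n w≤τ k< = split w w≤τ k<
        where
        next-phase : ∀ b → phase (b ∷ h) ≡ (if success (length h) p b then idle (suc c) a else contact c p)
        next-phase b = ≡.cong (λ φ → next (length h) φ b) eq
        suc-c+m≡n : suc c ℕ.+ m ≡ n
        suc-c+m≡n = ≡.trans (≡.sym (ℕ.+-suc c m)) c+m≡n
        split : ∀ w → w ℕ.≤ τ → suc k ℕ.+ τ ℕ.< suc a ℕ.* m ℕ.+ suc τ ℕ.* L ℕ.+ w →
                probSolvedAfter (suc k) h ≤ (hazardSum w (length h) p + sixteenth) * potential m L
        split zero _ k< = begin
          probSolvedAfter (suc k) h              ≤⟨ probSolvedAfter-suc k slot ⟩
          sixteenth * potential m L              ≈⟨ *-congʳ (+-identityˡ sixteenth) ⟨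
          (0# + sixteenth) * potential m L       ∎
          where
          k<₀ : suc k ℕ.+ τ ℕ.< suc a ℕ.* m ℕ.+ suc τ ℕ.* L
          k<₀ = ≡.subst (suc k ℕ.+ τ ℕ.<_) (ℕ.+-identityʳ _) k<
          k<₁ : ∀ L → suc k ℕ.+ τ ℕ.< suc a ℕ.* m ℕ.+ suc τ ℕ.* L →
                k ℕ.< suc a ℕ.* m ℕ.+ suc τ ℕ.* ℕ.pred L
          k<₁ zero    lt = ℕ.≤-<-trans (ℕ.≤-trans (ℕ.n≤1+n k) (ℕ.m≤m+n (suc k) τ)) lt
          -- The `τ` slots that the contact has already lasted and the current slot make up the
          -- `suc τ` slots charged to a long contact.
          k<₁ (suc L) lt = ℕ.+-cancelʳ-< (suc τ) _ _ (≡.subst₂ ℕ._<_ (≡.sym (ℕ.+-suc k τ))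
            (≡.trans (≡.cong (suc a ℕ.* m ℕ.+_) (≡.trans (ℕ.*-suc (suc τ) L) (ℕ.+-comm (suc τ) _)))
              (≡.sym (ℕ.+-assoc (suc a ℕ.* m) _ _))) lt)
          slot : ∀ b → Possible h b → probSolvedAfter k (b ∷ h) ≤ sixteenth * potential m L
          slot b poss with success (length h) p b | next-phase b
          ... | true | eq′ = begin
            probSolvedAfter k (b ∷ h)
              ≤⟨ arrive-bound k (b ∷ h) m (ℕ.pred L) (poss , leg)
                                                            eq′ suc-c+m≡n (k<₁ L k<₀) ⟩
            quarter ^ m * weight (ℕ.pred L)
              ≤⟨ *-monoˡ-≤ (0≤^ m 0≤quarter) (weight-pred L) ⟩
            quarter ^ m * (sixteenth * weight L)
              ≈⟨ solve 3 (λ q s w → q :* (s :* w) := s :* (q :* w))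
                   refl (quarter ^ m) sixteenth (weight L) ⟩
            sixteenth * potential m L                  ∎
          ... | false | eq′ = begin
            probSolvedAfter k (b ∷ h)
              ≤⟨ contact-bound k (b ∷ h) zero m L (poss , leg)
                                                            eq′ c+m≡n z≤n (ℕ.<-trans (ℕ.n<1+n _) k<) ⟩
            (0# + sixteenth) * potential m L           ≈⟨ *-congʳ (+-identityˡ sixteenth) ⟩
            sixteenth * potential m L                  ∎
        split (suc w) w<τ k< = begin
          expect (transmitProb h) (λ b → probSolvedAfter k (b ∷ h))
            ≤⟨ expect-mono-on (Informed h) (transmitProb-isProbability h) (transmitProb-support h) slot ⟩
          expect (transmitProb h) (λ b → indicator (success (length h) p b) * A + C)
            ≈⟨ expect-affine (transmitProb h) (indicator ∘ success (length h) p) A C ⟩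
          expect (transmitProb h) (indicator ∘ success (length h) p) * A + C
            ≈⟨ +-congʳ (*-congʳ (expect-success h (≡.cong progress eq) (proj₂ (invariant-at leg eq)))) ⟩
          hazard (length h) p * A + C
            ≈⟨ solve 4 (λ x A H s → x :* A :+ (H :+ s) :* A := (x :+ H :+ s) :* A) refl
                 (hazard (length h) p) A (hazardSum w (suc (length h)) p) sixteenth ⟩
          (hazardSum (suc w) (length h) p + sixteenth) * A ∎
          where
          A = potential m L
          C = (hazardSum w (suc (length h)) p + sixteenth) * A
          k<₁ : k ℕ.< suc a ℕ.* m ℕ.+ suc τ ℕ.* L
          k<₁ = ℕ.<-trans (ℕ.n<1+n k) (ℕ.+-cancelʳ-< τ _ _ (ℕ.<-≤-trans k< (ℕ.+-monoʳ-≤ _ w<τ)))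
          k<₂ : k ℕ.+ τ ℕ.< suc a ℕ.* m ℕ.+ suc τ ℕ.* L ℕ.+ w
          k<₂ = ℕ.≤-pred (≡.subst (suc k ℕ.+ τ ℕ.<_) (ℕ.+-suc _ w) k<)
          -- `C`, the bound after a failure, is added after a success as well. This union bound
          -- keeps the estimate linear in the hazards.
          slot : ∀ b → Possible h b →
                 probSolvedAfter k (b ∷ h) ≤ indicator (success (length h) p b) * A + C
          slot b poss with success (length h) p b | next-phase b
          ... | true  | eq′ = ≤-trans
            (arrive-bound k (b ∷ h) m L (poss , leg) eq′ suc-c+m≡n k<₁)
            (certificate ((0≤hazardSum w (suc (length h)) p ⊕ 0≤sixteenth) ⊗ 0≤potential m L)
              (solve 2 (λ A C → # 1 :* A :+ C :- A := C) refl A C))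
          ... | false | eq′ = ≤-trans
            (contact-bound k (b ∷ h) w m L (poss , leg) eq′ c+m≡n (ℕ.<⇒≤ w<τ) k<₂)
            (≤-reflexive (solve 2 (λ A C → C := # 0 :* A :+ C) refl A C))

      -- Waiting for the source only uses up time: no far node is served meanwhile, so the bound
      -- carries over with fewer slots left.
      start-bound : ∀ k h m L → Legal h → phase h ≡ start → N ℕ.+ m ≡ n →
                    k ℕ.< suc a ℕ.* m ℕ.+ suc τ ℕ.* L → probSolvedAfter k h ≤ potential m L
      start-bound zero h m L leg eq N+m≡n k< =
        probSolvedAfter-zero (unsolved-start leg eq) (0≤potential m L)
      start-bound (suc k) h m L leg eq N+m≡n k< = probSolvedAfter-suc k slot
        where
        k<′ = ℕ.<-trans (ℕ.n<1+n k) k<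
        slot : ∀ b → Possible h b → probSolvedAfter k (b ∷ h) ≤ potential m L
        next-phase : ∀ b → phase (b ∷ h) ≡ (if lookup b src then idle N a else start)
        next-phase b = ≡.cong (λ φ → next (length h) φ b) eq
        slot b poss with lookup b src | next-phase b
        ... | true  | eq′ = arrive-bound k (b ∷ h) m L (poss , leg) eq′ N+m≡n k<′
        ... | false | eq′ = start-bound k (b ∷ h) m L (poss , leg) eq′ N+m≡n k<′

      probSolvedWithin-bound : ∀ k m L → N ℕ.+ m ≡ n → k ℕ.< suc a ℕ.* m ℕ.+ suc τ ℕ.* L →
                               probSolvedWithin k ≤ potential m L
      probSolvedWithin-bound k m L = start-bound k [] m L tt ≡.refl

      slow-adversary : ∀ β → 0 ℕ.< β → SlowAdversary Vmax r d Π (suc a) β N τ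
      slow-adversary β 0<β = adversary , connected β 0<β , probSolvedWithin-bound

last-step : ∀ {P : ℕ → Set} → (∀ k → Dec (P k)) → P 0 → ∀ M → ¬ P M → ∃[ k ] P k × ¬ P (suc k)
last-step P? P₀ zero    ¬P = ⊥-elim (¬P P₀)
last-step P? P₀ (suc M) ¬P with P? M
... | yes Pₘ = M , Pₘ , ¬P
... | no ¬Pₘ = last-step P? P₀ M ¬Pₘ

-- Choosing partners by averaging over the cluster

module Averaging (R : CompleteOrderedField) where

  open OrderedField R
  open Geocast R
  open Expectation R
  open ExponentialSeries R using (sum-+-*)
  open Network R using (module Rates)
  open ≤-Reasoning

  sum-mono-< : ∀ {n} {f g : Fin n → ℝ} → (∀ i → f i ≤ g i) → ∀ i → f i < g i → sum f < sum g
  sum-mono-< {f = f} {g} f≤g zero f₀<g₀ = ≰⇒> λ Σg≤Σf → <⇒≱ f₀<g₀ (certificate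
    (x≤y⇒0≤y-x Σg≤Σf ⊕ x≤y⇒0≤y-x (sum-mono-≤ (f≤g ∘ suc)))
    (solve 4 (λ a b u v → a :- b := a :+ u :- (b :+ v) :+ (v :- u)) refl
      (f zero) (g zero) (sum (f ∘ suc)) (sum (g ∘ suc))))
  sum-mono-< {f = f} {g} f≤g (suc i) fᵢ<gᵢ = ≰⇒> λ Σg≤Σf → <⇒≱ (sum-mono-< (f≤g ∘ suc) i fᵢ<gᵢ) (certificate
    (x≤y⇒0≤y-x Σg≤Σf ⊕ x≤y⇒0≤y-x (f≤g zero))
    (solve 4 (λ a b u v → u :- v := a :+ u :- (b :+ v) :+ (b :- a)) refl
      (f zero) (g zero) (sum (f ∘ suc)) (sum (g ∘ suc))))

  restrict : ∀ {n} → ℕ → (Fin n → ℝ) → Fin n → ℝ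
  restrict N x i = if ⌊ toℕ i ℕ.<? N ⌋ then x i else 0#

  restrict-yes : ∀ {n N} (x : Fin n → ℝ) {i} → toℕ i ℕ.< N → restrict N x i ≡ x i
  restrict-yes {N = N} x {i} i<N with toℕ i ℕ.<? N
  ... | yes _  = ≡.refl
  ... | no i≮N = ⊥-elim (i≮N i<N)

  sum-restrict-const : ∀ {n N} c → N ℕ.≤ n → sum (restrict {n} N (λ _ → c)) ≈ fromℕ N * c
  sum-restrict-const {n} {N} c N≤n = trans
    -- The test is replaced by the Boolean comparison, which reduces when both arguments are
    -- successors, as the induction in `count` requires.
    (sum-cong-≋ {n} λ i → reflexive (≡.cong (if_then c else 0#) (isYes≗does (toℕ i ℕ.<? N))))
    (count n N N≤n)
    where
    count : ∀ n N → N ℕ.≤ n → sum (λ (i : Fin n) → if toℕ i ℕ.<ᵇ N then c else 0#) ≈ fromℕ N * c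
    count zero    zero    z≤n = sym (zeroˡ c)
    count (suc n) zero    z≤n = trans (+-congˡ (count n zero z≤n))
      (solve 1 (λ c → # 0 :+ # 0 :* c := # 0 :* c) refl c)
    count (suc n) (suc N) (s≤s N≤n) = trans (+-congˡ (count n N N≤n))
      (solve 2 (λ N c → c :+ N :* c := (# 1 :+ N) :* c) refl (fromℕ N) c)

  below-average : ∀ {n N} (x : Fin n → ℝ) c → N ℕ.≤ n → (i : Fin n) → toℕ i ℕ.< N →
                  sum (restrict N x) ≤ fromℕ N * c → ∃[ p ] toℕ p ℕ.< N × x p ≤ c
  below-average {n} {N} x c N≤n i i<N Σx≤Nc with any? (λ p → (toℕ p ℕ.<? N) ×-dec (x p ≤? c))
  ... | yes found = found
  ... | no  none  = ⊥-elim (<⇒≱ (sum-mono-< c≤x i cᵢ<xᵢ)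
    (≤-trans Σx≤Nc (≤-reflexive (sym (sum-restrict-const c N≤n)))))
    where
    c<x : ∀ p → toℕ p ℕ.< N → c < x p
    c<x p p<N = ≰⇒> λ xₚ≤c → none (p , p<N , xₚ≤c)
    c≤x : ∀ p → restrict N (λ _ → c) p ≤ restrict N x p
    c≤x p with toℕ p ℕ.<? N
    ... | yes p<N = <⇒≤ (c<x p p<N)
    ... | no  _   = ≤-refl
    cᵢ<xᵢ : restrict N (λ _ → c) i < restrict N x i
    cᵢ<xᵢ rewrite restrict-yes (λ _ → c) i<N | restrict-yes x i<N = c<x i i<N

  module Partners {n : ℕ} {N : ℕ} (N≤n : N ℕ.≤ n) (i₀ : Fin n) (i₀<N : toℕ i₀ ℕ.< N) (τ : ℕ)
    (Π : ObliviousProtocol n) where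

    open Rates N (λ _ → false) Π using (clusterProb; clusterProb-isProbability) public

    κ : ℝ
    κ = fromℕ 16 * fromℕ τ

    -- The mode is decided by the inequality that is wanted in a crowded slot, rather than by
    -- comparing the sum with a threshold. Where it fails, the dichotomy leaves the bound on the
    -- sum.
    crowded? : ∀ t → Dec (κ * probSingle (clusterProb t) ≤ fromℕ 3)
    crowded? t = κ * probSingle (clusterProb t) ≤? fromℕ 3

    crowded : ℕ → Bool
    crowded t = ⌊ crowded? t ⌋

    open Rates N crowded Π using (hazard; hazardSum)

    module _ (dichotomy : ∀ t → κ * probSingle (clusterProb t) ≤ fromℕ 3 ⊎
                                κ * sum (clusterProb t) ≤ fromℕ 3 * fromℕ N) where

      hazard-average : ∀ t → κ * sum (restrict N (hazard t)) ≤ fromℕ 3 * fromℕ N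
      hazard-average t with crowded? t
      ... | yes few = begin
        κ * sum (restrict {n} N (λ _ → F)) ≈⟨ *-congˡ (sum-restrict-const F N≤n) ⟩
        κ * (fromℕ N * F)
          ≈⟨ solve 3 (λ κ N F → κ :* (N :* F) := κ :* F :* N) refl κ (fromℕ N) F ⟩
        κ * F * fromℕ N                    ≤⟨ *-monoʳ-≤ (0≤fromℕ N) few ⟩
        fromℕ 3 * fromℕ N                  ∎
        where
        F = probSingle (clusterProb t)
      ... | no many = begin
        κ * sum (restrict N (clusterProb t)) ≈⟨ *-congˡ (sum-cong-≋ idempotent) ⟩
        κ * sum (clusterProb t)
          ≤⟨ [ ⊥-elim ∘ many , (λ light → light) ]′ (dichotomy t) ⟩
        fromℕ 3 * fromℕ N                    ∎
        where
        idempotent : ∀ i → restrict N (clusterProb t) i ≈ clusterProb t i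
        idempotent i with toℕ i ℕ.<? N
        ... | yes _ = refl
        ... | no  _ = refl

      restrict-+ : ∀ (x y : Fin n → ℝ) i → restrict N (λ i → x i + y i) i ≈ restrict N x i + 1# * restrict N y i
      restrict-+ x y i with toℕ i ℕ.<? N
      ... | yes _ = +-congˡ (sym (*-identityˡ _))
      ... | no  _ = solve 0 (# 0 := # 0 :+ # 1 :* # 0) refl

      -- The modes do not depend on the partner, so the bound of each slot can be summed over the
      -- window before a partner is selected. At `w = τ` the average hazard sum over the cluster is
      -- at most 3/16.
      hazardSum-average : ∀ w t → κ * sum (restrict N (hazardSum w t)) ≤ fromℕ 3 * fromℕ N * fromℕ w
      hazardSum-average zero t = begin
        κ * sum (restrict {n} N (λ _ → 0#)) ≈⟨ *-congˡ (sum-restrict-const 0# N≤n) ⟩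
        κ * (fromℕ N * 0#)
          ≈⟨ solve 2 (λ κ N → κ :* (N :* # 0) := # 3 :* N :* # 0) refl κ (fromℕ N) ⟩
        fromℕ 3 * fromℕ N * 0#              ∎
      hazardSum-average (suc w) t = begin
        κ * sum (restrict N (λ i → hazard t i + hazardSum w (suc t) i))
          ≈⟨ *-congˡ (sum-cong-≋ (restrict-+ (hazard t) (hazardSum w (suc t)))) ⟩
        κ * sum (λ i → restrict N (hazard t) i + 1# * restrict N (hazardSum w (suc t)) i)
          ≈⟨ *-congˡ (sum-+-* (restrict N (hazard t)) (restrict N (hazardSum w (suc t))) 1#) ⟩
        κ * (x + 1# * y)
          ≈⟨ solve 3 (λ κ x y → κ :* (x :+ # 1 :* y) := κ :* x :+ κ :* y) refl κ x y ⟩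
        κ * x + κ * y
          ≤⟨ +-mono-≤ (hazard-average t) (hazardSum-average w (suc t)) ⟩
        fromℕ 3 * fromℕ N + fromℕ 3 * fromℕ N * fromℕ w
          ≈⟨ solve 2 (λ N w → # 3 :* N :+ # 3 :* N :* w := # 3 :* N :* (# 1 :+ w))
               refl (fromℕ N) (fromℕ w) ⟩
        fromℕ 3 * fromℕ N * fromℕ (suc w) ∎
        where
        x = sum (restrict N (hazard t))
        y = sum (restrict N (hazardSum w (suc t)))

      partner-exists : ∀ t → ∃[ p ] toℕ p ℕ.< N × fromℕ 16 * hazardSum τ t p ≤ fromℕ 3
      partner-exists t with τ ℕ.≟ 0
      -- An empty window has no hazard, so any cluster node will do. The averaging below cancels a
      -- factor `τ`, which must be positive.
      ... | yes ≡.refl = i₀ , i₀<N , ≤-trans (≤-reflexive (zeroʳ _)) (0≤fromℕ 3)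
      ... | no  τ≢0    = rescale (below-average (hazardSum τ t) c N≤n i₀ i₀<N average)
        where
        c = fromℕ 3 / fromℕ 16
        0<16 : 0# < fromℕ 16
        0<16 = 0<fromℕ 16 (s≤s z≤n)
        16c≈3 : fromℕ 16 * c ≈ fromℕ 3
        16c≈3 = trans (*-comm _ _) (x/y*y≈x 0<16)
        S = sum (restrict N (hazardSum τ t))
        average : S ≤ fromℕ N * c
        average = *-cancelˡ-≤ (0<-* 0<16 (0<fromℕ τ (ℕ.n≢0⇒n>0 τ≢0))) (begin
          κ * S                          ≤⟨ hazardSum-average τ t ⟩
          fromℕ 3 * fromℕ N * fromℕ τ    ≈⟨ *-congʳ (*-congʳ 16c≈3) ⟨
          fromℕ 16 * c * fromℕ N * fromℕ τ
            ≈⟨ solve 4 (λ s c N τ → s :* c :* N :* τ := s :* τ :* (N :* c))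
                 refl (fromℕ 16) c (fromℕ N) (fromℕ τ) ⟩
          κ * (fromℕ N * c)              ∎)
        rescale : ∃[ p ] toℕ p ℕ.< N × hazardSum τ t p ≤ c →
                  ∃[ p ] toℕ p ℕ.< N × fromℕ 16 * hazardSum τ t p ≤ fromℕ 3
        rescale (p , p<N , Hₚ≤c) =
          p , p<N , ≤-trans (*-monoˡ-≤ (0≤fromℕ 16) Hₚ≤c) (≤-reflexive 16c≈3)

-- Choice of the parameters and the final estimate

module LowerBound (R : CompleteOrderedField) where

  open OrderedField R
  open Geocast R
  open Expectation R
  open LogarithmBounds R
  open Network R
  open Averaging R
  open ≤-Reasoning

  lower-common : ∀ {x y} → 0# < x → 0# < y → ∃[ z ] 0# < z × z ≤ x × z ≤ y
  lower-common {x} {y} 0<x 0<y with total x y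
  ... | inj₁ x≤y = x , 0<x , ≤-refl , x≤y
  ... | inj₂ y≤x = y , 0<y , y≤x , ≤-refl

  x<y⇒0<y-x : ∀ {x y} → x < y → 0# < y - x
  x<y⇒0<y-x {x} {y} x<y = ≰⇒> λ y-x≤0 → <⇒≱ x<y (certificate (x≤y⇒0≤y-x y-x≤0)
    (solve 2 (λ x y → x :- y := # 0 :- (y :- x)) refl x y))

  x<0⇒x⁻¹≤0 : ∀ {x} → x < 0# → x ⁻¹ ≤ 0#
  x<0⇒x⁻¹≤0 {x} x<0 with x ⁻¹ ≤? 0#
  ... | yes x⁻¹≤0 = x⁻¹≤0
  ... | no  x⁻¹≰0 = ⊥-elim (<⇒≱ 0<1 (begin
    1#       ≈⟨ *-inverseʳ x (proj₂ x<0) ⟨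
    x * x ⁻¹ ≤⟨ *-monoʳ-≤ (≰⇒≥ x⁻¹≰0) (<⇒≤ x<0) ⟩
    0# * x ⁻¹ ≈⟨ zeroˡ _ ⟩
    0#       ∎))

  -- The final estimate 2^{4L - 2m} < 2^{-n/2}, cleared of fractions and roots.
  potential-small : ∀ {n s} m L → n ℕ.≤ 2 ℕ.* m → 8 ℕ.* L ℕ.< n → IsSqrt (fromℕ 2 ^ n) s →
                    ¬ s ⁻¹ ≤ quarter ^ m * fromℕ 16 ^ L
  potential-small {n} {s} m L n≤2m 8L<n (0≤s , s²≈2ⁿ) s⁻¹≤ =
    ℕ.<⇒≱ (ℕ.^-monoʳ-< 2 (s≤s (s≤s z≤n)) exponents) (fromℕ-cancel-≤ (begin
      fromℕ (2 ℕ.^ (4 ℕ.* m))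
        ≡⟨ ≡.cong fromℕ (≡.trans (≡.cong (2 ℕ.^_) (ℕ.*-assoc 2 2 m)) (pow m)) ⟩
      fromℕ (4 ℕ.^ m ℕ.* 4 ℕ.^ m)          ≈⟨ fromℕ-* (4 ℕ.^ m) (4 ℕ.^ m) ⟩
      fromℕ (4 ℕ.^ m) * fromℕ (4 ℕ.^ m)    ≈⟨ *-cong (fromℕ-^ 4 m) (fromℕ-^ 4 m) ⟩
      F * F
        ≤⟨ *-mono-≤ (0≤s ⊗ 0≤S) (0≤^ m (0≤fromℕ 4)) F≤sS F≤sS ⟩
      s * S * (s * S)
        ≈⟨ solve 2 (λ s S → s :* S :* (s :* S) := s :* s :* (S :* S)) refl s S ⟩
      s * s * (S * S)                      ≈⟨ *-congʳ s²≈2ⁿ ⟩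
      fromℕ 2 ^ n * (S * S)
        ≈⟨ *-cong (fromℕ-^ 2 n) (*-cong (fromℕ-^ 16 L) (fromℕ-^ 16 L)) ⟨
      fromℕ (2 ℕ.^ n) * (fromℕ (16 ℕ.^ L) * fromℕ (16 ℕ.^ L))
                                           ≈⟨ *-congˡ (fromℕ-* (16 ℕ.^ L) (16 ℕ.^ L)) ⟨
      fromℕ (2 ℕ.^ n) * fromℕ (16 ℕ.^ L ℕ.* 16 ℕ.^ L)
                                           ≈⟨ fromℕ-* (2 ℕ.^ n) _ ⟨
      fromℕ (2 ℕ.^ n ℕ.* (16 ℕ.^ L ℕ.* 16 ℕ.^ L))
                                           ≡⟨ ≡.cong (λ z → fromℕ (2 ℕ.^ n ℕ.* z)) pow₁₆ ⟩
      fromℕ (2 ℕ.^ n ℕ.* 2 ℕ.^ (8 ℕ.* L))  ≡⟨ ≡.cong fromℕ (ℕ.^-distribˡ-+-* 2 n (8 ℕ.* L)) ⟨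
      fromℕ (2 ℕ.^ (n ℕ.+ 8 ℕ.* L))        ∎))
    where
    F = fromℕ 4 ^ m
    S = fromℕ 16 ^ L
    0≤S : 0# ≤ S
    0≤S = 0≤^ L (0≤fromℕ 16)
    -- After squaring, 2^{4m} ≤ 2^n · 16^{2L} would have to hold, whereas n + 8L < 2n ≤ 4m.
    exponents : n ℕ.+ 8 ℕ.* L ℕ.< 4 ℕ.* m
    exponents = ℕ.<-≤-trans (ℕ.+-monoʳ-< n 8L<n) (ℕ.≤-trans (ℕ.+-mono-≤ n≤2m n≤2m)
      (ℕ.≤-reflexive (≡.sym (ℕ.*-distribʳ-+ m 2 2))))
    pow : ∀ m → 2 ℕ.^ (2 ℕ.* (2 ℕ.* m)) ≡ 4 ℕ.^ m ℕ.* 4 ℕ.^ m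
    pow m = ≡.trans (≡.sym (ℕ.^-*-assoc 2 2 (2 ℕ.* m))) (≡.trans
      (≡.cong (4 ℕ.^_) (≡.cong (m ℕ.+_) (ℕ.+-identityʳ m))) (ℕ.^-distribˡ-+-* 4 m m))
    pow₁₆ : 16 ℕ.^ L ℕ.* 16 ℕ.^ L ≡ 2 ℕ.^ (8 ℕ.* L)
    pow₁₆ = ≡.trans (≡.sym (ℕ.^-distribˡ-+-* 16 L L)) (≡.trans
      (ℕ.^-*-assoc 2 4 (L ℕ.+ L)) (≡.cong (2 ℕ.^_) (≡.trans (ℕ.*-distribˡ-+ 4 L L)
        (≡.sym (ℕ.*-distribʳ-+ L 4 4)))))
    0<2ⁿ : 0# < fromℕ 2 ^ n
    0<2ⁿ = <-≤-trans (0<fromℕ (2 ℕ.^ n) (ℕ.m^n>0 2 n)) (≤-reflexive (fromℕ-^ 2 n))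
    0<s : 0# < s
    0<s = ≰⇒> λ s≤0 → <⇒≱ 0<2ⁿ (begin
      fromℕ 2 ^ n  ≈⟨ s²≈2ⁿ ⟨
      s * s        ≤⟨ *-monoʳ-≤ 0≤s s≤0 ⟩
      0# * s       ≈⟨ zeroˡ s ⟩
      0#           ∎)
    4^m*quarter^m : ∀ m → fromℕ 4 ^ m * quarter ^ m ≈ 1#
    4^m*quarter^m zero    = *-identityˡ 1#
    4^m*quarter^m (suc m) = begin-equality
      fromℕ 4 * fromℕ 4 ^ m * (quarter * quarter ^ m)
        ≈⟨ solve 4 (λ f F q Q → f :* F :* (q :* Q) := f :* q :* (F :* Q))
             refl (fromℕ 4) (fromℕ 4 ^ m) quarter (quarter ^ m) ⟩
      fromℕ 4 * quarter * (fromℕ 4 ^ m * quarter ^ m)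
        ≈⟨ *-cong (*-inverse 0<4) (4^m*quarter^m m) ⟩
      1# * 1#
        ≈⟨ *-identityˡ 1# ⟩
      1# ∎
    F≤sS : F ≤ s * S
    F≤sS = begin
      F                            ≈⟨ *-identityʳ F ⟨
      F * 1#                       ≈⟨ *-congˡ (*-inverse 0<s) ⟨
      F * (s * s ⁻¹)               ≤⟨ *-monoˡ-≤ (0≤^ m (0≤fromℕ 4)) (*-monoˡ-≤ 0≤s s⁻¹≤) ⟩
      F * (s * (quarter ^ m * S))
        ≈⟨ solve 4 (λ F s Q S → F :* (s :* (Q :* S)) := F :* Q :* (s :* S))
             refl F s (quarter ^ m) S ⟩
      F * quarter ^ m * (s * S)    ≈⟨ *-congʳ (4^m*quarter^m m) ⟩
      1# * (s * S)                 ≈⟨ *-identityˡ _ ⟩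
      s * S                        ∎

  -- τ is the length of a short contact and L the number of long contacts that
  -- fit into the claimed time.
  record Schedule (n m : ℕ) (e l : ℝ) (α : ℕ) : Set where
    field
      τ L       : ℕ
      few       : 8 ℕ.* L ℕ.< n
      dichotomy : ∀ {N} {p : Fin n → ℝ} → n ℕ.≤ 1 ℕ.+ 2 ℕ.* N → IsProbability p →
                  fromℕ 16 * fromℕ τ * probSingle p ≤ fromℕ 3 ⊎
                  fromℕ 16 * fromℕ τ * sum p ≤ fromℕ 3 * fromℕ N
      enough    : (fromℕ α * fromℕ n) / fromℕ 2 + fromℕ n ^ 2 / (fromℕ 48 * e * l)
                  ≤ fromℕ (α ℕ.* m ℕ.+ suc τ ℕ.* suc L)

  -- `τ` is maximal with 6 e l τ ≤ n and `L` with 8 L < n. Multiplying n ≤ 6 e l (τ + 1) by n ≤ 8 (L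
  -- + 1) gives n² ≤ 48 e l (τ + 1)(L + 1), the contact time; the idle time is at least α n / 2
  -- because n ≤ 2m.
  schedule : ∀ n m e l α → 3 ℕ.< n → n ℕ.≤ 2 ℕ.* m → IsExp 1# e → IsLn (fromℕ n / fromℕ 2) l →
             Schedule n m e l α
  schedule n m e l α 3<n n≤2m exp1 ln = cases
    where
    0<2 : 0# < fromℕ 2
    0<2 = 0<fromℕ 2 (s≤s z≤n)
    0<n : 0 ℕ.< n
    0<n = ℕ.≤-trans (s≤s z≤n) 3<n
    0<e : 0# < e
    0<e = ≰⇒> λ e≤0 → <⇒≱ (0<fromℕ 8 (s≤s z≤n)) (begin
      fromℕ 8       ≤⟨ 8≤3e exp1 ⟩
      fromℕ 3 * e   ≤⟨ *-monoˡ-≤ (0≤fromℕ 3) e≤0 ⟩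
      fromℕ 3 * 0#  ≈⟨ zeroʳ _ ⟩
      0#            ∎)
    idleTime : (fromℕ α * fromℕ n) / fromℕ 2 ≤ fromℕ α * fromℕ m
    idleTime = /-≤ 0<2 (begin
      fromℕ α * fromℕ n               ≤⟨ *-monoˡ-≤ (0≤fromℕ α) (fromℕ-mono-≤ n≤2m) ⟩
      fromℕ α * fromℕ (2 ℕ.* m)       ≈⟨ *-congˡ (fromℕ-* 2 m) ⟩
      fromℕ α * (fromℕ 2 * fromℕ m)
        ≈⟨ solve 2 (λ a m → a :* (# 2 :* m) := a :* m :* # 2) refl (fromℕ α) (fromℕ m) ⟩
      fromℕ α * fromℕ m * fromℕ 2     ∎)
    total-time : ∀ τ L → fromℕ n ^ 2 / (fromℕ 48 * e * l) ≤ fromℕ (suc τ) * fromℕ (suc L) →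
                 (fromℕ α * fromℕ n) / fromℕ 2 + fromℕ n ^ 2 / (fromℕ 48 * e * l)
                 ≤ fromℕ (α ℕ.* m ℕ.+ suc τ ℕ.* suc L)
    total-time τ L contactTime = begin
      (fromℕ α * fromℕ n) / fromℕ 2 + fromℕ n ^ 2 / (fromℕ 48 * e * l)
        ≤⟨ +-mono-≤ idleTime contactTime ⟩
      fromℕ α * fromℕ m + fromℕ (suc τ) * fromℕ (suc L)
        ≈⟨ +-cong (fromℕ-* α m) (fromℕ-* (suc τ) (suc L)) ⟨
      fromℕ (α ℕ.* m) + fromℕ (suc τ ℕ.* suc L)
        ≈⟨ fromℕ-+ (α ℕ.* m) (suc τ ℕ.* suc L) ⟨
      fromℕ (α ℕ.* m ℕ.+ suc τ ℕ.* suc L) ∎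
    y : ℝ
    y = fromℕ 6 * e * l
    -- This case does not occur, but the claimed bound is at most α n / 2 in it,
    -- which avoids proving that exp is below 1 on negative numbers.
    l<0-case : ¬ 0# ≤ l → Schedule n m e l α
    l<0-case 0≰l = record
      { τ         = 0
      ; L         = 0
      ; few       = 0<n
      ; dichotomy = λ {_} {p} _ _ → inj₁ (≤-trans
          (≤-reflexive (solve 1 (λ F → # 16 :* # 0 :* F := # 0)
               refl (probSingle p))) (0≤fromℕ 3))
      ; enough    = total-time 0 0 (begin
          fromℕ n ^ 2 * (fromℕ 48 * e * l) ⁻¹
            ≤⟨ *-monoˡ-≤ (0≤^ 2 (0≤fromℕ n)) (x<0⇒x⁻¹≤0 48el<0) ⟩
          fromℕ n ^ 2 * 0#                    ≈⟨ zeroʳ _ ⟩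
          0#                                  ≤⟨ 0≤fromℕ 1 ⊗ 0≤fromℕ 1 ⟩
          fromℕ 1 * fromℕ 1                   ∎)
      }
      where
      48el<0 : fromℕ 48 * e * l < 0#
      48el<0 = ≰⇒> λ 0≤48el → 0≰l (*-cancelˡ-≤ (0<-* (0<fromℕ 48 (s≤s z≤n)) 0<e)
        (≤-trans (≤-reflexive (zeroʳ _)) 0≤48el))
    16l≤y : 0# ≤ l → fromℕ 16 * l ≤ y
    16l≤y 0≤l = begin
      fromℕ 16 * l               ≈⟨ solve 1 (λ l → # 16 :* l := # 2 :* # 8 :* l) refl l ⟩
      fromℕ 2 * fromℕ 8 * l      ≤⟨ *-monoʳ-≤ 0≤l (*-monoˡ-≤ (0≤fromℕ 2) (8≤3e exp1)) ⟩
      fromℕ 2 * (fromℕ 3 * e) * l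
        ≈⟨ solve 2 (λ e l → # 2 :* (# 3 :* e) :* l := # 6 :* e :* l) refl e l ⟩
      y                          ∎
    1≤y : 0# ≤ l → 1# ≤ y
    1≤y 0≤l = ≤-trans (certificate
      (0≤fromℕ 4 ⊗ x≤y⇒0≤y-x (ln-half-lower n 2 4 ln 0≤l 3<n (toWitness {a? = 32 ℕ.<? 36} tt)) ⊕ 0≤fromℕ 7)
      (solve 1 (λ l → # 16 :* l :- # 1 := # 4 :* (# 4 :* l :- # 2) :+ # 7) refl l)) (16l≤y 0≤l)
    y[1+n]≰n : 0# ≤ l → ¬ y * fromℕ (suc n) ≤ fromℕ n
    y[1+n]≰n 0≤l y[1+n]≤n = ℕ.<-irrefl ≡.refl (fromℕ-cancel-≤ {suc n} {n} (begin
      fromℕ (suc n)       ≈⟨ *-identityˡ _ ⟨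
      1# * fromℕ (suc n)  ≤⟨ *-monoʳ-≤ (0≤fromℕ (suc n)) (1≤y 0≤l) ⟩
      y * fromℕ (suc n)   ≤⟨ y[1+n]≤n ⟩
      fromℕ n             ∎))
    0≤l-case : 0# ≤ l → ∃[ τ ] y * fromℕ τ ≤ fromℕ n × ¬ y * fromℕ (suc τ) ≤ fromℕ n →
               ∃[ L ] 8 ℕ.* L ℕ.< n × ¬ 8 ℕ.* suc L ℕ.< n → Schedule n m e l α
    0≤l-case 0≤l (τ , yτ≤n , y[1+τ]≰n) (L , 8L<n , 8[1+L]≮n) = record
      { τ         = τ
      ; L         = L
      ; few       = 8L<n
      ; dichotomy = λ {N} → split {N}
      ; enough    = total-time τ L (/-≤ 0<48el (begin
          fromℕ n ^ 2
            ≈⟨ *-congˡ (*-identityʳ _) ⟩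
          fromℕ n * fromℕ n
            ≤⟨ *-mono-≤ (<⇒≤ 0<y ⊗ 0≤fromℕ (suc τ)) (0≤fromℕ n) (≰⇒≥ y[1+τ]≰n) n≤8[1+L] ⟩
          y * fromℕ (suc τ) * (fromℕ 8 * fromℕ (suc L))
            ≈⟨ solve 4 (λ e l t L → # 6 :* e :* l :* t :* (# 8 :* L) := t :* L :* (# 48 :* e :* l))
                 refl e l (fromℕ (suc τ)) (fromℕ (suc L)) ⟩
          fromℕ (suc τ) * fromℕ (suc L) * (fromℕ 48 * e * l) ∎))
      }
      where
      0<l : 0# < l
      0<l = 0≤ln⇒0<ln 1<n/2 ln 0≤l
        where
        1<n/2 : 1# < fromℕ n / fromℕ 2
        1<n/2 = ≰⇒> λ n/2≤1 → ℕ.<⇒≱ (ℕ.<-trans (s≤s (s≤s (s≤s z≤n))) 3<n) (fromℕ-cancel-≤ (begin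
          fromℕ n                       ≈⟨ n/2*2≈n n ⟨
          fromℕ n / fromℕ 2 * fromℕ 2   ≤⟨ *-monoʳ-≤ (0≤fromℕ 2) n/2≤1 ⟩
          1# * fromℕ 2                  ≈⟨ *-identityˡ _ ⟩
          fromℕ 2                       ∎))
      0<y : 0# < y
      0<y = 0<-* (0<-* (0<fromℕ 6 (s≤s z≤n)) 0<e) 0<l
      0<48el : 0# < fromℕ 48 * e * l
      0<48el = 0<-* (0<-* (0<fromℕ 48 (s≤s z≤n)) 0<e) 0<l
      n≤8[1+L] : fromℕ n ≤ fromℕ 8 * fromℕ (suc L)
      n≤8[1+L] = ≤-trans (fromℕ-mono-≤ (ℕ.≮⇒≥ 8[1+L]≮n)) (≤-reflexive (fromℕ-* 8 (suc L)))
      κl≤n : fromℕ 16 * fromℕ τ * l ≤ fromℕ n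
      κl≤n = begin
        fromℕ 16 * fromℕ τ * l
          ≈⟨ solve 2 (λ t l → # 16 :* t :* l := # 2 :* # 8 :* (t :* l)) refl (fromℕ τ) l ⟩
        fromℕ 2 * fromℕ 8 * (fromℕ τ * l)
          ≤⟨ *-monoʳ-≤ (0≤fromℕ τ ⊗ 0≤l) (*-monoˡ-≤ (0≤fromℕ 2) (8≤3e exp1)) ⟩
        fromℕ 2 * (fromℕ 3 * e) * (fromℕ τ * l)
          ≈⟨ solve 3 (λ e t l → # 2 :* (# 3 :* e) :* (t :* l) := # 6 :* e :* l :* t)
               refl e (fromℕ τ) l ⟩
        y * fromℕ τ                     ≤⟨ yτ≤n ⟩
        fromℕ n                         ∎
      split : ∀ {N} {p : Fin n → ℝ} → n ℕ.≤ 1 ℕ.+ 2 ℕ.* N → IsProbability p →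
                    fromℕ 16 * fromℕ τ * probSingle p ≤ fromℕ 3 ⊎
                    fromℕ 16 * fromℕ τ * sum p ≤ fromℕ 3 * fromℕ N
      split {N} n≤1+2N = crowded-or-light n N τ ln 0≤l 3<n n≤1+2N κl≤n
    cases : Schedule n m e l α
    cases with 0# ≤? l
    ... | no  0≰l = l<0-case 0≰l
    ... | yes 0≤l = 0≤l-case 0≤l
      -- The search for `τ` may start at `suc n` because `y ≥ 16 l ≥ 1`, where l ≥ 1/2 comes from
      -- (4/3)² < 4/2.
      (last-step (λ τ → y * fromℕ τ ≤? fromℕ n)
        (≤-trans (≤-reflexive (zeroʳ _)) (0≤fromℕ n)) (suc n) (y[1+n]≰n 0≤l))
      (last-step (λ L → 8 ℕ.* L ℕ.<? n) 0<n n (ℕ.≤⇒≯ (ℕ.m≤n*m n 8)))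

  scale : ∀ {n r d Vmax} → 0# < r → r < d → 0# < Vmax →
          ∃[ δ ] 0# < δ × fromℕ (2 ℕ.* n) * δ ≤ Vmax × fromℕ (2 ℕ.* n) * δ < r ×
                 r + fromℕ (2 ℕ.* n) * δ ≤ d
  scale {n} {r} {d} {Vmax} 0<r r<d 0<Vmax
    with lower-common 0<r 0<Vmax
  ... | u , 0<u , u≤r , u≤Vmax with lower-common 0<u (x<y⇒0<y-x r<d)
  ...   | μ , 0<μ , μ≤u , μ≤d-r = δ , 0<δ , ≤-trans (<⇒≤ 2nδ<μ) (≤-trans μ≤u u≤Vmax) ,
    <-≤-trans 2nδ<μ (≤-trans μ≤u u≤r) ,
    certificate (x≤y⇒0≤y-x (≤-trans (<⇒≤ 2nδ<μ) μ≤d-r))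
      (solve 3 (λ r d x → d :- (r :+ x) := d :- r :- x) refl r d _)
    where
    0<M = 0<fromℕ (suc (2 ℕ.* n)) (s≤s z≤n)
    -- `μ` is at most `r`, `Vmax` and `d - r`. Dividing by 2n + 1 rather than 2n makes `2nδ < μ`,
    -- and so `2nδ < r`, strict.
    δ = μ / fromℕ (suc (2 ℕ.* n))
    0<δ : 0# < δ
    0<δ = 0<-* 0<μ (0<⁻¹ 0<M)
    2nδ<μ : fromℕ (2 ℕ.* n) * δ < μ
    2nδ<μ = ≰⇒> λ μ≤2nδ → <⇒≱ 0<δ (certificate (x≤y⇒0≤y-x (begin
      δ * (1# + fromℕ (2 ℕ.* n)) ≈⟨ x/y*y≈x 0<M ⟩
      μ                          ≤⟨ μ≤2nδ ⟩
      fromℕ (2 ℕ.* n) * δ        ∎))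
      (solve 2 (λ δ m → # 0 :- δ := m :* δ :- δ :* (# 1 :+ m)) refl δ (fromℕ (2 ℕ.* n))))

  slow-protocol : ∀ {e l s r d Vmax} n a β → IsExp 1# e → 3 ℕ.< n → IsLn (fromℕ n / fromℕ 2) l →
    IsSqrt (fromℕ 2 ^ n) s → 0# < r → r < d → 0 ℕ.< β → 0# < Vmax → (Π : ObliviousProtocol n) →
    Σ[ 𝒜 ∈ Adversary n Vmax ]
      (let open Execution r d Π 𝒜 in
       IsConnected (suc a) β ×
       (∀ k → s ⁻¹ ≤ probSolvedWithin k →
         (fromℕ (suc a) * fromℕ n) / fromℕ 2 + fromℕ n ^ 2 / (fromℕ 48 * e * l) ≤ fromℕ k))
  slow-protocol {e} {l} {s} {r} {d} {Vmax} n a β exp1 3<n ln sqrt 0<r r<d 0<β 0<Vmax Π =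
    finish (build (scale {n} 0<r r<d 0<Vmax)
      (partner-exists λ t → dichotomy {N} n≤1+2N (clusterProb-isProbability t)))
    where
    N = ⌊ n /2⌋
    m = ⌈ n /2⌉
    N+m≡n : N ℕ.+ m ≡ n
    N+m≡n = ℕ.⌊n/2⌋+⌈n/2⌉≡n n
    2≤N : 2 ℕ.≤ N
    2≤N = ℕ.⌊n/2⌋-mono 3<n
    N≤m = ℕ.⌊n/2⌋≤⌈n/2⌉ n
    N<n : N ℕ.< n
    N<n = ℕ.<-≤-trans (ℕ.m<m+n N (ℕ.≤-trans (ℕ.≤-trans (s≤s z≤n) 2≤N) N≤m)) (ℕ.≤-reflexive N+m≡n)
    n≤2m : n ℕ.≤ 2 ℕ.* m
    n≤2m = ℕ.≤-trans (ℕ.≤-reflexive (≡.sym N+m≡n)) (ℕ.+-mono-≤ N≤m (ℕ.m≤m+n m 0))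
    n≤1+2N : n ℕ.≤ 1 ℕ.+ 2 ℕ.* N
    n≤1+2N = ℕ.≤-trans (ℕ.≤-reflexive (≡.sym N+m≡n)) (ℕ.≤-trans
      (ℕ.+-monoʳ-≤ N (ℕ.⌊n/2⌋-mono (ℕ.n≤1+n (suc n))))
      (ℕ.≤-reflexive (≡.trans (ℕ.+-suc N N) (≡.cong (λ z → suc (N ℕ.+ z)) (≡.sym (ℕ.+-identityʳ N))))))
    node : ∀ k → k ℕ.< 2 → Fin n
    node k k<2 = fromℕ< (ℕ.<-trans (ℕ.<-≤-trans k<2 2≤N) N<n)
    toℕ-node : ∀ k k<2 → toℕ (node k k<2) ≡ k
    toℕ-node k k<2 = toℕ-fromℕ< _
    node<N : ∀ k k<2 → toℕ (node k k<2) ℕ.< N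
    node<N k k<2 = ≡.subst (ℕ._< N) (≡.sym (toℕ-node k k<2)) (ℕ.<-≤-trans k<2 2≤N)
    0<2 = s≤s z≤n
    1<2 = s≤s (s≤s z≤n)
    src≢mate : node 0 0<2 ≢ node 1 1<2
    src≢mate eq with () ← ≡.trans (≡.sym (toℕ-node 0 0<2)) (≡.trans (≡.cong toℕ eq) (toℕ-node 1 1<2))
    open Schedule (schedule n m e l (suc a) 3<n n≤2m exp1 ln)
    open Partners {n} {N} (ℕ.<⇒≤ N<n) (node 0 0<2) (node<N 0 0<2) τ Π
    open Rates N crowded Π using (hazardSum)
    build : (∃[ δ ] 0# < δ × fromℕ (2 ℕ.* n) * δ ≤ Vmax × fromℕ (2 ℕ.* n) * δ < r ×
               r + fromℕ (2 ℕ.* n) * δ ≤ d) →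
            (∀ t → ∃[ p ] toℕ p ℕ.< N × fromℕ 16 * hazardSum τ t p ≤ fromℕ 3) →
            SlowAdversary Vmax r d Π (suc a) β N τ
    build (δ , 0<δ , 2nδ≤Vmax , 2nδ<r , r+2nδ≤d) partners =
      Strategy.Potential.slow-adversary {n} {Vmax} r d δ 0<δ 2nδ≤Vmax 2nδ<r r+2nδ≤d
        N a N<n (node 0 0<2) (node 1 1<2) (node<N 0 0<2) (node<N 1 1<2) src≢mate
        crowded (proj₁ ∘ partners) (proj₁ ∘ proj₂ ∘ partners) Π τ (proj₂ ∘ proj₂ ∘ partners) β 0<β
    finish : SlowAdversary Vmax r d Π (suc a) β N τ → Σ[ 𝒜 ∈ Adversary n Vmax ]
      (let open Execution r d Π 𝒜 in
       IsConnected (suc a) β ×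
       (∀ k → s ⁻¹ ≤ probSolvedWithin k →
         (fromℕ (suc a) * fromℕ n) / fromℕ 2 + fromℕ n ^ 2 / (fromℕ 48 * e * l) ≤ fromℕ k))
    finish (𝒜 , connected , bound) = 𝒜 , connected , slow
      where
      open Execution r d Π 𝒜 using (probSolvedWithin)
      slow : ∀ k → s ⁻¹ ≤ probSolvedWithin k →
             (fromℕ (suc a) * fromℕ n) / fromℕ 2 + fromℕ n ^ 2 / (fromℕ 48 * e * l) ≤ fromℕ k
      slow k s⁻¹≤prob with k ℕ.<? suc a ℕ.* m ℕ.+ suc τ ℕ.* suc L
      ... | no  k≮ = ≤-trans enough (fromℕ-mono-≤ (ℕ.≮⇒≥ k≮))
      -- The time admits at most `L` long contacts, so the bound is taken at `suc L`, whose weight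
      -- is 16^L.
      ... | yes k< = ⊥-elim (potential-small m L n≤2m few sqrt
        (≤-trans s⁻¹≤prob (bound k m (suc L) N+m≡n k<)))

theorem10 : ExcludedMiddle 0ℓ →
    (R : CompleteOrderedField) →
    let open Reals R
        open Geocast R
    in
    (circ e : ℝ) → IsCircleConstant circ → IsExp 1# e →
    (n : ℕ) → 3 ℕ.< n →
    (lnHalfN : ℝ) → IsLn (fromℕ n / fromℕ 2) lnHalfN →
    (sqrt2ⁿ : ℝ) → IsSqrt (fromℕ 2 ^ n) sqrt2ⁿ →
    (r d : ℝ) → 0# < r → r < d →
    (α β : ℕ) → 0 ℕ.< β →
    (Vmax : ℝ) → Vmax >[ circ * r / 6 ℕ.* α ] →
    (Π : ObliviousProtocol n) →
    Σ[ 𝒜 ∈ Adversary n Vmax ]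
      (let open Execution r d Π 𝒜 in
       IsConnected α β ×
       (∀ k → sqrt2ⁿ ⁻¹ ≤ probSolvedWithin k →
         (fromℕ α * fromℕ n) / fromℕ 2
           + fromℕ n ^ 2 / (fromℕ 48 * e * lnHalfN)
         ≤ fromℕ k))
-- For α = 0 the speed condition is empty, so α is `suc a` and its predecessor counts the idle slots
-- after the first. The lower bound on `Vmax` is positive, which leaves room for the movements of
-- size at most 2nδ.
theorem10 _ R circ e (0<circ , _) exp1 n 3<n l ln s sqrt r d 0<r r<d (suc a) β 0<β Vmax fast Π =
  LowerBound.slow-protocol R n a β exp1 3<n ln sqrt 0<r r<d 0<β 0<Vmax Π
  where
  open OrderedField R
  0<Vmax : 0# < Vmax
  0<Vmax = <-≤-trans (0<-* (0<-* 0<circ 0<r) (0<⁻¹ (0<fromℕ (6 ℕ.* suc a) (s≤s z≤n)))) (<⇒≤ fast)
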